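{- As $p\to\infty$ through primes, we have $$M(p)\le p^{3/2+o(1)}.$$
   Context: An integer $n$ is $y$-smooth if all prime divisors of $n$ do not exceed $y$; it is square-free if it is not divisible by the square of a prime. For a prime $p$, $M(p)$ denotes the smallest integer $M$ such that every residue class modulo $p$ (including the class of $0$) contains a positive $p$-smooth square-free representative not exceeding $M$; $M(p)=\infty$ if no such $M$ exists. The $o(1)$ is a quantity tending to $0$ as $p\to\infty$. -}

module Defs where

open import Data.Empty using (⊥)
open import Data.Integer as ℤ using (ℤ; +_; -[1+_])
import Data.Integer.Divisibility as ℤ
open import Data.Nat using (ℕ; suc; _*_; _^_; _≤_; _<_)
open import Data.Nat.Divisibility using (_∣_)
open import Data.Nat.Primality using (Prime)
open import Data.Product using (_×_; ∃-syntax)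
open import Data.Rational as ℚ using (ℚ; 0ℚ; ↥_; ↧ₙ_)
open import Relation.Nullary using (¬_)
open import Relation.Nullary.Construct.Add.Supremum using (_⁺; [_]; ⊤⁺)

Smooth : ℕ → ℕ → Set
Smooth y n = ∀ q → Prime q → q ∣ n → q ≤ y

SquareFree : ℕ → Set
SquareFree n = ∀ q → Prime q → ¬ (q ^ 2 ∣ n)

-- Residue classes modulo p are given by arbitrary integer representatives a.
CoversResidues : ℕ → ℕ → Set
CoversResidues p m =
  ∀ (a : ℤ) → ∃[ n ] 0 < n × n ≤ m × Smooth p n × SquareFree n
                   × (+ p) ℤ.∣ ((+ n) ℤ.- a)

-- The graph of p ↦ M(p), where ⊤⁺ stands for ∞.  The minimum is taken over ℕ:
-- the representatives are positive, so no negative integer bounds them.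
IsM : ℕ → ℕ ⁺ → Set
IsM p [ m ] = CoversResidues p m × (∀ m′ → CoversResidues p m′ → m ≤ m′)
IsM p ⊤⁺    = ∀ m → ¬ CoversResidues p m

-- m ≤ b^(k/d) for b, d > 0, with the d-th root and any negative power of b
-- cleared.
PowerBound : ℕ → ℕ → ℤ → ℕ → Set
PowerBound m b (+ k)    d = m ^ d ≤ b ^ k
PowerBound m b -[1+ k ] d = m ^ d * b ^ suc k ≤ 1

infix 4 _≤_^ℚ_

-- x ≤ b^r as real numbers, for b > 0; the value ∞ satisfies no such bound.
_≤_^ℚ_ : ℕ ⁺ → ℕ → ℚ → Set
[ m ] ≤ b ^ℚ r = PowerBound m b (↥ r) (↧ₙ r)
⊤⁺    ≤ b ^ℚ r = ⊥

TendsToZeroAlongPrimes : (ℕ → ℚ) → Set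
TendsToZeroAlongPrimes f =
  ∀ ε → 0ℚ ℚ.< ε → ∃[ N ] (∀ p → Prime p → N ≤ p → ℚ.∣ f p ∣ ℚ.< ε)

{-# OPTIONS --safe #-}

-- Let p ∤ a.  For primes y and z below p, write a ≡ u y z modulo p with
-- 1 ≤ u < p; then n = u y z is p-smooth.  Take z of size p^ε and y slightly
-- above √p, so that n ≤ p^(3/2 + ε).  It remains to choose y and z such that n
-- is squarefree.
--
-- Small d.  Put r ≡ −a/y.  Whether d² ∣ u depends only on r modulo z and d²,
-- and it happens with density about 1/d²; for distinct z these events are
-- nearly independent.  Take k disjoint blocks of m primes z.  Multiplying the
-- variances of the k block counts, one sees that at most about p / m^k residues
-- r are bad, i.e. have in every block too many z with d² ∣ u for some small d.
-- As p / m^k is about √p, most y have a good block, and there at least a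
-- quarter of the z are left, because Σ 1/d² over d = 2 and
-- odd d ≥ 3 is below 1/2.  Residues below p are not equidistributed well enough
-- modulo M = d² z z′ ⋯ < p for this; but each averaging over p consecutive
-- shifts multiplies an M-periodic function of mean zero by at most M/p, so the
-- sum over [np, (n+1)p) is replaced by an n-fold average.
--
-- Large d.  For a fixed z, the numbers u y lie below p Y in one residue class
-- modulo p; at most Y/d² + 1 numbers there are divisible by d², and each of
-- them has at most three prime factors y > √p.  The sum over d is negligible.
--
-- Enough primes are supplied by 4^n ≤ lcm(1, …, 2n + 1).
module Submission where

open import Defs
open import Algebra.Bundles using (AbelianGroup)
open import Algebra.Structures using (IsCommutativeSemiring)
open import Data.Bool using (true; false; if_then_else_)
import Data.Integer as ℤ
import Data.Integer.Properties as ℤ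
open import Data.List using (List; []; _∷_; _++_; map; filter; concat; take; drop; upTo; length; cartesianProduct)
open import Data.List.Membership.Propositional using (_∈_; find; lose)
open import Data.List.Membership.Propositional.Properties
  using (∈-map⁺; ∈-map⁻; ∈-++⁺ˡ; ∈-++⁺ʳ; ∈-++⁻; ∈-filter⁺; ∈-filter⁻; ∈-upTo⁺; ∈-upTo⁻;
         ∈-concat⁺′; ∈-concat⁻′; ∈-cartesianProduct⁻)
open import Data.List.Properties
  using (length-map; length-++; length-take; length-drop; length-upTo; take++drop≡id; map-upTo; upTo-∷ʳ)
open import Data.List.Relation.Unary.All as All using (All; []; _∷_; all?)
open import Data.List.Relation.Unary.All.Properties using (¬All⇒Any¬)
open import Data.List.Relation.Unary.AllPairs using (AllPairs; []; _∷_)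
open import Data.List.Relation.Unary.Any using (Any; here; there; any?)
open import Data.List.Relation.Unary.Unique.Propositional using (Unique)
import Data.List.Relation.Unary.Unique.Propositional.Properties as Unique
open import Data.Nat as ℕ using (ℕ; zero; suc; z≤n; s≤s; NonZero)
open import Data.Nat.Coprimality as Coprime
  using (Coprime; coprime?; coprime-Bézout; coprime-divisor; coprime-factors; prime⇒coprime; 1-coprimeTo)
open import Data.Nat.Divisibility
open import Data.Nat.DivMod using (m≡m%n+[m/n]*n; m%n≤n; m%n<n; m<n*o⇒m/o<n)
open import Data.Nat.GCD using (module Bézout)
open import Data.Nat.Induction using (<-rec)
open import Data.Nat.ListAction using (product)
open import Data.Nat.ListAction.Properties using (∈⇒∣product)
open import Data.Nat.Primality
  using (Prime; prime?; prime⇒irreducible; prime⇒nonZero; prime⇒nonTrivial; euclidsLemma; ¬prime[1])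
open import Data.Nat.Primality.Factorisation using (factorise)
import Data.Nat.Properties as ℕ
open import Data.Product using (_×_; _,_; proj₁; proj₂; ∃-syntax)
open import Data.Sum using (_⊎_; inj₁; inj₂; [_,_]′)
open import Function using (_∘_)
open import Relation.Binary.PropositionalEquality hiding (J)
open import Relation.Nullary using (¬_; Dec; yes; no; does; contradiction)
open import Relation.Nullary.Construct.Add.Supremum using ([_])
open import Relation.Nullary.Decidable using (map′; _×-dec_; _→-dec_; ¬?)

-- Of the residues -a/y for prime y only one thing is used: they are distinct. So the bad residues
-- modulo p must themselves be fewer than the y, and one variance is not enough, since it saves a
-- single factor m, a small power of p. A product of k variances saves m^k. But its terms involve up
-- to 2k primes z, so their period is near m^(2k), and this has to stay below p. Hence m^k can
-- approach √p but not pass it, which is why y lies slightly above √p.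
--
-- When the period M is only slightly below p, one sum over an interval of length p has an error
-- factor M/p that is too weak against the number of products and their size. With n averages the
-- factor is (M/p)^n, at the cost of a factor n + 1 for a longer window.
--
-- Summing over d costs about D^5 per block: at most D values of d, and d⁴ ≤ D⁴ from each variance.
-- Therefore D is a much smaller power of p than m.
--
-- For u y z to be squarefree, y ∣ u and z ∣ u have to be excluded as well; both are rare and are
-- counted together with the large d.

-- Finite sums over a commutative semiring.

module Sum {R : Set} {_⊕_ _⊗_ : R → R → R} {0# 1# : R}
           (isCSR : IsCommutativeSemiring _≡_ _⊕_ _⊗_ 0# 1#) where

  open IsCommutativeSemiring isCSR
    using (+-assoc; +-comm; +-identityˡ; +-identityʳ; distribˡ; zeroʳ; *-comm)
  open ≡-Reasoning

  ∑ : {A : Set} → List A → (A → R) → R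
  ∑ []       f = 0#
  ∑ (x ∷ xs) f = f x ⊕ ∑ xs f

  ∑< : ℕ → (ℕ → R) → R
  ∑< n = ∑ (upTo n)

  module _ {A : Set} where

    ∑-cong : ∀ (xs : List A) {f g} → (∀ x → f x ≡ g x) → ∑ xs f ≡ ∑ xs g
    ∑-cong []       eq = refl
    ∑-cong (x ∷ xs) eq = cong₂ _⊕_ (eq x) (∑-cong xs eq)

    ∑-0 : ∀ (xs : List A) → ∑ xs (λ _ → 0#) ≡ 0#
    ∑-0 []       = refl
    ∑-0 (x ∷ xs) = trans (+-identityˡ _) (∑-0 xs)

    +-interchange : ∀ a b c d → (a ⊕ b) ⊕ (c ⊕ d) ≡ (a ⊕ c) ⊕ (b ⊕ d)
    +-interchange a b c d = begin
      (a ⊕ b) ⊕ (c ⊕ d) ≡⟨ +-assoc a b _ ⟩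
      a ⊕ (b ⊕ (c ⊕ d)) ≡⟨ cong (a ⊕_) (sym (+-assoc b c d)) ⟩
      a ⊕ ((b ⊕ c) ⊕ d) ≡⟨ cong (λ t → a ⊕ (t ⊕ d)) (+-comm b c) ⟩
      a ⊕ ((c ⊕ b) ⊕ d) ≡⟨ cong (a ⊕_) (+-assoc c b d) ⟩
      a ⊕ (c ⊕ (b ⊕ d)) ≡⟨ sym (+-assoc a c _) ⟩
      (a ⊕ c) ⊕ (b ⊕ d) ∎

    ∑-+ : ∀ (xs : List A) f g → ∑ xs (λ x → f x ⊕ g x) ≡ ∑ xs f ⊕ ∑ xs g
    ∑-+ []       f g = sym (+-identityˡ 0#)
    ∑-+ (x ∷ xs) f g =
      trans (cong ((f x ⊕ g x) ⊕_) (∑-+ xs f g)) (+-interchange (f x) (g x) _ _)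

    ∑-*ˡ : ∀ (xs : List A) a f → ∑ xs (λ x → a ⊗ f x) ≡ a ⊗ ∑ xs f
    ∑-*ˡ []       a f = sym (zeroʳ a)
    ∑-*ˡ (x ∷ xs) a f =
      trans (cong ((a ⊗ f x) ⊕_) (∑-*ˡ xs a f)) (sym (distribˡ a (f x) _))

    ∑-*ʳ : ∀ (xs : List A) a f → ∑ xs (λ x → f x ⊗ a) ≡ ∑ xs f ⊗ a
    ∑-*ʳ xs a f = trans (∑-cong xs (λ x → *-comm (f x) a))
                        (trans (∑-*ˡ xs a f) (*-comm a _))

    ∑-++ : ∀ (xs ys : List A) f → ∑ (xs ++ ys) f ≡ ∑ xs f ⊕ ∑ ys f
    ∑-++ []       ys f = sym (+-identityˡ _)
    ∑-++ (x ∷ xs) ys f =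
      trans (cong (f x ⊕_) (∑-++ xs ys f)) (sym (+-assoc (f x) _ _))

    ∑-map : ∀ {B : Set} (h : B → A) xs f → ∑ (map h xs) f ≡ ∑ xs (f ∘ h)
    ∑-map h []       f = refl
    ∑-map h (x ∷ xs) f = cong (f (h x) ⊕_) (∑-map h xs f)

  ∑-swap : ∀ {A B : Set} (xs : List A) (ys : List B) (f : A → B → R) →
           ∑ xs (λ x → ∑ ys (f x)) ≡ ∑ ys (λ y → ∑ xs (λ x → f x y))
  ∑-swap []       ys f = sym (∑-0 ys)
  ∑-swap (x ∷ xs) ys f =
    trans (cong (∑ ys (f x) ⊕_) (∑-swap xs ys f)) (sym (∑-+ ys (f x) _))

  ∑-*-∑ : ∀ {A B : Set} (xs : List A) (ys : List B) f g →
          ∑ xs f ⊗ ∑ ys g ≡ ∑ xs (λ x → ∑ ys (λ y → f x ⊗ g y))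
  ∑-*-∑ xs ys f g = trans (sym (∑-*ʳ xs (∑ ys g) f))
                          (∑-cong xs (λ x → sym (∑-*ˡ ys (f x) g)))

  ∑-cartesianProduct : ∀ {A B : Set} (xs : List A) (ys : List B) (f : A × B → R) →
                       ∑ (cartesianProduct xs ys) f ≡ ∑ xs (λ x → ∑ ys (λ y → f (x , y)))
  ∑-cartesianProduct []       ys f = refl
  ∑-cartesianProduct (x ∷ xs) ys f = trans (∑-++ (map (x ,_) ys) _ f)
    (cong₂ _⊕_ (∑-map (x ,_) ys f) (∑-cartesianProduct xs ys f))

  ∑<-suc : ∀ n f → ∑< (suc n) f ≡ f 0 ⊕ ∑< n (f ∘ suc)
  ∑<-suc n f = cong (f 0 ⊕_) (trans (cong (λ l → ∑ l f) (sym (map-upTo suc n)))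
                                    (∑-map suc (upTo n) f))

  ∑<-sucʳ : ∀ n f → ∑< (suc n) f ≡ ∑< n f ⊕ f n
  ∑<-sucʳ n f = trans (cong (λ l → ∑ l f) (sym (upTo-∷ʳ n)))
                (trans (∑-++ (upTo n) _ f) (cong (∑< n f ⊕_) (+-identityʳ (f n))))

  ∑<-+ : ∀ m n f → ∑< (m ℕ.+ n) f ≡ ∑< m f ⊕ ∑< n (λ i → f (m ℕ.+ i))
  ∑<-+ zero    n f = sym (+-identityˡ _)
  ∑<-+ (suc m) n f = begin
    ∑< (suc (m ℕ.+ n)) f                                    ≡⟨ ∑<-suc (m ℕ.+ n) f ⟩
    f 0 ⊕ ∑< (m ℕ.+ n) (f ∘ suc)                            ≡⟨ cong (f 0 ⊕_) (∑<-+ m n (f ∘ suc)) ⟩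
    f 0 ⊕ (∑< m (f ∘ suc) ⊕ ∑< n (λ i → f (suc m ℕ.+ i)))   ≡⟨ sym (+-assoc (f 0) _ _) ⟩
    (f 0 ⊕ ∑< m (f ∘ suc)) ⊕ ∑< n (λ i → f (suc m ℕ.+ i))   ≡⟨ cong (_⊕ ∑< n (λ i → f (suc m ℕ.+ i))) (sym (∑<-suc m f)) ⟩
    ∑< (suc m) f ⊕ ∑< n (λ i → f (suc m ℕ.+ i))             ∎

  ∑<-* : ∀ m n f → ∑< (n ℕ.* m) f ≡ ∑< n (λ t → ∑< m (λ i → f (t ℕ.* m ℕ.+ i)))
  ∑<-* m zero    f = refl
  ∑<-* m (suc n) f = begin
    ∑< (m ℕ.+ n ℕ.* m) f
      ≡⟨ ∑<-+ m (n ℕ.* m) f ⟩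
    ∑< m f ⊕ ∑< (n ℕ.* m) (λ i → f (m ℕ.+ i))
      ≡⟨ cong (∑< m f ⊕_) (∑<-* m n _) ⟩
    ∑< m f ⊕ ∑< n (λ t → ∑< m (λ i → f (m ℕ.+ (t ℕ.* m ℕ.+ i))))
      ≡⟨ cong (∑< m f ⊕_) (∑-cong (upTo n) λ t → ∑-cong (upTo m) λ i →
           cong f (sym (ℕ.+-assoc m (t ℕ.* m) i))) ⟩
    ∑< m f ⊕ ∑< n (λ t → ∑< m (λ i → f (suc t ℕ.* m ℕ.+ i)))
      ≡⟨ sym (∑<-suc n _) ⟩
    ∑< (suc n) (λ t → ∑< m (λ i → f (t ℕ.* m ℕ.+ i))) ∎

module ℕΣ = Sum ℕ.+-*-isCommutativeSemiring
module ℤΣ = Sum ℤ.+-*-isCommutativeSemiring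

-- Indicators and counting inequalities.

module NatSums where

  open import Data.Nat
  open import Data.Nat.Properties
  open ℕΣ

  ι : {P : Set} → Dec P → ℕ
  ι d = if does d then 1 else 0

  ι-yes : ∀ {P : Set} (d : Dec P) → P → ι d ≡ 1
  ι-yes (yes _) p = refl
  ι-yes (no ¬p) p = contradiction p ¬p

  ι-no : ∀ {P : Set} (d : Dec P) → ¬ P → ι d ≡ 0
  ι-no (yes p) ¬p = contradiction p ¬p
  ι-no (no _)  ¬p = refl

  ι≤1 : ∀ {P : Set} (d : Dec P) → ι d ≤ 1
  ι≤1 (yes _) = ≤-refl
  ι≤1 (no _)  = z≤n

  ι-elim : ∀ {P : Set} (d : Dec P) (Q : ℕ → Set) → (P → Q 1) → (¬ P → Q 0) → Q (ι d)
  ι-elim (yes p) Q y n = y p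
  ι-elim (no ¬p) Q y n = n ¬p

  ι-all-∷ : ∀ {A : Set} {P : A → Set} (P? : ∀ x → Dec (P x)) x xs →
            ι (All.all? P? (x ∷ xs)) ≡ ι (P? x) * ι (All.all? P? xs)
  ι-all-∷ P? x xs with does (P? x) | does (All.all? P? xs)
  ... | true  | true  = refl
  ... | true  | false = refl
  ... | false | true  = refl
  ... | false | false = refl

  ι-⇔ : ∀ {P Q : Set} (d : Dec P) (e : Dec Q) → (P → Q) → (Q → P) → ι d ≡ ι e
  ι-⇔ (yes p) e f g = sym (ι-yes e (f p))
  ι-⇔ (no ¬p) e f g = sym (ι-no e (¬p ∘ g))

  module _ {A : Set} where

    ∑-mono : ∀ (xs : List A) {f g} → (∀ x → x ∈ xs → f x ≤ g x) → ∑ xs f ≤ ∑ xs g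
    ∑-mono []       le = z≤n
    ∑-mono (x ∷ xs) le = +-mono-≤ (le x (here refl)) (∑-mono xs (λ y → le y ∘ there))

    ∑-const : ∀ (xs : List A) c → ∑ xs (λ _ → c) ≡ length xs * c
    ∑-const []       c = refl
    ∑-const (x ∷ xs) c = cong (c +_) (∑-const xs c)

    ∑-const-≤ : ∀ (xs : List A) c {f} → (∀ x → x ∈ xs → f x ≤ c) → ∑ xs f ≤ length xs * c
    ∑-const-≤ xs c le = ≤-trans (∑-mono xs le) (≤-reflexive (∑-const xs c))

    ∑-∈ : ∀ (xs : List A) f {x} → x ∈ xs → f x ≤ ∑ xs f
    ∑-∈ (x ∷ xs) f (here refl) = m≤m+n _ _
    ∑-∈ (x ∷ xs) f (there p)   = ≤-trans (∑-∈ xs f p) (m≤n+m _ _)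

    ∑-∈-0 : ∀ (xs : List A) {f} → (∀ x → x ∈ xs → f x ≡ 0) → ∑ xs f ≡ 0
    ∑-∈-0 []       eq = refl
    ∑-∈-0 (x ∷ xs) eq = cong₂ _+_ (eq x (here refl)) (∑-∈-0 xs (λ y → eq y ∘ there))

    ∑-ι-≤1 : ∀ (xs : List A) {P : A → Set} (P? : ∀ x → Dec (P x)) → Unique xs →
             (∀ x y → x ∈ xs → y ∈ xs → P x → P y → x ≡ y) → ∑ xs (ι ∘ P?) ≤ 1
    ∑-ι-≤1 []       P? _          un = z≤n
    ∑-ι-≤1 (x ∷ xs) P? (x∉ ∷ uxs) un with P? x
    ... | no ¬p = ∑-ι-≤1 xs P? uxs (λ a b a∈ b∈ → un a b (there a∈) (there b∈))
    ... | yes p = ≤-reflexive (cong suc (∑-∈-0 xs λ y y∈ → ι-no (P? y) λ q →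
                    All.lookup x∉ y∈ (un x y (here refl) (there y∈) p q)))

  ∑<-extend : ∀ {m n} f → m ≤ n → ∑< m f ≤ ∑< n f
  ∑<-extend {m} {n} f m≤n = begin
    ∑< m f                                      ≤⟨ m≤m+n _ _ ⟩
    ∑< m f + ∑< (n ∸ m) (λ i → f (m + i))       ≡⟨ sym (∑<-+ m (n ∸ m) f) ⟩
    ∑< (m + (n ∸ m)) f                          ≡⟨ cong (λ k → ∑< k f) (m+[n∸m]≡n m≤n) ⟩
    ∑< n f                                      ∎
    where open ≤-Reasoning

  ∑<-const : ∀ n c → ∑< n (λ _ → c) ≡ n * c
  ∑<-const n c = trans (∑-const (upTo n) c) (cong (_* c) (length-upTo n))

  -- A decidable search, so that the final counting contradiction yields an actual pair `y`, `z`.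
  zero-or-positive : ∀ {A B : Set} (xs : List A) (ys : List B) (f : A → B → ℕ) →
                     (∃[ x ] ∃[ y ] x ∈ xs × y ∈ ys × f x y ≡ 0) ⊎ (∀ x y → x ∈ xs → y ∈ ys → 1 ≤ f x y)
  zero-or-positive xs ys f with any? (λ x → any? (λ y → f x y ≟ 0) ys) xs
  ... | yes found = let x , x∈ , w = find found ; y , y∈ , eq = find w in inj₁ (x , y , x∈ , y∈ , eq)
  ... | no  none  = inj₂ (λ x y x∈ y∈ → n≢0⇒n>0 (λ eq → none (lose x∈ (lose y∈ eq))))

open NatSums

-- Sums of integers.

module IntegerSums where

  open import Data.Integer hiding (suc; NonZero)
  open import Data.Integer.Properties
  open ℤΣ

  module _ {A : Set} where

    ∑ℤ-mono : ∀ (xs : List A) {f g} → (∀ x → x ∈ xs → f x ≤ g x) → ∑ xs f ≤ ∑ xs g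
    ∑ℤ-mono []       le = ≤-refl
    ∑ℤ-mono (x ∷ xs) le = +-mono-≤ (le x (here refl)) (∑ℤ-mono xs (λ y → le y ∘ there))

    ∑ℤ-nonneg : ∀ (xs : List A) {f} → (∀ x → 0ℤ ≤ f x) → 0ℤ ≤ ∑ xs f
    ∑ℤ-nonneg []       le = ≤-refl
    ∑ℤ-nonneg (x ∷ xs) le = +-mono-≤ (le x) (∑ℤ-nonneg xs le)

    ∑ℤ-∈ : ∀ (xs : List A) {f} → (∀ x → 0ℤ ≤ f x) → ∀ {x} → x ∈ xs → f x ≤ ∑ xs f
    ∑ℤ-∈ (x ∷ xs) {f} le (here refl) =
      ≤-trans (≤-reflexive (sym (+-identityʳ (f x)))) (+-monoʳ-≤ (f x) (∑ℤ-nonneg xs le))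
    ∑ℤ-∈ (y ∷ xs) {f} le {x} (there p) =
      ≤-trans (≤-reflexive (sym (+-identityˡ (f x)))) (+-mono-≤ (le y) (∑ℤ-∈ xs le p))

    ∑-pos : ∀ (xs : List A) f → ∑ xs (λ x → + f x) ≡ + ℕΣ.∑ xs f
    ∑-pos []       f = refl
    ∑-pos (x ∷ xs) f = cong (λ t → + f x + t) (∑-pos xs f)

    ∣∑∣≤ : ∀ (xs : List A) f → ∣ ∑ xs f ∣ ℕ.≤ ℕΣ.∑ xs (∣_∣ ∘ f)
    ∣∑∣≤ []       f = z≤n
    ∣∑∣≤ (x ∷ xs) f = ℕ.≤-trans (∣i+j∣≤∣i∣+∣j∣ (f x) _) (ℕ.+-monoʳ-≤ ∣ f x ∣ (∣∑∣≤ xs f))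

    ∑ℤ-const : ∀ (xs : List A) c → ∑ xs (λ _ → c) ≡ + length xs * c
    ∑ℤ-const []       c = sym (*-zeroˡ c)
    ∑ℤ-const (x ∷ xs) c = begin
      c + ∑ xs (λ _ → c)     ≡⟨ cong (λ t → c + t) (∑ℤ-const xs c) ⟩
      c + + length xs * c    ≡⟨ sym (suc-* (+ length xs) c) ⟩
      + suc (length xs) * c  ∎
      where open ≡-Reasoning

  ∣∑<∣≤ : ∀ n f {B} → (∀ x → ∣ f x ∣ ℕ.≤ B) → ∣ ∑< n f ∣ ℕ.≤ n ℕ.* B
  ∣∑<∣≤ n f {B} bd = ℕ.≤-trans (∣∑∣≤ (upTo n) f)
    (ℕ.≤-trans (∑-mono (upTo n) (λ x _ → bd x)) (ℕ.≤-reflexive (∑<-const n B)))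

  ∑<ℤ-const : ∀ n c → ∑< n (λ _ → c) ≡ + n * c
  ∑<ℤ-const n c = trans (∑ℤ-const (upTo n) c) (cong (λ k → + k * c) (length-upTo n))

  ∑<ℤ-extend : ∀ {m n} {f} → (∀ x → 0ℤ ≤ f x) → m ℕ.≤ n → ∑< m f ≤ ∑< n f
  ∑<ℤ-extend {m} {n} {f} f≥0 m≤n = begin
    ∑< m f                                             ≡⟨ sym (+-identityʳ _) ⟩
    ∑< m f + 0ℤ                                        ≤⟨ +-monoʳ-≤ (∑< m f) (∑ℤ-nonneg (upTo (n ℕ.∸ m)) (λ i → f≥0 (m ℕ.+ i))) ⟩
    ∑< m f + ∑< (n ℕ.∸ m) (λ i → f (m ℕ.+ i))          ≡⟨ sym (∑<-+ m (n ℕ.∸ m) f) ⟩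
    ∑< (m ℕ.+ (n ℕ.∸ m)) f                             ≡⟨ cong (λ k → ∑< k f) (ℕ.m+[n∸m]≡n m≤n) ⟩
    ∑< n f                                             ∎
    where open ≤-Reasoning

-- Iterated averages of periodic functions.

module Averaging where

  open import Data.Integer hiding (suc; NonZero)
  open import Data.Integer.Properties
  open ℤΣ
  open IntegerSums

  open import Algebra.Properties.Group (AbelianGroup.group +-0-abelianGroup) using (∙-cancelˡ)
  open import Data.Nat.Tactic.RingSolver using (solve-∀)

  Periodic : ℕ → (ℕ → ℤ) → Set
  Periodic M f = ∀ x → f (x ℕ.+ M) ≡ f x

  periodic-∣ : ∀ {M f} k → Periodic M f → Periodic (k ℕ.* M) f
  periodic-∣ {M} {f} zero    per x = cong f (ℕ.+-identityʳ x)
  periodic-∣ {M} {f} (suc k) per x = begin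
    f (x ℕ.+ (M ℕ.+ k ℕ.* M)) ≡⟨ cong f (sym (ℕ.+-assoc x M _)) ⟩
    f (x ℕ.+ M ℕ.+ k ℕ.* M)   ≡⟨ periodic-∣ k per (x ℕ.+ M) ⟩
    f (x ℕ.+ M)               ≡⟨ per x ⟩
    f x                       ∎
    where open ≡-Reasoning

  ∑<-shift : ∀ {M f} → Periodic M f → ∀ x → ∑< M (λ j → f (x ℕ.+ j)) ≡ ∑< M f
  ∑<-shift           per zero    = refl
  ∑<-shift {M} {f} per (suc x) = trans (∙-cancelˡ (f (x ℕ.+ 0)) _ _ eq) (∑<-shift per x)
    where
    open ≡-Reasoning
    g = λ j → f (x ℕ.+ j)
    eq : g 0 + ∑< M (λ j → f (suc x ℕ.+ j)) ≡ g 0 + ∑< M g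
    eq = begin
      g 0 + ∑< M (λ j → f (suc x ℕ.+ j)) ≡⟨ cong (λ t → g 0 + t) (∑-cong (upTo M) λ j → cong f (sym (ℕ.+-suc x j))) ⟩
      g 0 + ∑< M (g ∘ suc)               ≡⟨ sym (∑<-suc M g) ⟩
      ∑< (suc M) g                       ≡⟨ ∑<-sucʳ M g ⟩
      ∑< M g + g M                       ≡⟨ +-comm (∑< M g) (g M) ⟩
      g M + ∑< M g                       ≡⟨ cong (λ t → t + ∑< M g) (trans (per x) (cong f (sym (ℕ.+-identityʳ x)))) ⟩
      g 0 + ∑< M g                       ∎

  -- Not divided by `L`, so that values stay integers; powers of `L` are carried along instead.
  Avg : ℕ → (ℕ → ℤ) → (ℕ → ℤ)
  Avg L f x = ∑< L (λ j → f (x ℕ.+ j))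

  Avgⁿ : ℕ → ℕ → (ℕ → ℤ) → (ℕ → ℤ)
  Avgⁿ L zero    f = f
  Avgⁿ L (suc n) f = Avg L (Avgⁿ L n f)

  Avgⁿ-cong : ∀ L n {f g} → (∀ x → f x ≡ g x) → ∀ x → Avgⁿ L n f x ≡ Avgⁿ L n g x
  Avgⁿ-cong L zero    eq x = eq x
  Avgⁿ-cong L (suc n) eq x = ∑-cong (upTo L) λ j → Avgⁿ-cong L n eq (x ℕ.+ j)

  Avgⁿ-+ : ∀ L n f g x → Avgⁿ L n (λ x → f x + g x) x ≡ Avgⁿ L n f x + Avgⁿ L n g x
  Avgⁿ-+ L zero    f g x = refl
  Avgⁿ-+ L (suc n) f g x = trans (∑-cong (upTo L) λ j → Avgⁿ-+ L n f g (x ℕ.+ j)) (∑-+ (upTo L) _ _)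

  Avgⁿ-* : ∀ L n a f x → Avgⁿ L n (λ x → a * f x) x ≡ a * Avgⁿ L n f x
  Avgⁿ-* L zero    a f x = refl
  Avgⁿ-* L (suc n) a f x = trans (∑-cong (upTo L) λ j → Avgⁿ-* L n a f (x ℕ.+ j)) (∑-*ˡ (upTo L) a _)

  Avgⁿ-const : ∀ L n c x → Avgⁿ L n (λ _ → c) x ≡ + (L ℕ.^ n) * c
  Avgⁿ-const L zero    c x = sym (*-identityˡ c)
  Avgⁿ-const L (suc n) c x = begin
    ∑< L (λ j → Avgⁿ L n (λ _ → c) (x ℕ.+ j)) ≡⟨ ∑-cong (upTo L) (λ j → Avgⁿ-const L n c (x ℕ.+ j)) ⟩
    ∑< L (λ _ → + (L ℕ.^ n) * c)              ≡⟨ ∑<ℤ-const L _ ⟩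
    + L * (+ (L ℕ.^ n) * c)                   ≡⟨ sym (*-assoc (+ L) _ c) ⟩
    + L * + (L ℕ.^ n) * c                     ≡⟨ cong (λ t → t * c) (sym (pos-* L _)) ⟩
    + (L ℕ.* L ℕ.^ n) * c                     ∎
    where open ≡-Reasoning

  record Balanced (M B : ℕ) (f : ℕ → ℤ) : Set where
    field
      periodic : Periodic M f
      sum≡0    : ∑< M f ≡ 0ℤ
      bounded  : ∀ x → ∣ f x ∣ ℕ.≤ B

  -- Full periods among the `L` shifts cancel, so only `L % M` terms survive and the bound is free
  -- of `L`. Against the trivial bound `L * B` this gains a factor M/L; as the result is balanced
  -- again, the gain can be iterated.
  Avg-balanced : ∀ {M B f} .{{_ : NonZero M}} L → Balanced M B f → Balanced M (M ℕ.* B) (Avg L f)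
  Avg-balanced {M} {B} {f} L bal = record
    { periodic = λ x → ∑-cong (upTo L) λ j → trans (cong f (swap x j)) (periodic (x ℕ.+ j))
    ; sum≡0    = begin
        ∑< M (λ x → ∑< L (λ j → f (x ℕ.+ j)))  ≡⟨ ∑-swap (upTo M) (upTo L) _ ⟩
        ∑< L (λ j → ∑< M (λ x → f (x ℕ.+ j)))  ≡⟨ ∑-cong (upTo L)
              (λ j → trans (∑-cong (upTo M) λ x → cong f (ℕ.+-comm x j)) (block j)) ⟩
        ∑< L (λ _ → 0ℤ)                        ≡⟨ ∑-0 (upTo L) ⟩
        0ℤ                                     ∎
    ; bounded  = bd
    }
    where
    open Balanced bal
    open ≡-Reasoning
    swap : ∀ x j → x ℕ.+ M ℕ.+ j ≡ x ℕ.+ j ℕ.+ M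
    swap x j = trans (ℕ.+-assoc x M j) (trans (cong (x ℕ.+_) (ℕ.+-comm M j)) (sym (ℕ.+-assoc x j M)))
    block : ∀ x → ∑< M (λ j → f (x ℕ.+ j)) ≡ 0ℤ
    block x = trans (∑<-shift periodic x) sum≡0
    q = L ℕ./ M
    r = L ℕ.% M
    split : ∀ x → Avg L f x ≡ ∑< r (λ j → f (x ℕ.+ j))
    split x = begin
      ∑< L g                                        ≡⟨ cong (λ k → ∑< k g) (m≡m%n+[m/n]*n L M) ⟩
      ∑< (r ℕ.+ q ℕ.* M) g                          ≡⟨ ∑<-+ r (q ℕ.* M) g ⟩
      ∑< r g + ∑< (q ℕ.* M) (λ i → g (r ℕ.+ i))     ≡⟨ cong (λ t → ∑< r g + t) (∑<-* M q _) ⟩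
      ∑< r g + ∑< q (λ t → ∑< M (λ i → g (r ℕ.+ (t ℕ.* M ℕ.+ i))))
        ≡⟨ cong (λ t → ∑< r g + t) (∑-cong (upTo q) λ t → trans (∑-cong (upTo M) λ i → cong f (assoc t i))
              (block (x ℕ.+ (r ℕ.+ t ℕ.* M)))) ⟩
      ∑< r g + ∑< q (λ _ → 0ℤ)                      ≡⟨ cong (λ t → ∑< r g + t) (∑-0 (upTo q)) ⟩
      ∑< r g + 0ℤ                                   ≡⟨ +-identityʳ _ ⟩
      ∑< r g                                        ∎
      where
      g = λ j → f (x ℕ.+ j)
      assoc : ∀ t i → x ℕ.+ (r ℕ.+ (t ℕ.* M ℕ.+ i)) ≡ x ℕ.+ (r ℕ.+ t ℕ.* M) ℕ.+ i
      assoc t i = trans (cong (x ℕ.+_) (sym (ℕ.+-assoc r _ i))) (sym (ℕ.+-assoc x _ i))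
    bd : ∀ x → ∣ Avg L f x ∣ ℕ.≤ M ℕ.* B
    bd x rewrite split x = ℕ.≤-trans (∣∑<∣≤ r _ (λ j → bounded (x ℕ.+ j))) (ℕ.*-monoˡ-≤ B (m%n≤n L M))

  Avgⁿ-balanced : ∀ {M B f} .{{_ : NonZero M}} L n → Balanced M B f →
                  Balanced M (M ℕ.^ n ℕ.* B) (Avgⁿ L n f)
  Avgⁿ-balanced {B = B} L zero    bal rewrite ℕ.*-identityˡ B = bal
  Avgⁿ-balanced {M} {B} L (suc n) bal rewrite ℕ.*-assoc M (M ℕ.^ n) B =
    Avg-balanced L (Avgⁿ-balanced L n bal)

  -- Subtract from `M * h` its sum `S` over a period. The constant `S` is multiplied by exactly
  -- `L ^ n`, and the remainder has mean zero and size at most `2 * (M * B)`. The factor `M`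
  -- replaces a division.
  Avgⁿ-≤-mean : ∀ {M B H h} .{{_ : NonZero M}} L n → Periodic M h → (∀ x → ∣ h x ∣ ℕ.≤ B) →
                ∣ ∑< M h ∣ ℕ.≤ H → ∀ x →
                + M * Avgⁿ L n h x ≤ + (L ℕ.^ n ℕ.* H ℕ.+ M ℕ.^ n ℕ.* (2 ℕ.* (M ℕ.* B)))
  Avgⁿ-≤-mean {M} {B} {H} {h} L n per bd le x = begin
    + M * Avgⁿ L n h x
      ≡⟨ eq ⟩
    + (L ℕ.^ n) * S + Avgⁿ L n f x
      ≤⟨ +-mono-≤ (*-monoˡ-≤-nonNeg (+ (L ℕ.^ n)) (≤-trans (i≤∣i∣ S) (+≤+ le)))
                  (≤-trans (i≤∣i∣ _) (+≤+ (Balanced.bounded (Avgⁿ-balanced L n bal) x))) ⟩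
    + (L ℕ.^ n) * + H + + (M ℕ.^ n ℕ.* (2 ℕ.* (M ℕ.* B)))
      ≡⟨ cong (λ t → t + + (M ℕ.^ n ℕ.* (2 ℕ.* (M ℕ.* B)))) (sym (pos-* (L ℕ.^ n) H)) ⟩
    + (L ℕ.^ n ℕ.* H ℕ.+ M ℕ.^ n ℕ.* (2 ℕ.* (M ℕ.* B))) ∎
    where
    open ≤-Reasoning
    i≤∣i∣ : ∀ i → i ≤ + ∣ i ∣
    i≤∣i∣ (+ _)    = ≤-refl
    i≤∣i∣ -[1+ _ ] = -≤+
    S = ∑< M h
    f : ℕ → ℤ
    f x = + M * h x + - S
    cancel : ∀ a b → b + (a + - b) ≡ a
    cancel a b = trans (+-comm b _) (trans (+-assoc a (- b) b)
                 (trans (cong (λ t → a + t) (+-inverseˡ b)) (+-identityʳ a)))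
    eq : + M * Avgⁿ L n h x ≡ + (L ℕ.^ n) * S + Avgⁿ L n f x
    eq = sym (trans (cong (λ t → + (L ℕ.^ n) * S + t)
          (trans (Avgⁿ-+ L n (λ x → + M * h x) (λ _ → - S) x)
                 (cong₂ _+_ (Avgⁿ-* L n (+ M) h x)
                            (trans (Avgⁿ-const L n (- S) x) (sym (neg-distribʳ-* (+ (L ℕ.^ n)) S))))))
          (cancel _ (+ (L ℕ.^ n) * S)))
    bal : Balanced M (2 ℕ.* (M ℕ.* B)) f
    bal = record
      { periodic = λ y → cong (λ t → + M * t + - S) (per y)
      ; sum≡0    = trans (∑-+ (upTo M) (λ x → + M * h x) (λ _ → - S))
                   (trans (cong₂ _+_ (∑-*ˡ (upTo M) (+ M) h)
                                     (trans (∑<ℤ-const M (- S)) (sym (neg-distribʳ-* (+ M) S))))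
                          (+-inverseʳ (+ M * S)))
      ; bounded  = λ y → ℕ.≤-trans (∣i+j∣≤∣i∣+∣j∣ (+ M * h y) (- S))
          (ℕ.+-mono-≤ (ℕ.≤-trans (ℕ.≤-reflexive (abs-* (+ M) (h y))) (ℕ.*-monoʳ-≤ M (bd y)))
            (ℕ.≤-trans (ℕ.≤-reflexive (∣-i∣≡∣i∣ S))
              (ℕ.≤-trans (∣∑<∣≤ M h bd) (ℕ.≤-reflexive (sym (ℕ.+-identityʳ _))))))
      }

  Avgⁿ-nonneg : ∀ L n {f} → (∀ x → 0ℤ ≤ f x) → ∀ x → 0ℤ ≤ Avgⁿ L n f x
  Avgⁿ-nonneg L zero    f≥0 x = f≥0 x
  Avgⁿ-nonneg L (suc n) f≥0 x = ∑ℤ-nonneg (upTo L) λ j → Avgⁿ-nonneg L n f≥0 (x ℕ.+ j)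

  Avg-≥ : ∀ L {f} → (∀ x → 0ℤ ≤ f x) → ∀ c N →
          + L * ∑< N (λ i → f (L ℕ.+ c ℕ.+ i)) ≤ ∑< (L ℕ.+ N) (λ i → Avg L f (c ℕ.+ i))
  Avg-≥ L {f} f≥0 c N = begin
    + L * S                                            ≡⟨ sym (∑<ℤ-const L S) ⟩
    ∑< L (λ _ → S)                                     ≤⟨ mono L ℕ.≤-refl ⟩
    ∑< L (λ j → ∑< (L ℕ.+ N) (λ i → f (c ℕ.+ i ℕ.+ j)))  ≡⟨ ∑-swap (upTo L) (upTo (L ℕ.+ N)) _ ⟩
    ∑< (L ℕ.+ N) (λ i → Avg L f (c ℕ.+ i))             ∎
    where
    open ≤-Reasoning
    S = ∑< N (λ i → f (L ℕ.+ c ℕ.+ i))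
    each : ∀ j → j ℕ.≤ L → S ≤ ∑< (L ℕ.+ N) (λ i → f (c ℕ.+ i ℕ.+ j))
    each j j≤L = begin
      S                                                ≤⟨ ∑<ℤ-extend (λ i → f≥0 _) (ℕ.m≤m+n N j) ⟩
      ∑< (N ℕ.+ j) (λ i → f (L ℕ.+ c ℕ.+ i))           ≡⟨ ∑-cong (upTo (N ℕ.+ j)) (λ i → cong f (reindex i)) ⟩
      ∑< (N ℕ.+ j) (λ i → g (L ℕ.∸ j ℕ.+ i))           ≡⟨ sym (+-identityˡ _) ⟩
      0ℤ + ∑< (N ℕ.+ j) (λ i → g (L ℕ.∸ j ℕ.+ i))      ≤⟨ +-monoˡ-≤ _ (∑ℤ-nonneg (upTo (L ℕ.∸ j)) (λ i → f≥0 (c ℕ.+ i ℕ.+ j))) ⟩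
      ∑< (L ℕ.∸ j) g + ∑< (N ℕ.+ j) (λ i → g (L ℕ.∸ j ℕ.+ i))  ≡⟨ sym (∑<-+ (L ℕ.∸ j) (N ℕ.+ j) g) ⟩
      ∑< (L ℕ.∸ j ℕ.+ (N ℕ.+ j)) g                     ≡⟨ cong (λ k → ∑< k g) total ⟩
      ∑< (L ℕ.+ N) g                                   ∎
      where
      g = λ i → f (c ℕ.+ i ℕ.+ j)
      total : L ℕ.∸ j ℕ.+ (N ℕ.+ j) ≡ L ℕ.+ N
      total = trans (cong (L ℕ.∸ j ℕ.+_) (ℕ.+-comm N j)) (trans (sym (ℕ.+-assoc (L ℕ.∸ j) j N)) (cong (ℕ._+ N) (ℕ.m∸n+n≡m j≤L)))
      rearrange : ∀ a c i j → a ℕ.+ j ℕ.+ c ℕ.+ i ≡ c ℕ.+ (a ℕ.+ i) ℕ.+ j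
      rearrange = solve-∀
      reindex : ∀ i → L ℕ.+ c ℕ.+ i ≡ c ℕ.+ (L ℕ.∸ j ℕ.+ i) ℕ.+ j
      reindex i = trans (cong (λ l → l ℕ.+ c ℕ.+ i) (sym (ℕ.m∸n+n≡m j≤L))) (rearrange (L ℕ.∸ j) c i j)
    shifted : ℕ → ℤ
    shifted j = ∑< (L ℕ.+ N) (λ i → f (c ℕ.+ i ℕ.+ j))
    mono : ∀ k → k ℕ.≤ L → ∑< k (λ _ → S) ≤ ∑< k shifted
    mono zero    _   = ≤-refl
    mono (suc k) k<L = begin
      ∑< (suc k) (λ _ → S)    ≡⟨ ∑<-sucʳ k (λ _ → S) ⟩
      ∑< k (λ _ → S) + S      ≤⟨ +-mono-≤ (mono k (ℕ.<⇒≤ k<L)) (each k (ℕ.<⇒≤ k<L)) ⟩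
      ∑< k shifted + shifted k ≡⟨ sym (∑<-sucʳ k shifted) ⟩
      ∑< (suc k) shifted      ∎

  -- Each round moves the inner window by `L` and lengthens the outer range by `L`. This is why
  -- residues modulo p are later placed in [np, (n+1)p).
  Avgⁿ-≥ : ∀ L n {f} → (∀ x → 0ℤ ≤ f x) → ∀ c N →
           + (L ℕ.^ n) * ∑< N (λ i → f (n ℕ.* L ℕ.+ c ℕ.+ i))
             ≤ ∑< (n ℕ.* L ℕ.+ N) (λ i → Avgⁿ L n f (c ℕ.+ i))
  Avgⁿ-≥ L zero    {f} f≥0 c N = ≤-reflexive (*-identityˡ _)
  Avgⁿ-≥ L (suc n) {f} f≥0 c N = begin
    + (L ℕ.* L ℕ.^ n) * ∑< N (λ i → f (L ℕ.+ n ℕ.* L ℕ.+ c ℕ.+ i))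
      ≡⟨ cong₂ _*_ (pos-* L (L ℕ.^ n)) (∑-cong (upTo N) λ i → cong f (rearrange L (n ℕ.* L) c i)) ⟩
    + L * + (L ℕ.^ n) * ∑< N (λ i → f (n ℕ.* L ℕ.+ (L ℕ.+ c) ℕ.+ i))
      ≡⟨ *-assoc (+ L) (+ (L ℕ.^ n)) _ ⟩
    + L * (+ (L ℕ.^ n) * ∑< N (λ i → f (n ℕ.* L ℕ.+ (L ℕ.+ c) ℕ.+ i)))
      ≤⟨ *-monoˡ-≤-nonNeg (+ L) (Avgⁿ-≥ L n f≥0 (L ℕ.+ c) N) ⟩
    + L * ∑< (n ℕ.* L ℕ.+ N) (λ i → Avgⁿ L n f (L ℕ.+ c ℕ.+ i))
      ≤⟨ Avg-≥ L (Avgⁿ-nonneg L n f≥0) c (n ℕ.* L ℕ.+ N) ⟩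
    ∑< (L ℕ.+ (n ℕ.* L ℕ.+ N)) (λ i → Avg L (Avgⁿ L n f) (c ℕ.+ i))
      ≡⟨ cong (λ k → ∑< k (λ i → Avg L (Avgⁿ L n f) (c ℕ.+ i))) (sym (ℕ.+-assoc L (n ℕ.* L) N)) ⟩
    ∑< (L ℕ.+ n ℕ.* L ℕ.+ N) (λ i → Avg L (Avgⁿ L n f) (c ℕ.+ i)) ∎
    where
    open ≤-Reasoning
    rearrange : ∀ l b c i → l ℕ.+ b ℕ.+ c ℕ.+ i ≡ b ℕ.+ (l ℕ.+ c) ℕ.+ i
    rearrange = solve-∀

-- Linear congruences and counts of their solutions.

module Residues where

  open import Data.Nat
  open import Data.Nat.Properties
  open import Data.Nat.Tactic.RingSolver using (solve-∀)
  open ℕΣ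

  coprime-* : ∀ {a b c} → Coprime a c → Coprime b c → Coprime (a * b) c
  coprime-* {a} {b} {c} ac bc (d∣ab , d∣c) =
    bc (coprime-factors ac (d∣ab , ∣m⇒∣m*n b d∣c) , d∣c)

  coprime-∣ˡ : ∀ {a b c} → a ∣ b → Coprime b c → Coprime a c
  coprime-∣ˡ a∣b bc (d∣a , d∣c) = bc (∣-trans d∣a a∣b , d∣c)

  ∣-shift : ∀ {q a b} k → b ≡ a + k * q → q ∣ b → q ∣ a
  ∣-shift {q} {a} k refl q∣b = ∣m+n∣m⇒∣n (subst (q ∣_) (+-comm a (k * q)) q∣b) (n∣m*n k)

  solve-residue : ∀ {α} q .{{_ : NonZero q}} → Coprime α q → ∀ c → ∃[ j ] j < q × q ∣ c + α * j
  solve-residue {α} q@(suc q′) cop c = j₀ % q , m%n<n j₀ q , ∣-shift (α * (j₀ / q)) eq (proj₂ large)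
    where
    large : ∃[ j ] q ∣ c + α * j
    large with coprime-Bézout cop
    ... | Bézout.-+ x y e = x * c , divides (c * y) (trans (alg₁ α x c) (trans (cong (c *_) e) (sym (*-assoc c y q))))
      where
      alg₁ : ∀ α x c → c + α * (x * c) ≡ c * (1 + x * α)
      alg₁ = solve-∀
    -- Here `x * α` is 1 modulo `q`, so a factor -1 is needed; `q′`, which is `q` minus 1, takes its
    -- place in ℕ.
    ... | Bézout.+- x y e = x * c * q′ , divides (c + y * c * q′)
          (trans (alg₁ α x c q′) (trans (cong (λ t → c + t * (c * q′)) (sym e)) (alg₂ y c q′)))
      where
      alg₁ : ∀ α x c q′ → c + α * (x * c * q′) ≡ c + (x * α) * (c * q′)
      alg₁ = solve-∀
      alg₂ : ∀ y c q′ → c + (1 + y * suc q′) * (c * q′) ≡ (c + y * c * q′) * suc q′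
      alg₂ = solve-∀
    j₀ = proj₁ large
    alg : ∀ c α r k q → c + α * (r + k * q) ≡ c + α * r + α * k * q
    alg = solve-∀
    eq : c + α * j₀ ≡ c + α * (j₀ % q) + α * (j₀ / q) * q
    eq = trans (cong (λ t → c + α * t) (m≡m%n+[m/n]*n j₀ q)) (alg c α (j₀ % q) (j₀ / q) q)

  residue-unique : ∀ {α q} → Coprime α q → ∀ c {i j} → i < q → j < q →
                   q ∣ c + α * i → q ∣ c + α * j → i ≡ j
  residue-unique {α} {q} cop c {i} {j} i<q j<q p₁ p₂ =
    [ (λ i≤j → go i≤j j<q p₁ p₂) , (λ j≤i → sym (go j≤i i<q p₂ p₁)) ]′ (≤-total i j)
    where
    alg : ∀ c α i k → c + α * (k + i) ≡ c + α * i + α * k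
    alg = solve-∀
    go : ∀ {i j} → i ≤ j → j < q → q ∣ c + α * i → q ∣ c + α * j → i ≡ j
    go {i} {j} i≤j j<q p₁ p₂ with j ∸ i in eq
    ... | zero  = ≤-antisym i≤j (m∸n≡0⇒m≤n eq)
    ... | suc k = contradiction (∣⇒≤ q∣k) (<⇒≱ (≤-<-trans (subst (_≤ j) eq (m∸n≤m j i)) j<q))
      where
      j≡ : j ≡ suc k + i
      j≡ = trans (sym (m∸n+n≡m i≤j)) (cong (_+ i) eq)
      q∣k : q ∣ suc k
      q∣k = coprime-divisor (Coprime.sym cop)
        (∣m+n∣m⇒∣n (subst (q ∣_) (trans (cong (λ t → c + α * t) j≡) (alg c α i (suc k))) p₂) p₁)

  count-residue≡1 : ∀ {α} q .{{_ : NonZero q}} → Coprime α q → ∀ c →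
                    ∑< q (λ j → ι (q ∣? (c + α * j))) ≡ 1
  count-residue≡1 {α} q cop c = ≤-antisym
    (∑-ι-≤1 (upTo q) (λ j → q ∣? (c + α * j)) (Unique.upTo⁺ q) (λ i j i∈ j∈ → residue-unique cop c (∈-upTo⁻ i∈) (∈-upTo⁻ j∈)))
    (let j , j<q , q∣ = solve-residue q cop c in
     ≤-trans (≤-reflexive (sym (ι-yes (q ∣? (c + α * j)) q∣))) (∑-∈ (upTo q) (λ j → ι (q ∣? (c + α * j))) (∈-upTo⁺ j<q)))

  -- Each complete block of `q` consecutive indices contains one solution and the incomplete block
  -- at most one, so `q * k` and `n` differ by at most `q`.
  count-residue : ∀ {α} q .{{_ : NonZero q}} → Coprime α q → ∀ c n →
                  let k = ∑< n (λ j → ι (q ∣? (c + α * j))) in (q * k ≤ n + q) × (n ≤ q * k + q)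
  count-residue {α} q cop c n = upper , lower
    where
    χ : ℕ → ℕ
    χ j = ι (q ∣? (c + α * j))
    a = n / q
    b = n % q
    k = ∑< n χ
    rest = ∑< b (λ j → χ (a * q + j))
    alg : ∀ c α x j → c + α * (x + j) ≡ (c + α * x) + α * j
    alg = solve-∀
    block : ∀ x → ∑< q (λ j → χ (x + j)) ≡ 1
    block x = trans (∑-cong (upTo q) (λ j → cong (λ t → ι (q ∣? t)) (alg c α x j))) (count-residue≡1 q cop (c + α * x))
    n≡ : n ≡ a * q + b
    n≡ = trans (m≡m%n+[m/n]*n n q) (+-comm b (a * q))
    split : k ≡ a + rest
    split = begin
      ∑< n χ                                  ≡⟨ cong (λ t → ∑< t χ) n≡ ⟩
      ∑< (a * q + b) χ                        ≡⟨ ∑<-+ (a * q) b χ ⟩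
      ∑< (a * q) χ + rest                     ≡⟨ cong (_+ rest)
            (trans (∑<-* q a χ) (trans (∑-cong (upTo a) (λ t → block (t * q))) (∑<-const a 1))) ⟩
      a * 1 + rest                            ≡⟨ cong (_+ rest) (*-identityʳ a) ⟩
      a + rest                                ∎
      where open ≡-Reasoning
    rest≤1 : rest ≤ 1
    rest≤1 = ≤-trans (∑<-extend _ (m%n≤n n q)) (≤-reflexive (block (a * q)))
    open ≤-Reasoning
    upper : q * k ≤ n + q
    upper = begin
      q * k          ≡⟨ cong (q *_) split ⟩
      q * (a + rest) ≤⟨ *-monoʳ-≤ q (+-monoʳ-≤ a rest≤1) ⟩
      q * (a + 1)    ≡⟨ alg′ q a ⟩
      a * q + q      ≤⟨ +-monoˡ-≤ q (subst (a * q ≤_) (sym n≡) (m≤m+n _ b)) ⟩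
      n + q          ∎
      where
      alg′ : ∀ q a → q * (a + 1) ≡ a * q + q
      alg′ = solve-∀
    lower : n ≤ q * k + q
    lower = begin
      n               ≡⟨ n≡ ⟩
      a * q + b       ≤⟨ +-mono-≤ (≤-reflexive (*-comm a q)) (m%n≤n n q) ⟩
      q * a + q       ≤⟨ +-monoˡ-≤ q (*-monoʳ-≤ q (subst (a ≤_) (sym split) (m≤m+n a rest))) ⟩
      q * k + q       ∎

-- Averaging over coprime moduli.

module Reduction where

  open import Data.Integer hiding (suc; NonZero)
  open import Data.Integer.Properties
  open import Data.Integer.Tactic.RingSolver using (solve-∀)
  import Data.Nat.Tactic.RingSolver as ℕ-Solver
  open ℤΣ
  open IntegerSums
  open Averaging
  open Residues
  open ≡-Reasoning

  periodic-multiple : ∀ {M W f} → M ∣ W → Periodic M f → Periodic W f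
  periodic-multiple (divides k refl) per = periodic-∣ k per

  periodic-* : ∀ {M f g} → Periodic M f → Periodic M g → Periodic M (λ r → f r * g r)
  periodic-* pf pg x = cong₂ _*_ (pf x) (pg x)

  periodic-tile : ∀ {W φ} → Periodic W φ → ∀ t i → φ (t ℕ.* W ℕ.+ i) ≡ φ i
  periodic-tile {W} {φ} per t i = trans (cong φ (ℕ.+-comm (t ℕ.* W) i)) (periodic-∣ t per i)

  -- Averaging f over the residue classes modulo N, while the class modulo 𝒟 is
  -- held fixed, gives N⁻¹ c.
  record Reduces (𝒟 N : ℕ) (f c : ℕ → ℤ) : Set where
    field
      f-periodic : Periodic (N ℕ.* 𝒟) f
      c-periodic : Periodic 𝒟 c
      reduce     : ∀ W φ → 𝒟 ∣ W → Coprime W N → Periodic W φ →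
                   ∑< (N ℕ.* W) (λ r → φ r * f r) ≡ ∑< W (λ r → φ r * c r)

  open Reduces public

  reduces-const : ∀ 𝒟 N a → Reduces 𝒟 N (λ _ → a) (λ _ → + N * a)
  reduces-const 𝒟 N a .f-periodic _ = refl
  reduces-const 𝒟 N a .c-periodic _ = refl
  reduces-const 𝒟 N a .reduce W φ _ _ per = begin
    ∑< (N ℕ.* W) (λ r → φ r * a)                       ≡⟨ ∑<-* W N _ ⟩
    ∑< N (λ t → ∑< W (λ i → φ (t ℕ.* W ℕ.+ i) * a))    ≡⟨ ∑-cong (upTo N)
          (λ t → ∑-cong (upTo W) λ i → cong (_* a) (periodic-tile per t i)) ⟩
    ∑< N (λ _ → ∑< W (λ i → φ i * a))                  ≡⟨ ∑<ℤ-const N _ ⟩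
    + N * ∑< W (λ i → φ i * a)                         ≡⟨ sym (∑-*ˡ (upTo W) (+ N) _) ⟩
    ∑< W (λ i → + N * (φ i * a))                       ≡⟨ ∑-cong (upTo W) (λ i → alg (+ N) (φ i) a) ⟩
    ∑< W (λ i → φ i * (+ N * a))                       ∎
    where
    alg : ∀ n x a → n * (x * a) ≡ x * (n * a)
    alg = solve-∀

  reduces-+ : ∀ {𝒟 N f c g e} → Reduces 𝒟 N f c → Reduces 𝒟 N g e →
              Reduces 𝒟 N (λ r → f r + g r) (λ r → c r + e r)
  reduces-+ R S .f-periodic x = cong₂ _+_ (R .f-periodic x) (S .f-periodic x)
  reduces-+ R S .c-periodic x = cong₂ _+_ (R .c-periodic x) (S .c-periodic x)
  reduces-+ {𝒟} {N} {f} {c} {g} {e} R S .reduce W φ 𝒟∣W cop per = begin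
    ∑< (N ℕ.* W) (λ r → φ r * (f r + g r))
      ≡⟨ ∑-cong (upTo (N ℕ.* W)) (λ r → *-distribˡ-+ (φ r) (f r) (g r)) ⟩
    ∑< (N ℕ.* W) (λ r → φ r * f r + φ r * g r)
      ≡⟨ ∑-+ (upTo (N ℕ.* W)) _ _ ⟩
    ∑< (N ℕ.* W) (λ r → φ r * f r) + ∑< (N ℕ.* W) (λ r → φ r * g r)
      ≡⟨ cong₂ _+_ (R .reduce W φ 𝒟∣W cop per) (S .reduce W φ 𝒟∣W cop per) ⟩
    ∑< W (λ r → φ r * c r) + ∑< W (λ r → φ r * e r)
      ≡⟨ sym (∑-+ (upTo W) _ _) ⟩
    ∑< W (λ r → φ r * c r + φ r * e r)
      ≡⟨ ∑-cong (upTo W) (λ r → sym (*-distribˡ-+ (φ r) (c r) (e r))) ⟩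
    ∑< W (λ r → φ r * (c r + e r)) ∎

  reduces-scale : ∀ {𝒟 N f c} a → Reduces 𝒟 N f c → Reduces 𝒟 N (λ r → a * f r) (λ r → a * c r)
  reduces-scale a R .f-periodic x = cong (a *_) (R .f-periodic x)
  reduces-scale a R .c-periodic x = cong (a *_) (R .c-periodic x)
  reduces-scale {𝒟} {N} {f} {c} a R .reduce W φ 𝒟∣W cop per = begin
    ∑< (N ℕ.* W) (λ r → φ r * (a * f r)) ≡⟨ pull (upTo (N ℕ.* W)) f ⟩
    a * ∑< (N ℕ.* W) (λ r → φ r * f r)   ≡⟨ cong (a *_) (R .reduce W φ 𝒟∣W cop per) ⟩
    a * ∑< W (λ r → φ r * c r)           ≡⟨ sym (pull (upTo W) c) ⟩
    ∑< W (λ r → φ r * (a * c r))         ∎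
    where
    alg : ∀ x a y → x * (a * y) ≡ a * (x * y)
    alg = solve-∀
    pull : ∀ xs h → ∑ xs (λ r → φ r * (a * h r)) ≡ a * ∑ xs (λ r → φ r * h r)
    pull xs h = trans (∑-cong xs (λ r → alg (φ r) a (h r))) (∑-*ˡ xs a _)

  reduces-cong : ∀ {𝒟 N f g c} → (∀ r → f r ≡ g r) → Reduces 𝒟 N f c → Reduces 𝒟 N g c
  reduces-cong eq R .f-periodic x = trans (sym (eq _)) (trans (R .f-periodic x) (eq x))
  reduces-cong eq R .c-periodic = R .c-periodic
  reduces-cong {N = N} eq R .reduce W φ 𝒟∣W cop per =
    trans (∑-cong (upTo (N ℕ.* W)) (λ r → cong (φ r *_) (sym (eq r)))) (R .reduce W φ 𝒟∣W cop per)

  -- First `f₁` is absorbed into the test function while `f₂` is averaged, then `c₂` is absorbed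
  -- while `f₁` is averaged. This is the purpose of the arbitrary test function and of the arbitrary
  -- multiple `W` of the modulus in `Reduces`.
  reduces-* : ∀ {𝒟₁ 𝒟₂ N₁ N₂ f₁ f₂ c₁ c₂} 𝒟 → 𝒟₁ ∣ 𝒟 → 𝒟₂ ∣ 𝒟 → Coprime N₁ N₂ →
              Reduces 𝒟₁ N₁ f₁ c₁ → Reduces 𝒟₂ N₂ f₂ c₂ →
              Reduces 𝒟 (N₁ ℕ.* N₂) (λ r → f₁ r * f₂ r) (λ r → c₁ r * c₂ r)
  reduces-* {𝒟₁} {𝒟₂} {N₁} {N₂} 𝒟 d₁ d₂ cop R₁ R₂ .f-periodic =
    periodic-* (periodic-multiple (*-pres-∣ (m∣m*n {N₁} N₂) d₁) (R₁ .f-periodic))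
               (periodic-multiple (*-pres-∣ (n∣m*n N₁ {N₂}) d₂) (R₂ .f-periodic))
  reduces-* 𝒟 d₁ d₂ cop R₁ R₂ .c-periodic =
    periodic-* (periodic-multiple d₁ (R₁ .c-periodic)) (periodic-multiple d₂ (R₂ .c-periodic))
  reduces-* {𝒟₁} {𝒟₂} {N₁} {N₂} {f₁} {f₂} {c₁} {c₂} 𝒟 d₁ d₂ cop R₁ R₂ .reduce W φ 𝒟∣W copW per = begin
    ∑< (N₁ ℕ.* N₂ ℕ.* W) (λ r → φ r * (f₁ r * f₂ r))
      ≡⟨ cong (λ n → ∑< n (λ r → φ r * (f₁ r * f₂ r))) (ℕalg N₁ N₂ W) ⟩
    ∑< (N₂ ℕ.* (N₁ ℕ.* W)) (λ r → φ r * (f₁ r * f₂ r))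
      ≡⟨ ∑-cong (upTo (N₂ ℕ.* (N₁ ℕ.* W))) (λ r → sym (*-assoc (φ r) (f₁ r) (f₂ r))) ⟩
    ∑< (N₂ ℕ.* (N₁ ℕ.* W)) (λ r → φ r * f₁ r * f₂ r)
      ≡⟨ R₂ .reduce (N₁ ℕ.* W) (λ r → φ r * f₁ r) (∣n⇒∣m*n N₁ (∣-trans d₂ 𝒟∣W))
           (coprime-* cop copW₂)
           (periodic-* (periodic-multiple (n∣m*n N₁) per)
                       (periodic-multiple (*-monoʳ-∣ N₁ (∣-trans d₁ 𝒟∣W)) (R₁ .f-periodic))) ⟩
    ∑< (N₁ ℕ.* W) (λ r → φ r * f₁ r * c₂ r)
      ≡⟨ ∑-cong (upTo (N₁ ℕ.* W)) (λ r → alg (φ r) (f₁ r) (c₂ r)) ⟩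
    ∑< (N₁ ℕ.* W) (λ r → φ r * c₂ r * f₁ r)
      ≡⟨ R₁ .reduce W (λ r → φ r * c₂ r) (∣-trans d₁ 𝒟∣W) copW₁
           (periodic-* per (periodic-multiple (∣-trans d₂ 𝒟∣W) (R₂ .c-periodic))) ⟩
    ∑< W (λ r → φ r * c₂ r * c₁ r)
      ≡⟨ ∑-cong (upTo W) (λ r → alg′ (φ r) (c₁ r) (c₂ r)) ⟩
    ∑< W (λ r → φ r * (c₁ r * c₂ r)) ∎
    where
    alg : ∀ x y z → x * y * z ≡ x * z * y
    alg = solve-∀
    alg′ : ∀ x y z → x * z * y ≡ x * (y * z)
    alg′ = solve-∀
    ℕalg : ∀ a b w → a ℕ.* b ℕ.* w ≡ b ℕ.* (a ℕ.* w)
    ℕalg = ℕ-Solver.solve-∀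
    copW₁ : Coprime W N₁
    copW₁ = Coprime.sym (coprime-∣ˡ (m∣m*n N₂) (Coprime.sym copW))
    copW₂ : Coprime W N₂
    copW₂ = Coprime.sym (coprime-∣ˡ (n∣m*n N₁) (Coprime.sym copW))

  -- Write r = t W + i. For fixed i, the coprimality of `W` and `z` makes exactly one t below `z`
  -- satisfy the divisibility, while `ψ` sees only i.
  ∑<-CRT : ∀ {W z ψ} .{{_ : NonZero z}} → Coprime W z → Periodic W ψ → ∀ c →
           ∑< (z ℕ.* W) (λ r → ψ r * + ι (z ∣? (r ℕ.+ c))) ≡ ∑< W ψ
  ∑<-CRT {W} {z} {ψ} cop per c = begin
    ∑< (z ℕ.* W) (λ r → ψ r * + ι (z ∣? (r ℕ.+ c)))
      ≡⟨ ∑<-* W z _ ⟩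
    ∑< z (λ t → ∑< W (λ i → ψ (t ℕ.* W ℕ.+ i) * + ι (z ∣? (t ℕ.* W ℕ.+ i ℕ.+ c))))
      ≡⟨ ∑-cong (upTo z) (λ t → ∑-cong (upTo W) λ i → cong₂ (λ x n → x * + ι (z ∣? n)) (periodic-tile per t i) (ℕalg t W i c)) ⟩
    ∑< z (λ t → ∑< W (λ i → ψ i * + ι (z ∣? (i ℕ.+ c ℕ.+ W ℕ.* t))))
      ≡⟨ ∑-swap (upTo z) (upTo W) _ ⟩
    ∑< W (λ i → ∑< z (λ t → ψ i * + ι (z ∣? (i ℕ.+ c ℕ.+ W ℕ.* t))))
      ≡⟨ ∑-cong (upTo W) (λ i → trans (∑-*ˡ (upTo z) (ψ i) _) (trans (cong (ψ i *_)
           (trans (∑-pos (upTo z) _) (cong +_ (count-residue≡1 z cop (i ℕ.+ c))))) (*-identityʳ (ψ i)))) ⟩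
    ∑< W ψ ∎
    where
    ℕalg : ∀ t W i c → t ℕ.* W ℕ.+ i ℕ.+ c ≡ i ℕ.+ c ℕ.+ W ℕ.* t
    ℕalg = ℕ-Solver.solve-∀

  module Event (Q z α κ : ℕ) where

    -- In the application `α` is -p and `κ` is -(n+1)p modulo `Q * z`, so this is r - (n+1+j)p
    -- modulo `Q * z`.
    hit : ℕ → ℕ → ℕ
    hit r j = r ℕ.+ κ ℕ.+ α ℕ.* j

    -- For `α` prime to `z` exactly one `j` has `z ∣ hit r j`, so this is a 0-1 indicator: whether
    -- `Q` divides the same value. It is implied by d² ∣ u.
    E : ℕ → ℕ
    E r = ℕΣ.∑< z (λ j → ι (Q ∣? hit r j) ℕ.* ι (z ∣? hit r j))

    cnt : ℕ → ℕ
    cnt r = ℕΣ.∑< z (λ j → ι (Q ∣? hit r j))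

    -- The event has density about 1/Q; this is its indicator centred and scaled by `Q` to stay
    -- integral.
    g : ℕ → ℤ
    g r = + Q * + E r + -1ℤ

    -- What remains of `g` after summation over the classes modulo `z`. As `cnt` is z/Q up to an
    -- error of 1, the value is of size `Q` instead of `Q * z`.
    c : ℕ → ℤ
    c r = + Q * + cnt r + + z * -1ℤ

    -- The same for the square of `g`, where E² = E reduces everything to a linear expression in
    -- `E`.
    e : ℕ → ℤ
    e r = (+ Q * + Q - + 2 * + Q) * + cnt r + + z * 1ℤ

    module Bounds .{{_ : NonZero Q}} .{{_ : NonZero z}} (αQ : Coprime α Q) (αz : Coprime α z) where

      E≤1 : ∀ r → E r ℕ.≤ 1
      E≤1 r = ℕ.≤-trans
        (∑-mono (upTo z) (λ j _ → ℕ.≤-trans (ℕ.*-monoˡ-≤ (ι (z ∣? hit r j)) (ι≤1 (Q ∣? hit r j)))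
              (ℕ.≤-reflexive (ℕ.*-identityˡ _))))
        (ℕ.≤-reflexive (count-residue≡1 z αz (r ℕ.+ κ)))

      hit-periodic : ∀ {q} k → q ∣ k → ∀ r j → ι (q ∣? hit (r ℕ.+ k) j) ≡ ι (q ∣? hit r j)
      hit-periodic {q} k (divides m refl) r j = ι-⇔ (q ∣? hit (r ℕ.+ k) j) (q ∣? hit r j)
        (∣-shift m (alg r κ α j (m ℕ.* q)))
        (λ q∣ → subst (q ∣_) (sym (alg r κ α j (m ℕ.* q))) (∣m∣n⇒∣m+n q∣ (n∣m*n m)))
        where
        alg : ∀ r κ α j k → r ℕ.+ k ℕ.+ κ ℕ.+ α ℕ.* j ≡ r ℕ.+ κ ℕ.+ α ℕ.* j ℕ.+ k
        alg = ℕ-Solver.solve-∀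

      -- For each `j` the condition modulo `Q` joins the test function, and `∑<-CRT` removes the
      -- condition modulo `z`.
      reduces-E : Reduces Q z (λ r → + E r) (λ r → + cnt r)
      reduces-E .f-periodic r = cong +_ (ℕΣ.∑-cong (upTo z) λ j →
        cong₂ ℕ._*_ (hit-periodic {Q} (z ℕ.* Q) (n∣m*n z) r j) (hit-periodic {z} (z ℕ.* Q) (m∣m*n Q) r j))
      reduces-E .c-periodic r = cong +_ (ℕΣ.∑-cong (upTo z) λ j → hit-periodic Q ∣-refl r j)
      reduces-E .reduce W φ Q∣W cop per = begin
        ∑< (z ℕ.* W) (λ r → φ r * + E r)
          ≡⟨ ∑-cong (upTo (z ℕ.* W)) (λ r → expand r) ⟩
        ∑< (z ℕ.* W) (λ r → ∑< z (λ j → ψ j r * + ι (z ∣? hit r j)))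
          ≡⟨ ∑-swap (upTo (z ℕ.* W)) (upTo z) _ ⟩
        ∑< z (λ j → ∑< (z ℕ.* W) (λ r → ψ j r * + ι (z ∣? hit r j)))
          ≡⟨ ∑-cong (upTo z) (λ j → trans (∑-cong (upTo (z ℕ.* W))
                (λ r → cong (λ n → ψ j r * + ι (z ∣? n)) (ℕ.+-assoc r κ (α ℕ.* j)))) (∑<-CRT cop (ψ-periodic j)
                      (κ ℕ.+ α ℕ.* j))) ⟩
        ∑< z (λ j → ∑< W (ψ j))
          ≡⟨ ∑-swap (upTo z) (upTo W) _ ⟩
        ∑< W (λ r → ∑< z (λ j → ψ j r))
          ≡⟨ ∑-cong (upTo W) (λ r → trans (∑-*ˡ (upTo z) (φ r) _) (cong (φ r *_) (∑-pos (upTo z) _))) ⟩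
        ∑< W (λ r → φ r * + cnt r) ∎
        where
        ψ : ℕ → ℕ → ℤ
        ψ j r = φ r * + ι (Q ∣? hit r j)
        ψ-periodic : ∀ j → Periodic W (ψ j)
        ψ-periodic j r = cong₂ (λ x n → x * + n) (per r) (hit-periodic W Q∣W r j)
        expand : ∀ r → φ r * + E r ≡ ∑< z (λ j → ψ j r * + ι (z ∣? hit r j))
        expand r = trans (cong (φ r *_) (sym (∑-pos (upTo z) _)))
          (trans (sym (∑-*ˡ (upTo z) (φ r) _))
            (∑-cong (upTo z) (λ j → trans (cong (φ r *_) (pos-* (ι (Q ∣? hit r j)) _)) (sym (*-assoc (φ r) _ _)))))

      reduces-g : Reduces Q z g c
      reduces-g = reduces-+ (reduces-scale (+ Q) reduces-E) (reduces-const Q z -1ℤ)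

      ∣c∣≤Q : ∀ r → ∣ c r ∣ ℕ.≤ Q
      ∣c∣≤Q r = subst (ℕ._≤ Q) (cong ∣_∣ (sym eq)) bound
        where
        both = count-residue Q αQ (r ℕ.+ κ) z
        eq : c r ≡ (Q ℕ.* cnt r) ⊖ z
        eq = trans (cong₂ _+_ (sym (pos-* Q (cnt r))) (trans (*-comm (+ z) -1ℤ) (-1*i≡-i (+ z)))) (m-n≡m⊖n (Q ℕ.* cnt r) z)
        ∣⊖∣≤ : ∀ a b q → a ℕ.≤ b ℕ.+ q → b ℕ.≤ a ℕ.+ q → ∣ a ⊖ b ∣ ℕ.≤ q
        ∣⊖∣≤ a b q p₁ p₂ with ℕ.≤-total a b
        ... | inj₁ a≤b = subst (ℕ._≤ q) (sym (∣⊖∣-≤ a≤b)) (ℕ.m≤n+o⇒m∸n≤o b a p₂)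
        ... | inj₂ b≤a = subst (ℕ._≤ q) (trans (sym (∣⊖∣-≤ b≤a)) (∣m⊖n∣≡∣n⊖m∣ b a)) (ℕ.m≤n+o⇒m∸n≤o a b p₁)
        bound : ∣ (Q ℕ.* cnt r) ⊖ z ∣ ℕ.≤ Q
        bound = ∣⊖∣≤ _ _ Q (proj₁ both) (proj₂ both)

      ∣g∣≤Q : ∀ r → ∣ g r ∣ ℕ.≤ Q
      ∣g∣≤Q r with E r | E≤1 r
      ... | zero        | _ rewrite *-zeroʳ (+ Q) = ℕ.>-nonZero⁻¹ Q
      ... | suc zero    | _ rewrite *-identityʳ (+ Q) = ∣Q-1∣≤Q Q
        where
        ∣Q-1∣≤Q : ∀ Q .{{_ : NonZero Q}} → ∣ + Q + -1ℤ ∣ ℕ.≤ Q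
        ∣Q-1∣≤Q (suc q) = ℕ.n≤1+n q
      ... | suc (suc _) | s≤s ()

      reduces-g² : Reduces Q z (λ r → g r * g r) e
      reduces-g² = reduces-cong (λ r → square r)
        (reduces-+ (reduces-scale (+ Q * + Q - + 2 * + Q) reduces-E) (reduces-const Q z 1ℤ))
        where
        E²≡E : ∀ n → n ℕ.≤ 1 → + n * + n ≡ + n
        E²≡E zero          _ = refl
        E²≡E (suc zero)    _ = refl
        E²≡E (suc (suc _)) (s≤s ())
        alg₁ : ∀ Q E → (Q * E + -1ℤ) * (Q * E + -1ℤ) ≡ Q * Q * (E * E) - + 2 * Q * E + 1ℤ
        alg₁ = solve-∀
        alg₂ : ∀ Q E → (Q * Q - + 2 * Q) * E + 1ℤ ≡ Q * Q * E - + 2 * Q * E + 1ℤ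
        alg₂ = solve-∀
        square : ∀ r → (+ Q * + Q - + 2 * + Q) * + E r + 1ℤ ≡ g r * g r
        square r = trans (alg₂ (+ Q) (+ E r))
          (trans (cong (λ t → + Q * + Q * t - + 2 * + Q * + E r + 1ℤ) (sym (E²≡E (E r) (E≤1 r))))
                 (sym (alg₁ (+ Q) (+ E r))))

      cnt≤z : ∀ r → cnt r ℕ.≤ z
      cnt≤z r = ℕ.≤-trans (∑-mono (upTo z) (λ j _ → ι≤1 (Q ∣? hit r j))) (ℕ.≤-reflexive (trans (∑<-const z 1) (ℕ.*-identityʳ z)))

      ∣e∣≤ : 2 ℕ.≤ Q → ∀ r → ∣ e r ∣ ℕ.≤ Q ℕ.* Q ℕ.* z
      ∣e∣≤ 2≤Q r = subst (λ i → ∣ i ∣ ℕ.≤ Q ℕ.* Q ℕ.* z) (sym e≡) bound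
        where
        -- With `Q ≥ 2` the coefficient Q² - 2Q equals `Q * q`, so `e r` is a natural number and can
        -- be bounded without signs.
        q = Q ℕ.∸ 2
        Q≡ : Q ≡ 2 ℕ.+ q
        Q≡ = sym (ℕ.m+[n∸m]≡n 2≤Q)
        n = Q ℕ.* q ℕ.* cnt r
        alg : ∀ q c z → ((+ 2 + q) * (+ 2 + q) - + 2 * (+ 2 + q)) * c + z * 1ℤ ≡ (+ 2 + q) * q * c + z
        alg = solve-∀
        e≡ : e r ≡ + (n ℕ.+ z)
        e≡ = begin
          e r
            ≡⟨ cong (λ t → (+ t * + t - + 2 * + t) * + cnt r + + z * 1ℤ) Q≡ ⟩
          ((+ 2 + + q) * (+ 2 + + q) - + 2 * (+ 2 + + q)) * + cnt r + + z * 1ℤ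
            ≡⟨ alg (+ q) (+ cnt r) (+ z) ⟩
          (+ 2 + + q) * + q * + cnt r + + z
            ≡⟨ cong (λ t → + t * + q * + cnt r + + z) (sym Q≡) ⟩
          + Q * + q * + cnt r + + z
            ≡⟨ cong (_+ + z) (trans (cong (_* + cnt r) (sym (pos-* Q q))) (sym (pos-* (Q ℕ.* q) (cnt r)))) ⟩
          + n + + z
            ≡⟨ sym (pos-+ n z) ⟩
          + (n ℕ.+ z) ∎
        ℕalg : ∀ a z → a ℕ.* z ℕ.+ z ≡ (a ℕ.+ 1) ℕ.* z
        ℕalg = ℕ-Solver.solve-∀
        Qq+1≤QQ : Q ℕ.* q ℕ.+ 1 ℕ.≤ Q ℕ.* Q
        Qq+1≤QQ = ℕ.≤-trans (ℕ.+-monoʳ-≤ (Q ℕ.* q) (ℕ.≤-trans (ℕ.s≤s ℕ.z≤n) 2≤Q))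
          (ℕ.≤-trans (ℕ.≤-reflexive (trans (ℕ.+-comm (Q ℕ.* q) Q) (sym (ℕ.*-suc Q q))))
                     (ℕ.*-monoʳ-≤ Q (ℕ.≤-trans (ℕ.n≤1+n (suc q)) (ℕ.≤-reflexive (sym Q≡)))))
        bound : n ℕ.+ z ℕ.≤ Q ℕ.* Q ℕ.* z
        bound = ℕ.≤-trans (ℕ.+-monoˡ-≤ z (ℕ.*-monoʳ-≤ (Q ℕ.* q) (cnt≤z r)))
          (ℕ.≤-trans (ℕ.≤-reflexive (ℕalg (Q ℕ.* q) z)) (ℕ.*-monoˡ-≤ z Qq+1≤QQ))

-- Prime divisors and coprimality.

module PrimeDivisors where

  open import Data.Nat
  open import Data.Nat.Properties

  has-prime-divisor : ∀ n .{{_ : NonZero n}} → n ≢ 1 → ∃[ q ] Prime q × q ∣ n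
  has-prime-divisor n n≢1 with factorise n
  ... | record { factors = []    ; isFactorisation = eq } = contradiction eq n≢1
  ... | record { factors = q ∷ qs ; isFactorisation = eq ; factorsPrime = pq ∷ _ } =
    q , pq , subst (q ∣_) (sym eq) (m∣m*n (product qs))

  coprime-by-primes : ∀ {a b} .{{_ : NonZero a}} → (∀ q → Prime q → q ∣ a → ¬ q ∣ b) → Coprime a b
  coprime-by-primes {a} disj {d} (d∣a , d∣b) with d ≟ 1
  ... | yes d≡1 = d≡1
  ... | no  d≢1 = let instance _ = m∣n≢0 d∣a in
    let q , pq , q∣d = has-prime-divisor d d≢1 in
    contradiction (∣-trans q∣d d∣b) (disj q pq (∣-trans q∣d d∣a))
    where
    m∣n≢0 : d ∣ a → NonZero d
    m∣n≢0 (divides k refl) = m*n≢0⇒n≢0 k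

  coprime-distinct-primes : ∀ {q r} → Prime q → Prime r → q ≢ r → Coprime q r
  coprime-distinct-primes pq pr q≢r (d∣q , d∣r) with prime⇒irreducible pq d∣q | prime⇒irreducible pr d∣r
  ... | inj₁ d≡1 | _        = d≡1
  ... | inj₂ _   | inj₁ d≡1 = d≡1
  ... | inj₂ d≡q | inj₂ d≡r = contradiction (trans (sym d≡q) d≡r) q≢r

-- Means of products over disjoint blocks.

module Blocks (p n D Z m : ℕ) .{{_ : NonZero p}} where

  open import Data.Integer hiding (suc; NonZero)
  open import Data.Integer.Properties
  open import Data.Integer.Tactic.RingSolver using (solve-∀)
  import Data.Nat.Tactic.RingSolver as ℕ-Solver
  open ℤΣ
  open IntegerSums
  open Averaging
  open Residues
  open Reduction
  open PrimeDivisors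

  -- weight says that the mean of φ, which is at most B / N, is at most β / m^j.
  record Good (j β : ℕ) (S : List ℕ) (φ : ℕ → ℤ) : Set where
    field
      𝒟 N B    : ℕ
      c        : ℕ → ℤ
      reduces  : Reduces 𝒟 N φ c
      c-bound  : ∀ r → ∣ c r ∣ ℕ.≤ B
      weight   : B ℕ.* m ℕ.^ j ℕ.≤ β ℕ.* N
      φ-bound  : ∀ r → ∣ φ r ∣ ℕ.≤ (D ℕ.* D ℕ.* (D ℕ.* D)) ℕ.^ j
      𝒟-bound  : 𝒟 ℕ.≤ (D ℕ.* D) ℕ.^ j
      N-bound  : N ℕ.≤ (Z ℕ.* Z) ℕ.^ j
      𝒟>0      : 1 ℕ.≤ 𝒟
      N>0      : 1 ℕ.≤ N
      𝒟-primes : ∀ q → Prime q → q ∣ 𝒟 → q ℕ.≤ D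
      N-primes : ∀ q → Prime q → q ∣ N → q ∈ S × D ℕ.< q

  good-1 : Good 0 1 [] (λ _ → 1ℤ)
  good-1 = record
    { 𝒟 = 1 ; N = 1 ; B = 1 ; c = λ _ → + 1 * 1ℤ
    ; reduces = reduces-const 1 1 1ℤ ; c-bound = λ _ → ℕ.≤-refl ; weight = ℕ.≤-refl
    ; φ-bound = λ _ → ℕ.≤-refl ; 𝒟-bound = ℕ.≤-refl ; N-bound = ℕ.≤-refl ; 𝒟>0 = ℕ.≤-refl ; N>0 = ℕ.≤-refl
    ; 𝒟-primes = λ q pq q∣1 → contradiction pq (subst (¬_ ∘ Prime) (sym (∣1⇒≡1 q∣1)) ¬prime[1])
    ; N-primes = λ q pq q∣1 → contradiction pq (subst (¬_ ∘ Prime) (sym (∣1⇒≡1 q∣1)) ¬prime[1])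
    }

  -- Disjoint supports make the two `N` coprime, as `reduces-*` demands. The two `𝒟` may share
  -- primes; their product merely serves as a common multiple.
  good-* : ∀ {i j β γ S T φ ψ} → (∀ {q} → q ∈ S → ¬ q ∈ T) →
           Good i β S φ → Good j γ T ψ → Good (i ℕ.+ j) (β ℕ.* γ) (S ++ T) (λ r → φ r * ψ r)
  good-* {i} {j} {β} {γ} {S} {T} {φ} {ψ} disj G H = record
    { 𝒟 = G.𝒟 ℕ.* H.𝒟
    ; N = G.N ℕ.* H.N
    ; B = G.B ℕ.* H.B
    ; c = λ r → G.c r * H.c r
    ; reduces = reduces-* (G.𝒟 ℕ.* H.𝒟) (m∣m*n H.𝒟) (n∣m*n G.𝒟) cop G.reduces H.reduces
    ; c-bound = λ r → ℕ.≤-trans (ℕ.≤-reflexive (abs-* (G.c r) (H.c r))) (ℕ.*-mono-≤ (G.c-bound r) (H.c-bound r))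
    ; weight = begin
        G.B ℕ.* H.B ℕ.* m ℕ.^ (i ℕ.+ j)             ≡⟨ cong (G.B ℕ.* H.B ℕ.*_) (ℕ.^-distribˡ-+-* m i j) ⟩
        G.B ℕ.* H.B ℕ.* (m ℕ.^ i ℕ.* m ℕ.^ j)       ≡⟨ interchange G.B H.B (m ℕ.^ i) (m ℕ.^ j) ⟩
        G.B ℕ.* m ℕ.^ i ℕ.* (H.B ℕ.* m ℕ.^ j)       ≤⟨ ℕ.*-mono-≤ G.weight H.weight ⟩
        β ℕ.* G.N ℕ.* (γ ℕ.* H.N)                   ≡⟨ interchange β G.N γ H.N ⟩
        β ℕ.* γ ℕ.* (G.N ℕ.* H.N)                   ∎
    ; φ-bound = λ r → ℕ.≤-trans (ℕ.≤-reflexive (abs-* (φ r) (ψ r)))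
        (mul-pow (D ℕ.* D ℕ.* (D ℕ.* D)) (G.φ-bound r) (H.φ-bound r))
    ; 𝒟-bound = mul-pow (D ℕ.* D) G.𝒟-bound H.𝒟-bound
    ; N-bound = mul-pow (Z ℕ.* Z) G.N-bound H.N-bound
    ; 𝒟>0 = ℕ.*-mono-≤ G.𝒟>0 H.𝒟>0
    ; N>0 = ℕ.*-mono-≤ G.N>0 H.N>0
    ; 𝒟-primes = λ q pq q∣ → [ G.𝒟-primes q pq , H.𝒟-primes q pq ]′ (euclidsLemma G.𝒟 H.𝒟 pq q∣)
    ; N-primes = λ q pq q∣ →
        [ (λ d → let q∈ , D<q = G.N-primes q pq d in ∈-++⁺ˡ q∈ , D<q)
        , (λ d → let q∈ , D<q = H.N-primes q pq d in ∈-++⁺ʳ S q∈ , D<q) ]′ (euclidsLemma G.N H.N pq q∣)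
    }
    where
    module G = Good G
    module H = Good H
    open ℕ.≤-Reasoning
    interchange : ∀ a b c d → a ℕ.* b ℕ.* (c ℕ.* d) ≡ a ℕ.* c ℕ.* (b ℕ.* d)
    interchange = ℕ-Solver.solve-∀
    mul-pow : ∀ {x y} b → x ℕ.≤ b ℕ.^ i → y ℕ.≤ b ℕ.^ j → x ℕ.* y ℕ.≤ b ℕ.^ (i ℕ.+ j)
    mul-pow b x≤ y≤ = ℕ.≤-trans (ℕ.*-mono-≤ x≤ y≤) (ℕ.≤-reflexive (sym (ℕ.^-distribˡ-+-* b i j)))
    cop : Coprime G.N H.N
    cop = coprime-by-primes {{ℕ.>-nonZero G.N>0}} λ q pq q∣G q∣H →
      disj (proj₁ (G.N-primes q pq q∣G)) (proj₁ (H.N-primes q pq q∣H))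

  -- By `Avgⁿ-≥` it dominates `p ^ n` times the sum of a nonnegative `φ` over [np, np+p). Being
  -- linear, it can also be evaluated on the separate terms of an expansion, which have no sign.
  X : (ℕ → ℤ) → ℤ
  X φ = ∑< (n ℕ.* p ℕ.+ p) (Avgⁿ p n φ)

  X-cong : ∀ {φ ψ} → (∀ r → φ r ≡ ψ r) → X φ ≡ X ψ
  X-cong eq = ∑-cong (upTo (n ℕ.* p ℕ.+ p)) (Avgⁿ-cong p n eq)

  X-∑ : ∀ {A : Set} (xs : List A) (f : A → ℕ → ℤ) → X (λ r → ∑ xs (λ a → f a r)) ≡ ∑ xs (λ a → X (f a))
  X-∑ []       f = trans (∑-cong (upTo (n ℕ.* p ℕ.+ p)) (λ x → trans (Avgⁿ-const p n 0ℤ x) (*-zeroʳ (+ (p ℕ.^ n)))))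
        (∑-0 (upTo (n ℕ.* p ℕ.+ p)))
  X-∑ (a ∷ xs) f = trans (∑-cong (upTo (n ℕ.* p ℕ.+ p)) (Avgⁿ-+ p n (f a) _))
    (trans (∑-+ (upTo (n ℕ.* p ℕ.+ p)) _ _) (cong (λ t → X (f a) + t) (X-∑ xs f)))

  -- The second term of `Avgⁿ-≤-mean`, divided by the period and multiplied by `m ^ k`, for a
  -- product of k items: the inner power bounds the period, the last one the size of the product.
  Err : ℕ → ℕ
  Err k = m ℕ.^ k ℕ.* (((Z ℕ.* Z) ℕ.^ k ℕ.* (D ℕ.* D) ℕ.^ k) ℕ.^ n ℕ.* (2 ℕ.* (D ℕ.* D ℕ.* (D ℕ.* D)) ℕ.^ k))

  -- Test function 1 in `reduce` turns the sum over a period `N * 𝒟` into a sum of `c` over `𝒟`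
  -- terms, at most `𝒟 * B`. The mean is then at most B/N, which `weight` bounds by β/m^k.
  X-good : ∀ {k β S φ} → Good k β S φ →
           + (m ℕ.^ k) * X φ ≤ + ((n ℕ.* p ℕ.+ p) ℕ.* (p ℕ.^ n ℕ.* β ℕ.+ Err k))
  X-good {k} {β} {S} {φ} G = let open ≤-Reasoning in begin
    + (m ℕ.^ k) * X φ
      ≡⟨ sym (∑-*ˡ (upTo L) (+ (m ℕ.^ k)) (Avgⁿ p n φ)) ⟩
    ∑< L (λ x → + (m ℕ.^ k) * Avgⁿ p n φ x)
      ≤⟨ ∑ℤ-mono (upTo L) (λ x _ → pointwise x) ⟩
    ∑< L (λ _ → + (p ℕ.^ n ℕ.* β ℕ.+ Err k))
      ≡⟨ ∑<ℤ-const L _ ⟩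
    + L * + (p ℕ.^ n ℕ.* β ℕ.+ Err k)
      ≡⟨ sym (pos-* L _) ⟩
    + (L ℕ.* (p ℕ.^ n ℕ.* β ℕ.+ Err k)) ∎
    where
    open Good G
    L = n ℕ.* p ℕ.+ p
    M = N ℕ.* 𝒟
    F = (D ℕ.* D ℕ.* (D ℕ.* D)) ℕ.^ k
    Mmax = (Z ℕ.* Z) ℕ.^ k ℕ.* (D ℕ.* D) ℕ.^ k
    instance
      M≢0 : NonZero M
      M≢0 = ℕ.>-nonZero (ℕ.*-mono-≤ N>0 𝒟>0)
    𝒟⊥N : Coprime 𝒟 N
    𝒟⊥N = coprime-by-primes {{ℕ.>-nonZero 𝒟>0}} λ q pq q∣𝒟 q∣N →
      ℕ.<⇒≱ (proj₂ (N-primes q pq q∣N)) (𝒟-primes q pq q∣𝒟)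
    sum-eq : ∑< M φ ≡ ∑< 𝒟 c
    sum-eq = trans (∑-cong (upTo M) (λ r → sym (*-identityˡ (φ r))))
      (trans (reduces .reduce 𝒟 (λ _ → 1ℤ) ∣-refl 𝒟⊥N (λ _ → refl)) (∑-cong (upTo 𝒟) (λ r → *-identityˡ (c r))))
    H≤ : ∣ ∑< M φ ∣ ℕ.≤ 𝒟 ℕ.* B
    H≤ = subst (λ t → ∣ t ∣ ℕ.≤ 𝒟 ℕ.* B) (sym sum-eq) (∣∑<∣≤ 𝒟 c c-bound)
    M≤ : M ℕ.≤ Mmax
    M≤ = ℕ.*-mono-≤ N-bound 𝒟-bound
    a = p ℕ.^ n
    μ = m ℕ.^ k
    nat : μ ℕ.* (a ℕ.* (𝒟 ℕ.* B) ℕ.+ M ℕ.^ n ℕ.* (2 ℕ.* (M ℕ.* F))) ℕ.≤ M ℕ.* (a ℕ.* β ℕ.+ Err k)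
    nat = let open ℕ.≤-Reasoning in begin
      μ ℕ.* (a ℕ.* (𝒟 ℕ.* B) ℕ.+ M ℕ.^ n ℕ.* (2 ℕ.* (M ℕ.* F)))
        ≡⟨ alg₁ μ a 𝒟 B (M ℕ.^ n) M F ⟩
      a ℕ.* 𝒟 ℕ.* (B ℕ.* μ) ℕ.+ M ℕ.* (μ ℕ.* (M ℕ.^ n ℕ.* (2 ℕ.* F)))
        ≤⟨ ℕ.+-mono-≤ (ℕ.*-monoʳ-≤ (a ℕ.* 𝒟) weight)
             (ℕ.*-monoʳ-≤ M (ℕ.*-monoʳ-≤ μ (ℕ.*-monoˡ-≤ (2 ℕ.* F) (ℕ.^-monoˡ-≤ n M≤)))) ⟩
      a ℕ.* 𝒟 ℕ.* (β ℕ.* N) ℕ.+ M ℕ.* Err k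
        ≡⟨ alg₂ a 𝒟 β N (Err k) ⟩
      M ℕ.* (a ℕ.* β ℕ.+ Err k) ∎
      where
      alg₁ : ∀ μ a 𝒟 B x M F → μ ℕ.* (a ℕ.* (𝒟 ℕ.* B) ℕ.+ x ℕ.* (2 ℕ.* (M ℕ.* F)))
                             ≡ a ℕ.* 𝒟 ℕ.* (B ℕ.* μ) ℕ.+ M ℕ.* (μ ℕ.* (x ℕ.* (2 ℕ.* F)))
      alg₁ = ℕ-Solver.solve-∀
      alg₂ : ∀ a 𝒟 β N e → a ℕ.* 𝒟 ℕ.* (β ℕ.* N) ℕ.+ N ℕ.* 𝒟 ℕ.* e ≡ N ℕ.* 𝒟 ℕ.* (a ℕ.* β ℕ.+ e)
      alg₂ = ℕ-Solver.solve-∀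
    swap : ∀ x y z → x * (y * z) ≡ y * (x * z)
    swap = solve-∀
    pointwise : ∀ x → + μ * Avgⁿ p n φ x ≤ + (a ℕ.* β ℕ.+ Err k)
    pointwise x = *-cancelˡ-≤-pos _ _ (+ M) {{positive (+<+ (ℕ.>-nonZero⁻¹ M))}} (let open ≤-Reasoning in begin
      + M * (+ μ * Avgⁿ p n φ x)
        ≡⟨ swap (+ M) (+ μ) _ ⟩
      + μ * (+ M * Avgⁿ p n φ x)
        ≤⟨ *-monoˡ-≤-nonNeg (+ μ) (Avgⁿ-≤-mean p n (reduces .f-periodic) φ-bound H≤ x) ⟩
      + μ * + (a ℕ.* (𝒟 ℕ.* B) ℕ.+ M ℕ.^ n ℕ.* (2 ℕ.* (M ℕ.* F)))
        ≡⟨ sym (pos-* μ _) ⟩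
      + (μ ℕ.* (a ℕ.* (𝒟 ℕ.* B) ℕ.+ M ℕ.^ n ℕ.* (2 ℕ.* (M ℕ.* F))))
        ≤⟨ +≤+ nat ⟩
      + (M ℕ.* (a ℕ.* β ℕ.+ Err k))
        ≡⟨ pos-* M _ ⟩
      + M * + (a ℕ.* β ℕ.+ Err k) ∎)

  -- A sum of squares written out as products, each paired with its weight in the sense of `Good`.
  -- `βV` limits the total main term, and `TV` the number of error terms.
  record Block (βV TV : ℕ) : Set where
    field
      items   : List ((ℕ → ℤ) × ℕ)
      support : List ℕ
      good    : ∀ {fβ} → fβ ∈ items → Good 1 (proj₂ fβ) support (proj₁ fβ)
      β-sum   : ℕΣ.∑ items proj₂ ℕ.≤ βV
      size    : length items ℕ.≤ TV

    value : ℕ → ℤ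
    value r = ∑ items (λ fβ → proj₁ fβ r)

  open Block

  ∏V : ∀ {βV TV} → List (Block βV TV) → ℕ → ℤ
  ∏V []       r = 1ℤ
  ∏V (b ∷ bs) r = value b r * ∏V bs r

  -- The supports are accumulated in the order in which `X-∏V` multiplies items into `φ`.
  data Separated {βV TV} (S : List ℕ) : List (Block βV TV) → Set where
    []  : Separated S []
    _∷_ : ∀ {b bs} → (∀ {q} → q ∈ support b → ¬ q ∈ S) → Separated (support b ++ S) bs → Separated S (b ∷ bs)

  -- `φ` holds one item from each block expanded so far. Only complete products are estimated, since
  -- it is there that the coprime moduli make the means multiply. The main terms add up to
  -- `β * βV ^ l`, and each of the at most `TV ^ l` products costs one `Err`.
  X-∏V : ∀ {βV TV} (bs : List (Block βV TV)) {j β S φ} → Good j β S φ → Separated S bs →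
         let l = length bs ; k = l ℕ.+ j in
         + (m ℕ.^ k) * X (λ r → φ r * ∏V bs r)
           ≤ + ((n ℕ.* p ℕ.+ p) ℕ.* (p ℕ.^ n ℕ.* (β ℕ.* βV ℕ.^ l) ℕ.+ TV ℕ.^ l ℕ.* Err k))
  X-∏V [] {j} {β} {S} {φ} G [] = begin
    + (m ℕ.^ j) * X (λ r → φ r * 1ℤ)  ≡⟨ cong (λ t → + (m ℕ.^ j) * t) (X-cong (λ r → *-identityʳ (φ r))) ⟩
    + (m ℕ.^ j) * X φ                 ≤⟨ X-good G ⟩
    + (L ℕ.* (p ℕ.^ n ℕ.* β ℕ.+ Err j))
      ≡⟨ cong₂ (λ s t → + (L ℕ.* (p ℕ.^ n ℕ.* s ℕ.+ t))) (sym (ℕ.*-identityʳ β)) (sym (ℕ.*-identityˡ (Err j))) ⟩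
    + (L ℕ.* (p ℕ.^ n ℕ.* (β ℕ.* 1) ℕ.+ 1 ℕ.* Err j)) ∎
    where
    open ≤-Reasoning
    L = n ℕ.* p ℕ.+ p
  X-∏V {βV} {TV} (b ∷ bs) {j} {β} {S} {φ} G (b# ∷ sep) = let open ≤-Reasoning in begin
    + μ * X (λ r → φ r * (value b r * ∏V bs r))
      ≡⟨ cong (λ t → + μ * t) (X-cong expand) ⟩
    + μ * X (λ r → ∑ (items b) (λ fβ → ψ fβ r * ∏V bs r))
      ≡⟨ cong (λ t → + μ * t) (X-∑ (items b) _) ⟩
    + μ * ∑ (items b) (λ fβ → X (λ r → ψ fβ r * ∏V bs r))
      ≡⟨ sym (∑-*ˡ (items b) (+ μ) _) ⟩
    ∑ (items b) (λ fβ → + μ * X (λ r → ψ fβ r * ∏V bs r))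
      ≤⟨ ∑ℤ-mono (items b) (λ fβ fβ∈ → subst (λ k → + (m ℕ.^ k) * X (λ r → ψ fβ r * ∏V bs r)
             ≤ + (L ℕ.* (p ℕ.^ n ℕ.* (proj₂ fβ ℕ.* β ℕ.* βV ℕ.^ l) ℕ.+ TV ℕ.^ l ℕ.* Err k))) (ℕ.+-suc l j)
           (X-∏V bs (good-* b# (good b fβ∈) G) sep)) ⟩
    ∑ (items b) (λ fβ → + (L ℕ.* (p ℕ.^ n ℕ.* (proj₂ fβ ℕ.* β ℕ.* βV ℕ.^ l) ℕ.+ TV ℕ.^ l ℕ.* E′)))
      ≡⟨ ∑-pos (items b) _ ⟩
    + (ℕΣ.∑ (items b) (λ fβ → L ℕ.* (p ℕ.^ n ℕ.* (proj₂ fβ ℕ.* β ℕ.* βV ℕ.^ l) ℕ.+ TV ℕ.^ l ℕ.* E′)))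
      ≤⟨ +≤+ nat ⟩
    + (L ℕ.* (p ℕ.^ n ℕ.* (β ℕ.* βV ℕ.^ suc l) ℕ.+ TV ℕ.^ suc l ℕ.* E′)) ∎
    where
    L = n ℕ.* p ℕ.+ p
    l = length bs
    μ = m ℕ.^ (suc l ℕ.+ j)
    E′ = Err (suc l ℕ.+ j)
    ψ : (ℕ → ℤ) × ℕ → ℕ → ℤ
    ψ fβ r = proj₁ fβ r * φ r
    alg : ∀ x y z → x * (y * z) ≡ (y * x) * z
    alg = solve-∀
    expand : ∀ r → φ r * (value b r * ∏V bs r) ≡ ∑ (items b) (λ fβ → ψ fβ r * ∏V bs r)
    expand r = trans (alg (φ r) (value b r) (∏V bs r))
      (trans (cong (λ t → t * ∏V bs r) (sym (∑-*ʳ (items b) (φ r) _))) (sym (∑-*ʳ (items b) (∏V bs r) _)))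
    x = L ℕ.* p ℕ.^ n ℕ.* (β ℕ.* βV ℕ.^ l)
    y = L ℕ.* (TV ℕ.^ l ℕ.* E′)
    alg₁ : ∀ L a w β v u → L ℕ.* (a ℕ.* (w ℕ.* β ℕ.* v) ℕ.+ u) ≡ w ℕ.* (L ℕ.* a ℕ.* (β ℕ.* v)) ℕ.+ L ℕ.* u
    alg₁ = ℕ-Solver.solve-∀
    alg₂ : ∀ L a w β v u t e → w ℕ.* (L ℕ.* a ℕ.* (β ℕ.* v)) ℕ.+ t ℕ.* (L ℕ.* (u ℕ.* e)) ≡ L ℕ.*
          (a ℕ.* (β ℕ.* (w ℕ.* v)) ℕ.+ t ℕ.* u ℕ.* e)
    alg₂ = ℕ-Solver.solve-∀
    nat : ℕΣ.∑ (items b) (λ fβ → L ℕ.* (p ℕ.^ n ℕ.* (proj₂ fβ ℕ.* β ℕ.* βV ℕ.^ l) ℕ.+ TV ℕ.^ l ℕ.* E′))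
          ℕ.≤ L ℕ.* (p ℕ.^ n ℕ.* (β ℕ.* βV ℕ.^ suc l) ℕ.+ TV ℕ.^ suc l ℕ.* E′)
    nat = let open ℕ.≤-Reasoning in begin
      ℕΣ.∑ (items b) (λ fβ → L ℕ.* (p ℕ.^ n ℕ.* (proj₂ fβ ℕ.* β ℕ.* βV ℕ.^ l) ℕ.+ TV ℕ.^ l ℕ.* E′))
        ≡⟨ ℕΣ.∑-cong (items b) (λ fβ → alg₁ L (p ℕ.^ n) (proj₂ fβ) β (βV ℕ.^ l) (TV ℕ.^ l ℕ.* E′)) ⟩
      ℕΣ.∑ (items b) (λ fβ → proj₂ fβ ℕ.* x ℕ.+ y)
        ≡⟨ trans (ℕΣ.∑-+ (items b) _ _) (cong₂ ℕ._+_ (ℕΣ.∑-*ʳ (items b) x proj₂) (∑-const (items b) y)) ⟩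
      ℕΣ.∑ (items b) proj₂ ℕ.* x ℕ.+ length (items b) ℕ.* y
        ≤⟨ ℕ.+-mono-≤ (ℕ.*-monoˡ-≤ x (β-sum b)) (ℕ.*-monoˡ-≤ y (size b)) ⟩
      βV ℕ.* x ℕ.+ TV ℕ.* y
        ≡⟨ alg₂ L (p ℕ.^ n) βV β (βV ℕ.^ l) (TV ℕ.^ l) TV E′ ⟩
      L ℕ.* (p ℕ.^ n ℕ.* (β ℕ.* βV ℕ.^ suc l) ℕ.+ TV ℕ.^ suc l ℕ.* E′) ∎

  ∏V-upper : ∀ {βV TV} (bs : List (Block βV TV)) → Separated [] bs →
             (∀ b → b ∈ bs → ∀ r → 0ℤ ≤ value b r) →
             let k = length bs in
             + (m ℕ.^ k) * (+ (p ℕ.^ n) * ∑< p (λ i → ∏V bs (n ℕ.* p ℕ.+ i)))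
               ≤ + ((n ℕ.* p ℕ.+ p) ℕ.* (p ℕ.^ n ℕ.* βV ℕ.^ k ℕ.+ TV ℕ.^ k ℕ.* Err k))
  ∏V-upper {βV} {TV} bs sep V≥0 = begin
    + (m ℕ.^ k) * (+ (p ℕ.^ n) * ∑< p (λ i → ∏V bs (n ℕ.* p ℕ.+ i)))
      ≡⟨ cong (λ t → + (m ℕ.^ k) * (+ (p ℕ.^ n) * t))
            (∑-cong (upTo p) (λ i → cong (λ t → ∏V bs (t ℕ.+ i)) (sym (ℕ.+-identityʳ (n ℕ.* p))))) ⟩
    + (m ℕ.^ k) * (+ (p ℕ.^ n) * ∑< p (λ i → ∏V bs (n ℕ.* p ℕ.+ 0 ℕ.+ i)))
      ≤⟨ *-monoˡ-≤-nonNeg (+ (m ℕ.^ k)) (Avgⁿ-≥ p n (∏V≥0 bs V≥0) 0 p) ⟩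
    + (m ℕ.^ k) * X (∏V bs)
      ≡⟨ cong₂ (λ e t → + (m ℕ.^ e) * t) (sym (ℕ.+-identityʳ k)) (X-cong (λ r → sym (*-identityˡ (∏V bs r)))) ⟩
    + (m ℕ.^ (k ℕ.+ 0)) * X (λ r → 1ℤ * ∏V bs r)
      ≤⟨ X-∏V bs good-1 sep ⟩
    + (L ℕ.* (p ℕ.^ n ℕ.* (1 ℕ.* βV ℕ.^ k) ℕ.+ TV ℕ.^ k ℕ.* Err (k ℕ.+ 0)))
      ≡⟨ cong₂ (λ s t → + (L ℕ.* (p ℕ.^ n ℕ.* s ℕ.+ TV ℕ.^ k ℕ.* Err t))) (ℕ.*-identityˡ (βV ℕ.^ k)) (ℕ.+-identityʳ k) ⟩
    + (L ℕ.* (p ℕ.^ n ℕ.* βV ℕ.^ k ℕ.+ TV ℕ.^ k ℕ.* Err k)) ∎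
    where
    open ≤-Reasoning
    k = length bs
    L = n ℕ.* p ℕ.+ p
    ∏V≥0 : ∀ bs → (∀ b → b ∈ bs → ∀ r → 0ℤ ≤ value b r) → ∀ r → 0ℤ ≤ ∏V bs r
    ∏V≥0 []       V≥0 r = +≤+ z≤n
    ∏V≥0 (b ∷ bs) V≥0 r = begin
      0ℤ                      ≡⟨ sym (*-zeroʳ (value b r)) ⟩
      value b r * 0ℤ          ≤⟨ *-monoˡ-≤-nonNeg (value b r) {{nonNegative (V≥0 b (here refl) r)}}
            (∏V≥0 bs (λ b → V≥0 b ∘ there) r) ⟩
      value b r * ∏V bs r     ∎

-- Cutting a list into disjoint pieces.

module Chunks where

  open import Data.Nat
  open import Data.Nat.Properties
  Disjoint : List ℕ → List ℕ → Set
  Disjoint xs ys = ∀ q → q ∈ xs → ¬ q ∈ ys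

  ∈-take⇒∈ : ∀ m L {q : ℕ} → q ∈ take m L → q ∈ L
  ∈-take⇒∈ m L {q} q∈ = subst (q ∈_) (take++drop≡id m L) (∈-++⁺ˡ q∈)

  ∈-drop⇒∈ : ∀ m L {q : ℕ} → q ∈ drop m L → q ∈ L
  ∈-drop⇒∈ m L {q} q∈ = subst (q ∈_) (take++drop≡id m L) (∈-++⁺ʳ (take m L) q∈)

  take-drop-disjoint : ∀ m {L} → Unique L → Disjoint (take m L) (drop m L)
  take-drop-disjoint (suc m) {_ ∷ L} (x∉ ∷ uL) q (here refl) q∈ = All.lookup x∉ (∈-drop⇒∈ m L q∈) refl
  take-drop-disjoint (suc m) (x∉ ∷ uL) q (there q∈₁) q∈₂ = take-drop-disjoint m uL q q∈₁ q∈₂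

  record Chunk (m : ℕ) (L bl : List ℕ) : Set where
    constructor chunk
    field
      unique : Unique bl
      size   : length bl ≡ m
      subset : ∀ {q} → q ∈ bl → q ∈ L

  chunks : ∀ k m L → Unique L → k * m ≤ length L →
           ∃[ bls ] length bls ≡ k × All (Chunk m L) bls × AllPairs Disjoint bls
  chunks zero    m L uL len = [] , refl , [] , []
  chunks (suc k) m L uL len =
    let bls , lbls , cs , dis = chunks k m (drop m L) (Unique.drop⁺ m uL)
          (subst (k * m ≤_) (sym (length-drop m L)) (m+n≤o⇒m≤o∸n (k * m) (≤-trans (≤-reflexive (+-comm (k * m) m)) len)))
    in take m L ∷ bls , cong suc lbls
     , chunk (Unique.take⁺ m uL) (trans (length-take m L) (m≤n⇒m⊓n≡m (≤-trans (m≤m+n m (k * m)) len))) (∈-take⇒∈ m L)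
       ∷ All.map (λ { (chunk u s sub) → chunk u s (∈-drop⇒∈ m L ∘ sub) }) cs
     , All.map (λ { (chunk _ _ sub) q q∈t q∈bl → take-drop-disjoint m uL q q∈t (sub q∈bl) }) cs ∷ dis

-- Variances of the small-square events.

module SquareBlocks (p n D Z m : ℕ) (ds : List ℕ) (prime-p : Prime p) (D<p : D ℕ.< p) (Z<p : Z ℕ.< p)
                    (ds-bounds : ∀ d → d ∈ ds → 2 ℕ.≤ d × d ℕ.≤ D) where

  private
    instance
      p≢0 : NonZero p
      p≢0 = prime⇒nonZero prime-p

  open import Data.Integer hiding (suc; NonZero)
  open import Data.Integer.Properties
  open import Data.Integer.Tactic.RingSolver using (solve-∀)
  import Data.Nat.Tactic.RingSolver as ℕ-Solver
  open ℤΣ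
  open IntegerSums
  open Residues
  open Reduction
  open PrimeDivisors
  open Chunks using (Disjoint)
  open Blocks p n D Z m

  -- Modulo `d * d * z` the factor `d * d * z ∸ 1` is -1, so these are -p and -(n+1)p. The offset
  -- n+1 is the least possible quotient of z u + r by p.
  α κ : ℕ → ℕ → ℕ
  α d z = (d ℕ.* d ℕ.* z ℕ.∸ 1) ℕ.* p
  κ d z = α d z ℕ.* suc n

  module Ev (d z : ℕ) = Event (d ℕ.* d) z (α d z) (κ d z)
  open Ev using (E; g)

  D⁴ : ℕ
  D⁴ = D ℕ.* D ℕ.* (D ℕ.* D)

  record PrimeBlock (bl : List ℕ) : Set where
    field
      unique : Unique bl
      size≡m : length bl ≡ m
      member : ∀ z → z ∈ bl → Prime z × D ℕ.< z × m ℕ.≤ z × z ℕ.≤ Z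

  F : ℕ → List ℕ → ℕ → ℕ
  F d bl r = ℕΣ.∑ bl (λ z → E d z r)

  -- More than 3/2 times the expected m/d². The 3/2 keeps the deviation of `d * d * F d bl r` from
  -- `m` above m/2, and times a sum of 1/d² below 1/2 it still stays below 3/4.
  Bad : ℕ → List ℕ → Set
  Bad r bl = Any (λ d → 3 ℕ.* m ℕ.< 2 ℕ.* (d ℕ.* d ℕ.* F d bl r)) ds

  bad? : ∀ r bl → Dec (Bad r bl)
  bad? r bl = any? (λ d → 3 ℕ.* m ℕ.<? 2 ℕ.* (d ℕ.* d ℕ.* F d bl r)) ds

  coprime-pred : ∀ N .{{_ : NonZero N}} → Coprime (N ℕ.∸ 1) N
  coprime-pred (suc N) {d} (d∣N , d∣1+N) = ∣1⇒≡1 (∣m+n∣m⇒∣n (subst (d ∣_) (ℕ.+-comm 1 N) d∣1+N) d∣N)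

  module _ {d z} (2≤d : 2 ℕ.≤ d) (d≤D : d ℕ.≤ D) (prime-z : Prime z) (D<z : D ℕ.< z) (z≤Z : z ℕ.≤ Z) where

    private instance
      d≢0 : NonZero d
      d≢0 = ℕ.>-nonZero (ℕ.<⇒≤ 2≤d)
      z≢0 : NonZero z
      z≢0 = prime⇒nonZero prime-z
      dd≢0 : NonZero (d ℕ.* d)
      dd≢0 = ℕ.m*n≢0 d d
      ddz≢0 : NonZero (d ℕ.* d ℕ.* z)
      ddz≢0 = ℕ.m*n≢0 (d ℕ.* d) z

    coprime-dd-p : Coprime (d ℕ.* d) p
    coprime-dd-p = let c = Coprime.sym (prime⇒coprime prime-p (ℕ.≤-<-trans d≤D D<p)) in coprime-* c c

    coprime-α-dd : Coprime (α d z) (d ℕ.* d)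
    coprime-α-dd = coprime-*
      (Coprime.sym (coprime-∣ˡ (m∣m*n z) (Coprime.sym (coprime-pred (d ℕ.* d ℕ.* z)))))
      (Coprime.sym coprime-dd-p)

    coprime-α-z : Coprime (α d z) z
    coprime-α-z = coprime-*
      (Coprime.sym (coprime-∣ˡ (n∣m*n (d ℕ.* d)) (Coprime.sym (coprime-pred (d ℕ.* d ℕ.* z)))))
      (prime⇒coprime prime-p (ℕ.≤-<-trans z≤Z Z<p))

    module EvB = Ev.Bounds d z coprime-α-dd coprime-α-z

    dd-primes : ∀ q → Prime q → q ∣ d ℕ.* d → q ℕ.≤ D
    dd-primes q pq q∣ = ℕ.≤-trans (∣⇒≤ ([ (λ x → x) , (λ x → x) ]′ (euclidsLemma d d pq q∣))) d≤D

    dd≤DD : d ℕ.* d ℕ.≤ D ℕ.* D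
    dd≤DD = ℕ.*-mono-≤ d≤D d≤D

    dd>0 : 1 ℕ.≤ d ℕ.* d
    dd>0 = ℕ.>-nonZero⁻¹ (d ℕ.* d)

    2≤dd : 2 ℕ.≤ d ℕ.* d
    2≤dd = ℕ.≤-trans 2≤d (ℕ.m≤m*n d d)

  Index : Set
  Index = ℕ × ℕ × ℕ

  f : Index → ℕ → ℤ
  f (d , z , z′) r = g d z r * g d z′ r

  -- Weights in units of 1/m. On the diagonal the mean of g² is bounded only by `D⁴`; off the
  -- diagonal the mean of the product is at most d⁴/(z z′), hence at most D⁴/m.
  β : Index → ℕ
  β (d , z , z′) with z ℕ.≟ z′
  ... | yes _ = D⁴ ℕ.* m
  ... | no  _ = D⁴

  module _ {bl} (B : PrimeBlock bl) where

    open PrimeBlock B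

    prime-divisor-∈ : ∀ {z} → z ∈ bl → ∀ q → Prime q → q ∣ z → q ∈ bl × D ℕ.< q
    prime-divisor-∈ {z} z∈ q pq q∣z with prime⇒irreducible (proj₁ (member z z∈)) q∣z
    ... | inj₁ refl = contradiction pq ¬prime[1]
    ... | inj₂ refl = z∈ , proj₁ (proj₂ (member z z∈))

    good-f : ∀ {d z z′} → d ∈ ds → z ∈ bl → z′ ∈ bl → Good 1 (β (d , z , z′)) bl (f (d , z , z′))
    good-f {d} {z} {z′} d∈ z∈ z′∈ with z ℕ.≟ z′ | ds-bounds d d∈ | member z z∈ | member z′ z′∈
    ... | yes refl | 2≤d , d≤D | pz , D<z , m≤z , z≤Z | _ = record
      { 𝒟 = d ℕ.* d ; N = z ; B = d ℕ.* d ℕ.* (d ℕ.* d) ℕ.* z ; c = Ev.e d z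
      ; reduces = EvB.reduces-g² 2≤d d≤D pz D<z z≤Z
      ; c-bound = EvB.∣e∣≤ 2≤d d≤D pz D<z z≤Z (2≤dd 2≤d d≤D pz D<z z≤Z)
      ; weight = begin
          d ℕ.* d ℕ.* (d ℕ.* d) ℕ.* z ℕ.* (m ℕ.* 1)  ≡⟨ alg (d ℕ.* d ℕ.* (d ℕ.* d)) z m ⟩
          d ℕ.* d ℕ.* (d ℕ.* d) ℕ.* m ℕ.* z          ≤⟨ ℕ.*-monoˡ-≤ z (ℕ.*-monoˡ-≤ m d⁴≤) ⟩
          D⁴ ℕ.* m ℕ.* z                             ∎
      ; φ-bound = λ r → ℕ.≤-trans (ℕ.≤-reflexive (abs-* (g d z r) (g d z r)))
          (ℕ.≤-trans (ℕ.*-mono-≤ (∣g∣≤ r) (∣g∣≤ r)) (ℕ.≤-trans d⁴≤ (ℕ.≤-reflexive (sym (ℕ.*-identityʳ _)))))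
      ; 𝒟-bound = ℕ.≤-trans dd≤ (ℕ.≤-reflexive (sym (ℕ.*-identityʳ _)))
      ; N-bound = ℕ.≤-trans z≤Z (ℕ.≤-trans (ℕ.m≤m*n Z Z {{ℕ.>-nonZero
            (ℕ.≤-trans (ℕ.>-nonZero⁻¹ z {{prime⇒nonZero pz}}) z≤Z)}}) (ℕ.≤-reflexive (sym (ℕ.*-identityʳ _))))
      ; 𝒟>0 = dd>0 2≤d d≤D pz D<z z≤Z
      ; N>0 = ℕ.>-nonZero⁻¹ z {{prime⇒nonZero pz}}
      ; 𝒟-primes = dd-primes 2≤d d≤D pz D<z z≤Z
      ; N-primes = prime-divisor-∈ z∈
      }
      where
      open ℕ.≤-Reasoning
      alg : ∀ x z m → x ℕ.* z ℕ.* (m ℕ.* 1) ≡ x ℕ.* m ℕ.* z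
      alg = ℕ-Solver.solve-∀
      dd≤ = dd≤DD 2≤d d≤D pz D<z z≤Z
      d⁴≤ = ℕ.*-mono-≤ dd≤ dd≤
      ∣g∣≤ = EvB.∣g∣≤Q 2≤d d≤D pz D<z z≤Z
    ... | no z≢z′ | 2≤d , d≤D | pz , D<z , m≤z , z≤Z | pz′ , D<z′ , m≤z′ , z′≤Z = record
      { 𝒟 = d ℕ.* d ; N = z ℕ.* z′ ; B = d ℕ.* d ℕ.* (d ℕ.* d) ; c = λ r → Ev.c d z r * Ev.c d z′ r
      ; reduces = reduces-* (d ℕ.* d) ∣-refl ∣-refl (coprime-distinct-primes pz pz′ z≢z′)
          (EvB.reduces-g 2≤d d≤D pz D<z z≤Z) (EvB.reduces-g 2≤d d≤D pz′ D<z′ z′≤Z)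
      ; c-bound = λ r → ℕ.≤-trans (ℕ.≤-reflexive (abs-* (Ev.c d z r) (Ev.c d z′ r)))
          (ℕ.*-mono-≤ (EvB.∣c∣≤Q 2≤d d≤D pz D<z z≤Z r) (EvB.∣c∣≤Q 2≤d d≤D pz′ D<z′ z′≤Z r))
      ; weight = ℕ.*-mono-≤ d⁴≤ (ℕ.≤-trans (ℕ.≤-reflexive (ℕ.*-identityʳ m))
          (ℕ.≤-trans m≤z (ℕ.m≤m*n z z′ {{prime⇒nonZero pz′}})))
      ; φ-bound = λ r → ℕ.≤-trans (ℕ.≤-reflexive (abs-* (g d z r) (g d z′ r)))
          (ℕ.≤-trans (ℕ.*-mono-≤ (EvB.∣g∣≤Q 2≤d d≤D pz D<z z≤Z r) (EvB.∣g∣≤Q 2≤d d≤D pz′ D<z′ z′≤Z r))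
            (ℕ.≤-trans d⁴≤ (ℕ.≤-reflexive (sym (ℕ.*-identityʳ _)))))
      ; 𝒟-bound = ℕ.≤-trans dd≤ (ℕ.≤-reflexive (sym (ℕ.*-identityʳ _)))
      ; N-bound = ℕ.≤-trans (ℕ.*-mono-≤ z≤Z z′≤Z) (ℕ.≤-reflexive (sym (ℕ.*-identityʳ _)))
      ; 𝒟>0 = dd>0 2≤d d≤D pz D<z z≤Z
      ; N>0 = ℕ.*-mono-≤ (ℕ.>-nonZero⁻¹ z {{prime⇒nonZero pz}}) (ℕ.>-nonZero⁻¹ z′ {{prime⇒nonZero pz′}})
      ; 𝒟-primes = dd-primes 2≤d d≤D pz D<z z≤Z
      ; N-primes = λ q pq q∣ → [ prime-divisor-∈ z∈ q pq , prime-divisor-∈ z′∈ q pq ]′ (euclidsLemma z z′ pq q∣)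
      }
      where
      dd≤ = dd≤DD 2≤d d≤D pz D<z z≤Z
      d⁴≤ = ℕ.*-mono-≤ dd≤ dd≤

    idx : List Index
    idx = cartesianProduct ds (cartesianProduct bl bl)

    βV TV : ℕ
    βV = length ds ℕ.* (m ℕ.* (D⁴ ℕ.* m ℕ.+ m ℕ.* D⁴))
    TV = length ds ℕ.* (m ℕ.* m)

    ∑-idx : ∀ h → ℕΣ.∑ idx h ≡ ℕΣ.∑ ds (λ d → ℕΣ.∑ bl (λ z → ℕΣ.∑ bl (λ z′ → h (d , z , z′))))
    ∑-idx h = trans (ℕΣ.∑-cartesianProduct ds _ h) (ℕΣ.∑-cong ds (λ d → ℕΣ.∑-cartesianProduct bl bl _))

    β≤ : ∀ d z z′ → β (d , z , z′) ℕ.≤ ι (z ℕ.≟ z′) ℕ.* (D⁴ ℕ.* m) ℕ.+ D⁴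
    β≤ d z z′ with z ℕ.≟ z′
    ... | yes eq = ℕ.≤-trans (ℕ.≤-reflexive (sym
          (trans (cong (ℕ._* (D⁴ ℕ.* m)) (ι-yes (z ℕ.≟ z′) eq)) (ℕ.*-identityˡ _)))) (ℕ.m≤m+n _ D⁴)
    ... | no  _  = ℕ.m≤n+m D⁴ _

    inner-β : ∀ d z → ℕΣ.∑ bl (λ z′ → β (d , z , z′)) ℕ.≤ D⁴ ℕ.* m ℕ.+ m ℕ.* D⁴
    inner-β d z = begin
      ℕΣ.∑ bl (λ z′ → β (d , z , z′))
        ≤⟨ ∑-mono bl (λ z′ _ → β≤ d z z′) ⟩
      ℕΣ.∑ bl (λ z′ → ι (z ℕ.≟ z′) ℕ.* (D⁴ ℕ.* m) ℕ.+ D⁴)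
        ≡⟨ trans (ℕΣ.∑-+ bl _ _) (cong₂ ℕ._+_ (ℕΣ.∑-*ʳ bl (D⁴ ℕ.* m) _) (trans (∑-const bl D⁴) (cong (ℕ._* D⁴) size≡m))) ⟩
      ℕΣ.∑ bl (λ z′ → ι (z ℕ.≟ z′)) ℕ.* (D⁴ ℕ.* m) ℕ.+ m ℕ.* D⁴
        ≤⟨ ℕ.+-monoˡ-≤ (m ℕ.* D⁴) (ℕ.*-monoˡ-≤ (D⁴ ℕ.* m) (∑-ι-≤1 bl (z ℕ.≟_) unique (λ x y _ _ z≡x z≡y → trans (sym z≡x) z≡y))) ⟩
      1 ℕ.* (D⁴ ℕ.* m) ℕ.+ m ℕ.* D⁴
        ≡⟨ cong (ℕ._+ m ℕ.* D⁴) (ℕ.*-identityˡ (D⁴ ℕ.* m)) ⟩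
      D⁴ ℕ.* m ℕ.+ m ℕ.* D⁴ ∎
      where open ℕ.≤-Reasoning

    block : Block βV TV
    block = record
      { items   = map (λ τ → f τ , β τ) idx
      ; support = bl
      ; good    = λ fβ∈ → let τ , τ∈ , eq = ∈-map⁻ _ fβ∈ in
          subst (λ fβ → Good 1 (proj₂ fβ) bl (proj₁ fβ)) (sym eq) (good-idx τ τ∈)
      ; β-sum   = begin
          ℕΣ.∑ (map (λ τ → f τ , β τ) idx) proj₂  ≡⟨ ℕΣ.∑-map (λ τ → f τ , β τ) idx proj₂ ⟩
          ℕΣ.∑ idx β                              ≡⟨ ∑-idx β ⟩
          ℕΣ.∑ ds (λ d → ℕΣ.∑ bl (λ z → ℕΣ.∑ bl (λ z′ → β (d , z , z′))))
            ≤⟨ ∑-const-≤ ds _ (λ d _ → ℕ.≤-trans (∑-const-≤ bl _ (λ z _ → inner-β d z)) (ℕ.≤-reflexive (cong (ℕ._* _) size≡m))) ⟩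
          βV ∎
      ; size    = begin
          length (map (λ τ → f τ , β τ) idx)      ≡⟨ length-map _ idx ⟩
          length idx                              ≡⟨ sym (ℕ.*-identityʳ _) ⟩
          length idx ℕ.* 1                        ≡⟨ sym (∑-const idx 1) ⟩
          ℕΣ.∑ idx (λ _ → 1)                      ≡⟨ ∑-idx (λ _ → 1) ⟩
          ℕΣ.∑ ds (λ d → ℕΣ.∑ bl (λ z → ℕΣ.∑ bl (λ z′ → 1)))
            ≡⟨ trans (∑-const ds _) (cong (length ds ℕ.*_)
                  (trans (∑-const bl _) (cong₂ ℕ._*_ size≡m (trans (∑-const bl 1) (trans (ℕ.*-identityʳ _) size≡m))))) ⟩
          TV ∎
      }
      where
      open ℕ.≤-Reasoning
      good-idx : ∀ τ → τ ∈ idx → Good 1 (β τ) bl (f τ)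
      good-idx (d , z , z′) τ∈ =
        let d∈ , zz′∈ = ∈-cartesianProduct⁻ ds (cartesianProduct bl bl) τ∈
            z∈ , z′∈ = ∈-cartesianProduct⁻ bl bl zz′∈
        in good-f d∈ z∈ z′∈

    G : ℕ → ℕ → ℤ
    G d r = ∑ bl (λ z → g d z r)

    value-block : ∀ r → Block.value block r ≡ ∑ ds (λ d → G d r * G d r)
    value-block r = begin
      ∑ (map (λ τ → f τ , β τ) idx) (λ fβ → proj₁ fβ r)
        ≡⟨ ∑-map (λ τ → f τ , β τ) idx _ ⟩
      ∑ idx (λ τ → f τ r)
        ≡⟨ trans (∑-cartesianProduct ds _ _) (∑-cong ds (λ d → ∑-cartesianProduct bl bl _)) ⟩
      ∑ ds (λ d → ∑ bl (λ z → ∑ bl (λ z′ → g d z r * g d z′ r)))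
        ≡⟨ ∑-cong ds (λ d → sym (∑-*-∑ bl bl (λ z → g d z r) (λ z → g d z r))) ⟩
      ∑ ds (λ d → G d r * G d r) ∎
      where open ≡-Reasoning

    square-nonneg : ∀ i → 0ℤ ≤ i * i
    square-nonneg (+ a)    = ≤-trans (+≤+ z≤n) (≤-reflexive (pos-* a a))
    square-nonneg -[1+ _ ] = +≤+ z≤n

    block-nonneg : ∀ r → 0ℤ ≤ Block.value block r
    block-nonneg r = ≤-trans (∑ℤ-nonneg ds (λ d → square-nonneg (G d r))) (≤-reflexive (sym (value-block r)))

    G≡ : ∀ d r → G d r ≡ + (d ℕ.* d ℕ.* F d bl r) - + m
    G≡ d r = begin
      ∑ bl (λ z → + (d ℕ.* d) * + E d z r + -1ℤ)
        ≡⟨ ∑-+ bl _ _ ⟩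
      ∑ bl (λ z → + (d ℕ.* d) * + E d z r) + ∑ bl (λ _ → -1ℤ)
        ≡⟨ cong₂ _+_ (trans (∑-*ˡ bl (+ (d ℕ.* d)) _)
              (trans (cong (λ t → + (d ℕ.* d) * t) (∑-pos bl _)) (sym (pos-* (d ℕ.* d) _))))
                     (trans (∑ℤ-const bl -1ℤ) (trans (cong (λ t → + t * -1ℤ) size≡m)
                           (trans (*-comm (+ m) -1ℤ) (-1*i≡-i (+ m))))) ⟩
      + (d ℕ.* d ℕ.* F d bl r) - + m ∎
      where open ≡-Reasoning

    -- For a bad `d` the deviation `G d r` is at least m/2, and its square is one of the nonnegative
    -- terms of the value.
    block-bad : ∀ r → Bad r bl → + (m ℕ.* m) ≤ + 4 * Block.value block r
    block-bad r bad with find bad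
    ... | d , d∈ , 3m< = begin
      + (m ℕ.* m)                         ≤⟨ +≤+ mm≤ ⟩
      + (4 ℕ.* (b ℕ.* b))                 ≡⟨ trans (pos-* 4 (b ℕ.* b)) (cong (λ t → + 4 * t) (pos-* b b)) ⟩
      + 4 * (+ b * + b)                   ≡⟨ cong (λ t → + 4 * (t * t)) (sym G≡b) ⟩
      + 4 * (G d r * G d r)               ≤⟨ *-monoˡ-≤-nonNeg (+ 4) (∑ℤ-∈ ds (λ d → square-nonneg (G d r)) d∈) ⟩
      + 4 * ∑ ds (λ d → G d r * G d r)    ≡⟨ cong (λ t → + 4 * t) (sym (value-block r)) ⟩
      + 4 * Block.value block r           ∎
      where
      open ≤-Reasoning
      a = d ℕ.* d ℕ.* F d bl r
      m≤a : m ℕ.≤ a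
      m≤a = ℕ.*-cancelˡ-≤ 2 (ℕ.≤-trans (ℕ.*-monoˡ-≤ m (s≤s (s≤s (z≤n {1})))) (ℕ.<⇒≤ 3m<))
      b = a ℕ.∸ m
      a≡ : a ≡ b ℕ.+ m
      a≡ = sym (ℕ.m∸n+n≡m m≤a)
      G≡b : G d r ≡ + b
      G≡b = trans (G≡ d r) (trans (m-n≡m⊖n a m) (⊖-≥ m≤a))
      alg : ∀ b m → 2 ℕ.* (b ℕ.+ m) ≡ 2 ℕ.* b ℕ.+ 2 ℕ.* m
      alg = ℕ-Solver.solve-∀
      alg₂ : ∀ b → 2 ℕ.* b ℕ.* (2 ℕ.* b) ≡ 4 ℕ.* (b ℕ.* b)
      alg₂ = ℕ-Solver.solve-∀
      m≤2b : m ℕ.≤ 2 ℕ.* b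
      m≤2b = ℕ.+-cancelʳ-≤ (2 ℕ.* m) m (2 ℕ.* b)
        (subst (3 ℕ.* m ℕ.≤_) (trans (cong (2 ℕ.*_) a≡) (alg b m)) (ℕ.<⇒≤ 3m<))
      mm≤ : m ℕ.* m ℕ.≤ 4 ℕ.* (b ℕ.* b)
      mm≤ = subst (m ℕ.* m ℕ.≤_) (alg₂ b) (ℕ.*-mono-≤ m≤2b m≤2b)

  disjoint-[] : ∀ xs → Disjoint xs []
  disjoint-[] xs _ _ ()

  allBad : ℕ → List (List ℕ) → ℕ
  allBad r bls = ι (all? (bad? r) bls)

  -- The same numbers as `βV` and `TV`, but free of a block, so that all blocks have one type.
  βW TW : ℕ
  βW = length ds ℕ.* (m ℕ.* (D⁴ ℕ.* m ℕ.+ m ℕ.* D⁴))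
  TW = length ds ℕ.* (m ℕ.* m)

  blocks : ∀ {bls} → All PrimeBlock bls → List (Block βW TW)
  blocks []       = []
  blocks (B ∷ Bs) = block B ∷ blocks Bs

  length-blocks : ∀ {bls} (Bs : All PrimeBlock bls) → length (blocks Bs) ≡ length bls
  length-blocks []       = refl
  length-blocks (B ∷ Bs) = cong suc (length-blocks Bs)

  blocks-separated : ∀ S {bls} (Bs : All PrimeBlock bls) → All (λ bl → Disjoint bl S) bls →
                     AllPairs Disjoint bls → Separated S (blocks Bs)
  blocks-separated S []       []         []         = []
  blocks-separated S {bl ∷ bls} (B ∷ Bs) (d ∷ dS) (dbl ∷ pairs) = (λ {q} → d q) ∷ blocks-separated (bl ++ S) Bs
    (All.zipWith (λ { (bl#x , x#S) q q∈x q∈ → [ (λ q∈bl → bl#x q q∈bl q∈x) , x#S q q∈x ]′ (∈-++⁻ bl q∈) }) (dbl , dS)) pairs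

  blocks-nonneg : ∀ {bls} (Bs : All PrimeBlock bls) b → b ∈ blocks Bs → ∀ r → 0ℤ ≤ Block.value b r
  blocks-nonneg (B ∷ Bs) b (here refl) r = block-nonneg B r
  blocks-nonneg (B ∷ Bs) b (there b∈)  r = blocks-nonneg Bs b b∈ r

  -- Markov's inequality for a product: each bad block has value at least m²/4, and nonnegativity
  -- covers the case in which some block is not bad.
  allBad-≤ : ∀ {bls} (Bs : All PrimeBlock bls) r →
             + ((m ℕ.* m) ℕ.^ length bls ℕ.* allBad r bls) ≤ + (4 ℕ.^ length bls) * ∏V (blocks Bs) r
  allBad-≤ []       r = ≤-refl
  allBad-≤ {bl ∷ bls} (B ∷ Bs) r = begin
    + (m ℕ.* m ℕ.* (m ℕ.* m) ℕ.^ l ℕ.* allBad r (bl ∷ bls))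
      ≤⟨ +≤+ (ℕ.≤-trans (ℕ.*-monoʳ-≤ (m ℕ.* m ℕ.* (m ℕ.* m) ℕ.^ l) split)
            (ℕ.≤-reflexive (ℕalg (m ℕ.* m) ((m ℕ.* m) ℕ.^ l) x y))) ⟩
    + (m ℕ.* m ℕ.* x ℕ.* ((m ℕ.* m) ℕ.^ l ℕ.* y))
      ≡⟨ pos-* (m ℕ.* m ℕ.* x) _ ⟩
    + (m ℕ.* m ℕ.* x) * + ((m ℕ.* m) ℕ.^ l ℕ.* y)
      ≤⟨ *-monoˡ-≤-nonNeg (+ (m ℕ.* m ℕ.* x)) (allBad-≤ Bs r) ⟩
    + (m ℕ.* m ℕ.* x) * (+ (4 ℕ.^ l) * P)
      ≤⟨ *-monoʳ-≤-nonNeg (+ (4 ℕ.^ l) * P) {{nonNegative rest≥0}} first ⟩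
    + 4 * v * (+ (4 ℕ.^ l) * P)
      ≡⟨ alg v (+ (4 ℕ.^ l)) P ⟩
    + 4 * + (4 ℕ.^ l) * (v * P)
      ≡⟨ cong (λ t → t * (v * P)) (sym (pos-* 4 (4 ℕ.^ l))) ⟩
    + (4 ℕ.^ suc l) * (v * P) ∎
    where
    open ≤-Reasoning
    l = length bls
    x = ι (bad? r bl)
    y = allBad r bls
    v = Block.value (block B) r
    P = ∏V (blocks Bs) r
    alg : ∀ v e P → + 4 * v * (e * P) ≡ + 4 * e * (v * P)
    alg = solve-∀
    ℕalg : ∀ a b x y → a ℕ.* b ℕ.* (x ℕ.* y) ≡ a ℕ.* x ℕ.* (b ℕ.* y)
    ℕalg = ℕ-Solver.solve-∀
    split : allBad r (bl ∷ bls) ℕ.≤ x ℕ.* y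
    split = ℕ.≤-reflexive (ι-all-∷ (bad? r) bl bls)
    rest≥0 : 0ℤ ≤ + (4 ℕ.^ l) * P
    rest≥0 = ≤-trans (+≤+ z≤n) (allBad-≤ Bs r)
    first : + (m ℕ.* m ℕ.* x) ≤ + 4 * v
    first = ι-elim (bad? r bl) (λ x → + (m ℕ.* m ℕ.* x) ≤ + 4 * v)
      (λ b → ≤-trans (≤-reflexive (cong +_ (ℕ.*-identityʳ (m ℕ.* m)))) (block-bad B r b))
      (λ _ → ≤-trans (≤-reflexive (cong +_ (ℕ.*-zeroʳ (m ℕ.* m))))
            (≤-trans (≤-reflexive (sym (*-zeroʳ (+ 4)))) (*-monoˡ-≤-nonNeg (+ 4) (block-nonneg B r))))

  -- With at most `D` values of d, `βW` is at most 2 D^5 m². Against the m³ per block on the left,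
  -- each block therefore reduces the number of bad residues by a factor of about m/(8 D^5).
  count-allBad : ∀ {bls} → All PrimeBlock bls → AllPairs Disjoint bls → let k = length bls in
    m ℕ.^ k ℕ.* (p ℕ.^ n ℕ.* ((m ℕ.* m) ℕ.^ k ℕ.* ℕΣ.∑< p (λ i → allBad (n ℕ.* p ℕ.+ i) bls)))
      ℕ.≤ 4 ℕ.^ k ℕ.* ((n ℕ.* p ℕ.+ p) ℕ.* (p ℕ.^ n ℕ.* βW ℕ.^ k ℕ.+ TW ℕ.^ k ℕ.* Err k))
  count-allBad {bls} Bs pairs = drop‿+≤+ (begin
    + (m ℕ.^ k ℕ.* (p ℕ.^ n ℕ.* ((m ℕ.* m) ℕ.^ k ℕ.* ℕΣ.∑< p bad)))
      ≡⟨ trans (pos-* (m ℕ.^ k) _) (cong (λ t → + (m ℕ.^ k) * t) (trans (pos-* (p ℕ.^ n) _) (cong (λ t → + (p ℕ.^ n) * t)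
           (trans (cong +_ (sym (ℕΣ.∑-*ˡ (upTo p) ((m ℕ.* m) ℕ.^ k) bad))) (sym (∑-pos (upTo p) _)))))) ⟩
    + (m ℕ.^ k) * (+ (p ℕ.^ n) * ∑< p (λ i → + ((m ℕ.* m) ℕ.^ k ℕ.* bad i)))
      ≤⟨ *-monoˡ-≤-nonNeg (+ (m ℕ.^ k)) (*-monoˡ-≤-nonNeg (+ (p ℕ.^ n))
            (∑ℤ-mono (upTo p) (λ i _ → allBad-≤ Bs (n ℕ.* p ℕ.+ i)))) ⟩
    + (m ℕ.^ k) * (+ (p ℕ.^ n) * ∑< p (λ i → + (4 ℕ.^ k) * P i))
      ≡⟨ cong (λ t → + (m ℕ.^ k) * (+ (p ℕ.^ n) * t)) (∑-*ˡ (upTo p) (+ (4 ℕ.^ k)) P) ⟩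
    + (m ℕ.^ k) * (+ (p ℕ.^ n) * (+ (4 ℕ.^ k) * ∑< p P))
      ≡⟨ alg (+ (m ℕ.^ k)) (+ (p ℕ.^ n)) (+ (4 ℕ.^ k)) (∑< p P) ⟩
    + (4 ℕ.^ k) * (+ (m ℕ.^ k) * (+ (p ℕ.^ n) * ∑< p P))
      ≤⟨ *-monoˡ-≤-nonNeg (+ (4 ℕ.^ k)) upper ⟩
    + (4 ℕ.^ k) * + ((n ℕ.* p ℕ.+ p) ℕ.* (p ℕ.^ n ℕ.* βW ℕ.^ k ℕ.+ TW ℕ.^ k ℕ.* Err k))
      ≡⟨ sym (pos-* (4 ℕ.^ k) _) ⟩
    + (4 ℕ.^ k ℕ.* ((n ℕ.* p ℕ.+ p) ℕ.* (p ℕ.^ n ℕ.* βW ℕ.^ k ℕ.+ TW ℕ.^ k ℕ.* Err k))) ∎)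
    where
    open ≤-Reasoning
    k = length bls
    bad = λ i → allBad (n ℕ.* p ℕ.+ i) bls
    P = λ i → ∏V (blocks Bs) (n ℕ.* p ℕ.+ i)
    alg : ∀ a b c d → a * (b * (c * d)) ≡ c * (a * (b * d))
    alg = solve-∀
    upper : + (m ℕ.^ k) * (+ (p ℕ.^ n) * ∑< p P) ≤ + ((n ℕ.* p ℕ.+ p) ℕ.* (p ℕ.^ n ℕ.* βW ℕ.^ k ℕ.+ TW ℕ.^ k ℕ.* Err k))
    upper = subst (λ k → + (m ℕ.^ k) * (+ (p ℕ.^ n) * ∑< p P) ≤ +
          ((n ℕ.* p ℕ.+ p) ℕ.* (p ℕ.^ n ℕ.* βW ℕ.^ k ℕ.+ TW ℕ.^ k ℕ.* Err k)))
      (length-blocks Bs) (∏V-upper (blocks Bs) (blocks-separated [] Bs (All.map (λ {bl} _ → disjoint-[] bl) Bs) pairs) (blocks-nonneg Bs))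

-- A lower bound for the number of primes.

module Chebyshev where

  open import Data.Nat
  open import Data.Nat.Properties
  open import Data.Nat.Tactic.RingSolver using (solve-∀)
  open ℕΣ using (∑; ∑<; ∑<-+; ∑-map)
  open Residues using (coprime-*)
  open PrimeDivisors

  -- I = L ∫₀¹ xᵃ (1 − x)ᵇ dx, by expanding xᵃ(1 − x)ᵇ⁺¹ = xᵃ(1 − x)ᵇ − xᵃ⁺¹(1 − x)ᵇ.
  beta-integral : ∀ L b a → (∀ i → 1 ≤ i → i ≤ suc (a + b) → i ∣ L) →
                  ∃[ I ] I * suc (a + b) ! ≡ L * (a ! * b !)
  beta-integral L zero a div with div (suc a) (s≤s z≤n) (s≤s (m≤m+n a 0))
  ... | divides k refl = k , trans (cong (λ n → k * suc n !) (+-identityʳ a)) (alg k (suc a) (a !))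
    where
    alg : ∀ k s f → k * (s * f) ≡ k * s * (f * 1)
    alg = solve-∀
  beta-integral L (suc b) a div
    with beta-integral L b a (λ i 1≤i i≤ → div i 1≤i (≤-trans i≤ (s≤s (+-monoʳ-≤ a (n≤1+n b)))))
       | beta-integral L b (suc a) (λ i 1≤i i≤ → div i 1≤i (≤-trans i≤ (≤-reflexive (cong suc (sym (+-suc a b))))))
  ... | I₁ , eq₁ | I₂ , eq₂ = I₁ ∸ I₂ , (begin
    (I₁ ∸ I₂) * suc (a + suc b) !              ≡⟨ cong (λ n → (I₁ ∸ I₂) * suc n !) (+-suc a b) ⟩
    (I₁ ∸ I₂) * X                              ≡⟨ *-distribʳ-∸ X I₁ I₂ ⟩
    I₁ * X ∸ I₂ * X                            ≡⟨ cong₂ _∸_ first eq₂ ⟩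
    L * ((suc a) ! * b !) + L * (a ! * suc b !) ∸ L * ((suc a) ! * b !)
                                               ≡⟨ m+n∸m≡n (L * ((suc a) ! * b !)) _ ⟩
    L * (a ! * suc b !)                        ∎)
    where
    open ≡-Reasoning
    X = suc (suc (a + b)) !
    alg₁ : ∀ I s f → I * (s * f) ≡ s * (I * f)
    alg₁ = solve-∀
    alg₂ : ∀ a b L f g → (2 + (a + b)) * (L * (f * g)) ≡ L * (suc a * f * g) + L * (f * (suc b * g))
    alg₂ = solve-∀
    first : I₁ * X ≡ L * ((suc a) ! * b !) + L * (a ! * suc b !)
    first = trans (alg₁ I₁ (2 + (a + b)) (suc (a + b) !)) (trans (cong ((2 + (a + b)) *_) eq₁) (alg₂ a b L (a !) (b !)))

  4^n*n!*n!≤[2n+1]! : ∀ n → 4 ^ n * (n ! * n !) ≤ suc (n + n) !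
  4^n*n!*n!≤[2n+1]! zero    = ≤-refl
  4^n*n!*n!≤[2n+1]! (suc n) = begin
    4 * 4 ^ n * (suc n * n ! * (suc n * n !))    ≡⟨ alg n (4 ^ n) (n !) ⟩
    (2 + 2 * n) * ((2 + 2 * n) * (4 ^ n * (n ! * n !)))
      ≤⟨ *-mono-≤ (n≤1+n (2 + 2 * n)) (*-monoʳ-≤ (2 + 2 * n) (4^n*n!*n!≤[2n+1]! n)) ⟩
    (3 + 2 * n) * ((2 + 2 * n) * suc (n + n) !)  ≡⟨ cong (λ k → (3 + k) * ((2 + k) * suc (n + n) !))
          (cong (n +_) (+-identityʳ n)) ⟩
    suc (suc (suc (n + n))) !                    ≡⟨ cong (λ k → suc (suc k) !) (sym (+-suc n n)) ⟩
    suc (suc n + suc n) !                        ∎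
    where
    open ≤-Reasoning
    alg : ∀ n x f → 4 * x * (suc n * f * (suc n * f)) ≡ (2 + 2 * n) * ((2 + 2 * n) * (x * (f * f)))
    alg = solve-∀

  -- The integer I = L ∫₀¹ xⁿ(1 - x)ⁿ dx is nonzero, hence at least 1, and the integral is
  -- n!²/(2n+1)!.
  4^n≤common-multiple : ∀ n L .{{_ : NonZero L}} → (∀ i → 1 ≤ i → i ≤ suc (n + n) → i ∣ L) → 4 ^ n ≤ L
  4^n≤common-multiple n L div with beta-integral L n n div
  ... | I , eq = *-cancelʳ-≤ (4 ^ n) L (n ! * n !) {{ff≢0}} (begin
    4 ^ n * (n ! * n !)    ≤⟨ 4^n*n!*n!≤[2n+1]! n ⟩
    suc (n + n) !          ≤⟨ m≤n*m (suc (n + n) !) I {{I≢0}} ⟩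
    I * suc (n + n) !      ≡⟨ eq ⟩
    L * (n ! * n !)        ∎)
    where
    open ≤-Reasoning
    instance
      ff≢0 : NonZero (n ! * n !)
      ff≢0 = m*n≢0 (n !) (n !) {{n !≢0}} {{n !≢0}}
    I≢0 : NonZero I
    I≢0 = m*n≢0⇒m≢0 I {{subst NonZero (sym eq) (m*n≢0 L (n ! * n !))}}

  m<n*m : ∀ m n .{{_ : NonZero m}} → 2 ≤ n → m < n * m
  m<n*m m n 2≤n = subst (m <_) (*-comm m n) (m<m*n m n 2≤n)

  maxExp : ℕ → ℕ → ℕ
  maxExp q zero    = 0
  maxExp q (suc N) with q ^ suc (maxExp q N) ≤? suc N
  ... | yes _ = suc (maxExp q N)
  ... | no  _ = maxExp q N

  maxExp-spec : ∀ q N → 2 ≤ q → 1 ≤ N → q ^ maxExp q N ≤ N × N < q ^ suc (maxExp q N)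
  maxExp-spec q (suc zero)    2≤q _ with q ^ 1 ≤? 1
  ... | yes q≤1 = contradiction (≤-trans 2≤q (≤-trans (≤-reflexive (sym (^-identityʳ q))) q≤1)) (λ { (s≤s ()) })
  ... | no  _   = ≤-refl , ≤-trans 2≤q (≤-reflexive (sym (^-identityʳ q)))
  maxExp-spec q (suc (suc N)) 2≤q _ with maxExp-spec q (suc N) 2≤q (s≤s z≤n)
  ... | lo , hi with q ^ suc (maxExp q (suc N)) ≤? suc (suc N)
  ...   | yes le = le , ≤-<-trans hi (m<n*m
        (q ^ suc (maxExp q (suc N))) q {{>-nonZero (m^n>0 q {{>-nonZero (≤-trans (s≤s z≤n) 2≤q)}} (suc (maxExp q (suc N))))}} 2≤q)
  ...   | no  gt = m≤n⇒m≤1+n lo , ≰⇒> gt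

  ∣⇒^∣ : ∀ q {v e} → v ≤ e → q ^ v ∣ q ^ e
  ∣⇒^∣ q {v} {e} v≤e = divides (q ^ (e ∸ v)) (trans (cong (q ^_) (sym (m∸n+n≡m v≤e))) (^-distribˡ-+-* q (e ∸ v) v))

  ^-cancelʳ-≤ : ∀ q {v e} → 2 ≤ q → q ^ v ≤ q ^ e → v ≤ e
  ^-cancelʳ-≤ q {v} {e} 2≤q le with v ≤? e
  ... | yes v≤e = v≤e
  ... | no  v≰e = contradiction le (<⇒≱ (^-monoʳ-< q 2≤q (≰⇒> v≰e)))

  strip : ∀ q → 2 ≤ q → ∀ i → 1 ≤ i → ∃[ v ] ∃[ i′ ] i ≡ q ^ v * i′ × ¬ q ∣ i′
  strip q 2≤q = <-rec _ step
    where
    step : ∀ i → (∀ {j} → j < i → 1 ≤ j → ∃[ v ] ∃[ i′ ] j ≡ q ^ v * i′ × ¬ q ∣ i′) →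
           1 ≤ i → ∃[ v ] ∃[ i′ ] i ≡ q ^ v * i′ × ¬ q ∣ i′
    step i rec 1≤i with q ∣? i
    ... | no q∤i = 0 , i , sym (*-identityˡ i) , q∤i
    ... | yes (divides j refl) with rec {j} j<jq j>0
      where
      j>0 : 1 ≤ j
      j>0 = >-nonZero⁻¹ j {{m*n≢0⇒m≢0 j {{>-nonZero 1≤i}}}}
      j<jq : j < j * q
      j<jq = m<m*n j q {{>-nonZero j>0}} 2≤q
    ...   | v , i′ , eq , q∤ = suc v , i′ , trans (cong (_* q) eq) (alg (q ^ v) i′ q) , q∤
      where
      alg : ∀ x i q → x * i * q ≡ q * x * i
      alg = solve-∀

  prime-∤⇒coprime : ∀ {q i} → Prime q → ¬ q ∣ i → Coprime q i
  prime-∤⇒coprime pq q∤i (d∣q , d∣i) with prime⇒irreducible pq d∣q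
  ... | inj₁ d≡1  = d≡1
  ... | inj₂ refl = contradiction d∣i q∤i

  coprime-^ : ∀ {q i} v → Coprime q i → Coprime (q ^ v) i
  coprime-^ zero    cop (d∣1 , _) = ∣1⇒≡1 d∣1
  coprime-^ (suc v) cop = coprime-* cop (coprime-^ v cop)

  coprime-∣-* : ∀ {a b L} → Coprime a b → a ∣ L → b ∣ L → a * b ∣ L
  coprime-∣-* {a} {b} cop a∣L (divides k refl) =
    *-monoˡ-∣ b (coprime-divisor cop (subst (a ∣_) (*-comm k b) a∣L))

  prime⇒≥2 : ∀ {q} → Prime q → 2 ≤ q
  prime⇒≥2 {q} pq = nonTrivial⇒n>1 q {{prime⇒nonTrivial pq}}

  primesUpTo : ℕ → List ℕ
  primesUpTo N = filter prime? (upTo (suc N))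

  powers : ℕ → List ℕ
  powers N = map (λ q → q ^ maxExp q N) (primesUpTo N)

  -- The product is lcm(1, ..., N). The exact power of a prime q in `i` divides the factor that
  -- belongs to q; the cofactor is smaller and prime to q, so the two divisors combine.
  ∣product-powers : ∀ N i → 1 ≤ i → i ≤ N → i ∣ product (powers N)
  ∣product-powers N = <-rec _ step
    where
    step : ∀ i → (∀ {j} → j < i → 1 ≤ j → j ≤ N → j ∣ product (powers N)) →
           1 ≤ i → i ≤ N → i ∣ product (powers N)
    step i rec 1≤i i≤N with i ≟ 1
    ... | yes refl = 1∣ _
    ... | no  i≢1 with has-prime-divisor i {{>-nonZero 1≤i}} i≢1
    ...   | q , pq , q∣i with strip q (prime⇒≥2 pq) i 1≤i
    ...     | zero , i′ , refl , q∤i′ = contradiction (subst (q ∣_) (*-identityˡ i′) q∣i) q∤i′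
    ...     | suc v , i′ , refl , q∤i′ = coprime-∣-* (coprime-^ (suc v) (prime-∤⇒coprime pq q∤i′))
        (∣-trans (∣⇒^∣ q v<e) (∈⇒∣product (∈-map⁺ (λ q → q ^ maxExp q N) (∈-filter⁺ prime? (∈-upTo⁺ (s≤s q≤N)) pq))))
        (rec i′<i (>-nonZero⁻¹ i′) (≤-trans (<⇒≤ i′<i) i≤N))
      where
      instance
        _ = prime⇒nonZero pq
        i≢0 : NonZero (q ^ suc v * i′)
        i≢0 = >-nonZero 1≤i
        i′≢0 : NonZero i′
        i′≢0 = m*n≢0⇒n≢0 (q ^ suc v)
        q^≢0 : NonZero (q ^ suc v)
        q^≢0 = m^n≢0 q (suc v)
      q^≤N : q ^ suc v ≤ N
      q^≤N = ≤-trans (m≤m*n (q ^ suc v) i′) i≤N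
      q≤N : q ≤ N
      q≤N = ≤-trans (m≤m*n q (q ^ v) {{m^n≢0 q v}}) q^≤N
      spec = maxExp-spec q N (prime⇒≥2 pq) (≤-trans 1≤i i≤N)
      v<e : suc v ≤ maxExp q N
      v<e = s≤s⁻¹ (≰⇒> λ e<v → <⇒≱ (proj₂ spec) (≤-trans (^-monoʳ-≤ q e<v) q^≤N))
      i′<i : i′ < q ^ suc v * i′
      i′<i = m<n*m i′ (q ^ suc v) (≤-trans (prime⇒≥2 pq) (m≤m*n q (q ^ v) {{m^n≢0 q v}}))

  product-≤-^ : ∀ {N} xs → (∀ x → x ∈ xs → x ≤ N) → product xs ≤ N ^ length xs
  product-≤-^ []       le = ≤-refl
  product-≤-^ (x ∷ xs) le = *-mono-≤ (le x (here refl)) (product-≤-^ xs (λ y → le y ∘ there))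

  product≢0 : ∀ xs → (∀ x → x ∈ xs → NonZero x) → NonZero (product xs)
  product≢0 []       nz = _
  product≢0 (x ∷ xs) nz = m*n≢0 x (product xs) {{nz x (here refl)}} {{product≢0 xs (λ y → nz y ∘ there)}}

  halve : ∀ N → ∃[ n ] n + n ≤ N × N ≤ suc (n + n)
  halve zero          = 0 , z≤n , z≤n
  halve (suc zero)    = 0 , z≤n , s≤s z≤n
  halve (suc (suc N)) with halve N
  ... | n , lo , hi = suc n , subst (_≤ suc (suc N)) (cong suc (sym (+-suc n n))) (s≤s (s≤s lo))
                            , subst (λ k → suc (suc N) ≤ suc (suc k)) (sym (+-suc n n)) (s≤s (s≤s hi))

  -- Every factor of the least common multiple is at most N, so it is bounded by N^π(N). The 4
  -- absorbs rounding N to an odd number 2n+1.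
  2^N≤4N^π : ∀ N → 1 ≤ N → 2 ^ N ≤ 4 * N ^ length (primesUpTo N)
  2^N≤4N^π (suc N) 1≤N with halve N
  ... | n , lo , hi = begin
    2 ^ suc N                                  ≤⟨ ^-monoʳ-≤ 2 (s≤s hi) ⟩
    2 ^ suc (suc (n + n))                      ≡⟨ trans (cong (λ t → 2 * (2 * t)) 2^[n+n]≡4^n) (sym (*-assoc 2 2 (4 ^ n))) ⟩
    4 * 4 ^ n                                  ≤⟨ *-monoʳ-≤ 4
          (4^n≤common-multiple n L {{L≢0}} (λ i 1≤i i≤ → ∣product-powers (suc N) i 1≤i (≤-trans i≤ (s≤s lo)))) ⟩
    4 * L                                      ≤⟨ *-monoʳ-≤ 4 (product-≤-^ (powers (suc N)) λ x x∈ → let q , q∈ , eq = ∈-map⁻ _ x∈ in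
                                                    subst (_≤ suc N) (sym eq) (proj₁ (maxExp-spec q (suc N)
                                                          (prime⇒≥2 (proj₂ (∈-filter⁻ prime? {xs = upTo
                                                                (suc (suc N))} q∈))) (s≤s z≤n)))) ⟩
    4 * suc N ^ length (powers (suc N))        ≡⟨ cong (λ k → 4 * suc N ^ k) (length-map _ (primesUpTo (suc N))) ⟩
    4 * suc N ^ length (primesUpTo (suc N))    ∎
    where
    open ≤-Reasoning
    L = product (powers (suc N))
    L≢0 : NonZero L
    L≢0 = product≢0 (powers (suc N)) λ x x∈ → let q , q∈ , eq = ∈-map⁻ _ x∈ in
      subst NonZero (sym eq) (m^n≢0 q (maxExp q
            (suc N)) {{prime⇒nonZero (proj₂ (∈-filter⁻ prime? {xs = upTo (suc (suc N))} q∈))}})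
    2^[n+n]≡4^n : 2 ^ (n + n) ≡ 4 ^ n
    2^[n+n]≡4^n = trans (cong (2 ^_) (cong (n +_) (sym (+-identityʳ n)))) (sym (^-*-assoc 2 2 n))

  -- Since `b` exceeds log₂ t, fewer than `C * t ^ j` primes up to N = t^(j+1) would give N ≤ 2 +
  -- b(j+1)C t^j by `2^N≤4N^π`, but the right side is below t^(j+1). So the factor log N is paid for
  -- by one factor t, with any constant `C` to spare.
  π-lower : ∀ {t b} j C → t < 2 ^ b → 2 + b * suc j * C < t → C * t ^ j ≤ length (primesUpTo (t ^ suc j))
  π-lower {t} {b} j C t<2^b small = ≮⇒≥ λ π< → <-irrefl refl (begin-strict
    t ^ suc j                  ≤⟨ ^-cancelʳ-≤ 2 ≤-refl (begin
        2 ^ t ^ suc j                          ≤⟨ 2^N≤4N^π (t ^ suc j) (m^n>0 t (suc j)) ⟩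
        4 * (t ^ suc j) ^ length (primesUpTo (t ^ suc j))
          ≤⟨ *-monoʳ-≤ 4 (^-monoʳ-≤ (t ^ suc j) {{m^n≢0 t (suc j)}} (<⇒≤ π<)) ⟩
        4 * (t ^ suc j) ^ (C * t ^ j)          ≤⟨ *-monoʳ-≤ 4 (^-monoˡ-≤ (C * t ^ j) (^-monoˡ-≤ (suc j) (<⇒≤ t<2^b))) ⟩
        4 * ((2 ^ b) ^ suc j) ^ (C * t ^ j)    ≡⟨ cong (4 *_)
              (trans (cong (_^ (C * t ^ j)) (^-*-assoc 2 b (suc j))) (^-*-assoc 2 (b * suc j) (C * t ^ j))) ⟩
        2 ^ 2 * 2 ^ (b * suc j * (C * t ^ j))  ≡⟨ sym (^-distribˡ-+-* 2 2 (b * suc j * (C * t ^ j))) ⟩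
        2 ^ (2 + b * suc j * (C * t ^ j))      ∎) ⟩
    2 + b * suc j * (C * t ^ j)                ≤⟨ +-monoˡ-≤ _ (m≤m*n 2 (t ^ j) {{m^n≢0 t j}}) ⟩
    2 * t ^ j + b * suc j * (C * t ^ j)        ≡⟨ alg (t ^ j) (b * suc j) C ⟩
    (2 + b * suc j * C) * t ^ j                <⟨ *-monoˡ-< (t ^ j) {{m^n≢0 t j}} small ⟩
    t * t ^ j                                  ∎)
    where
    open ≤-Reasoning
    instance
      t≢0 : NonZero t
      t≢0 = >-nonZero (≤-<-trans z≤n small)
    alg : ∀ x B C → 2 * x + B * (C * x) ≡ (2 + B * C) * x
    alg = solve-∀

  n<2^n : ∀ n → n < 2 ^ n
  n<2^n zero    = s≤s z≤n
  n<2^n (suc n) = begin-strict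
    suc n           <⟨ s≤s (n<2^n n) ⟩
    suc (2 ^ n)     ≤⟨ +-monoˡ-≤ (2 ^ n) (m^n>0 2 n) ⟩
    2 ^ n + 2 ^ n   ≡⟨ cong (2 ^ n +_) (sym (+-identityʳ (2 ^ n))) ⟩
    2 ^ suc n       ∎
    where open ≤-Reasoning

  linear<2^ : ∀ A y → 2 + suc (y + (2 * A + 4)) * A < 2 ^ (y + (2 * A + 4))
  -- The summands 14 and `14 * (A * A) + 27 * A` complete the left side to 16(A+1)², and A + 1 ≤
  -- 2^A.
  linear<2^ A zero = begin-strict
    2 + suc (2 * A + 4) * A             <⟨ m<m+n _ (s≤s (z≤n {13})) ⟩
    2 + suc (2 * A + 4) * A + 14        ≤⟨ m≤m+n _ (14 * (A * A) + 27 * A) ⟩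
    2 + suc (2 * A + 4) * A + 14 + (14 * (A * A) + 27 * A) ≡⟨ alg A ⟩
    suc A * suc A * 16                  ≤⟨ *-monoˡ-≤ 16 (*-mono-≤ (n<2^n A) (n<2^n A)) ⟩
    2 ^ A * 2 ^ A * 16                  ≡⟨ cong (_* 16)
          (trans (sym (^-distribˡ-+-* 2 A A)) (cong (2 ^_) (cong (A +_) (sym (+-identityʳ A))))) ⟩
    2 ^ (2 * A) * 2 ^ 4                 ≡⟨ sym (^-distribˡ-+-* 2 (2 * A) 4) ⟩
    2 ^ (2 * A + 4)                     ∎
    where
    open ≤-Reasoning
    alg : ∀ A → 2 + suc (2 * A + 4) * A + 14 + (14 * (A * A) + 27 * A) ≡ suc A * suc A * 16
    alg = solve-∀
  linear<2^ A (suc y) = begin-strict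
    2 + (A + suc (y + x₀) * A)               ≡⟨ alg A (suc (y + x₀) * A) ⟩
    A + (2 + suc (y + x₀) * A)               <⟨ +-mono-≤-< A≤ (linear<2^ A y) ⟩
    2 ^ (y + x₀) + 2 ^ (y + x₀)              ≡⟨ cong (2 ^ (y + x₀) +_) (sym (+-identityʳ (2 ^ (y + x₀)))) ⟩
    2 ^ suc (y + x₀)                         ∎
    where
    open ≤-Reasoning
    x₀ = 2 * A + 4
    alg : ∀ A B → 2 + (A + B) ≡ A + (2 + B)
    alg = solve-∀
    A≤ : A ≤ 2 ^ (y + x₀)
    A≤ = ≤-trans (<⇒≤ (n<2^n A)) (^-monoʳ-≤ 2
          (≤-trans (m≤m+n A (A + 0 + 4)) (≤-trans (≤-reflexive (sym (+-assoc A (A + 0) 4))) (m≤n+m x₀ y))))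

  -- `b` is the integer part of log₂ t plus 1, so this says that A log t is eventually below t.
  log-threshold : ∀ A → ∃[ t₀ ] ∀ t → t₀ ≤ t → ∃[ b ] t < 2 ^ b × 2 + b * A < t
  log-threshold A = 2 ^ x₀ , λ t t₀≤t →
    let 1≤t = ≤-trans (m^n>0 2 x₀) t₀≤t
        lo , hi = maxExp-spec 2 t ≤-refl 1≤t
        e = maxExp 2 t
        x₀≤e = s≤s⁻¹ (≰⇒> λ e<x₀ → <⇒≱ hi (≤-trans (^-monoʳ-≤ 2 e<x₀) t₀≤t))
        e≡ = m∸n+n≡m {e} {x₀} x₀≤e
    in suc e , hi , <-≤-trans (subst (λ x → 2 + suc x * A < 2 ^ x) e≡ (linear<2^ A (e ∸ x₀))) lo
    where x₀ = 2 * A + 4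

  length-filter≡∑ι : ∀ {A : Set} {P : A → Set} (P? : ∀ x → Dec (P x)) xs → length (filter P? xs) ≡ ∑ xs (ι ∘ P?)
  length-filter≡∑ι P? []       = refl
  length-filter≡∑ι P? (x ∷ xs) with P? x
  ... | yes _ = cong suc (length-filter≡∑ι P? xs)
  ... | no  _ = length-filter≡∑ι P? xs

  primesBetween : ℕ → ℕ → List ℕ
  primesBetween w N = filter prime? (map (suc w +_) (upTo (N ∸ w)))

  primesBetween-unique : ∀ w N → Unique (primesBetween w N)
  primesBetween-unique w N = Unique.filter⁺ prime? (Unique.map⁺ (+-cancelˡ-≡ (suc w) _ _) (Unique.upTo⁺ (N ∸ w)))

  ∈-primesBetween⁻ : ∀ {w N q} → w ≤ N → q ∈ primesBetween w N → Prime q × w < q × q ≤ N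
  ∈-primesBetween⁻ {w} {N} w≤N q∈ with ∈-filter⁻ prime? {xs = map (suc w +_) (upTo (N ∸ w))} q∈
  ... | q∈map , pq with ∈-map⁻ (suc w +_) q∈map
  ...   | i , i∈ , refl = pq , s≤s (m≤m+n w i) , subst (w + i <_) (m+[n∸m]≡n w≤N) (+-monoʳ-< w (∈-upTo⁻ i∈))

  length-primesBetween : ∀ {w N} → w ≤ N → length (primesUpTo N) ≤ suc w + length (primesBetween w N)
  length-primesBetween {w} {N} w≤N = begin
    length (primesUpTo N)                          ≡⟨ length-filter≡∑ι prime? (upTo (suc N)) ⟩
    ∑< (suc N) (ι ∘ prime?)                        ≡⟨ cong (λ k → ∑< (suc k) (ι ∘ prime?)) (sym (m+[n∸m]≡n w≤N)) ⟩
    ∑< (suc w + (N ∸ w)) (ι ∘ prime?)              ≡⟨ ∑<-+ (suc w) (N ∸ w) (ι ∘ prime?) ⟩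
    ∑< (suc w) (ι ∘ prime?) + ∑< (N ∸ w) (λ i → ι (prime? (suc w + i)))
      ≤⟨ +-mono-≤ (≤-trans (∑-mono (upTo (suc w)) (λ i _ → ι≤1 (prime? i)))
            (≤-reflexive (trans (∑<-const (suc w) 1) (*-identityʳ (suc w)))))
                  (≤-reflexive (sym (trans (length-filter≡∑ι prime? (map (suc w +_) (upTo (N ∸ w))))
                        (∑-map (suc w +_) (upTo (N ∸ w)) (ι ∘ prime?))))) ⟩
    suc w + length (primesBetween w N)             ∎
    where open ≤-Reasoning

-- Sums of reciprocal squares.

module SmallSquares where

  open import Data.Nat
  open import Data.Nat.Properties
  open import Data.Nat.Tactic.RingSolver using (solve-∀)
  open ℕΣ using (∑; ∑<; ∑<-sucʳ; ∑-map)
  open Chebyshev using (halve)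

  -- 2 and the odd numbers up to D: all prime candidates, with Σ 1/d² < 1/2.
  roots : ℕ → List ℕ
  roots D = 2 ∷ map (λ i → 3 + 2 * i) (upTo (proj₁ (halve (D ∸ 1))))

  roots-bounds : ∀ {D} → 2 ≤ D → ∀ d → d ∈ roots D → 2 ≤ d × d ≤ D
  roots-bounds {D} 2≤D d (here refl) = ≤-refl , 2≤D
  roots-bounds {D} 2≤D d (there d∈) with ∈-map⁻ (λ i → 3 + 2 * i) d∈ | halve (D ∸ 1) in eq
  ... | i , i∈ , refl | h , lo , hi = s≤s (s≤s z≤n) , (begin
      3 + 2 * i            ≡⟨ alg i ⟩
      suc (suc i + suc i)  ≤⟨ s≤s (+-mono-≤ i<h i<h) ⟩
      suc (h + h)          ≤⟨ s≤s lo ⟩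
      suc (D ∸ 1)          ≡⟨ m+[n∸m]≡n (≤-trans (s≤s z≤n) 2≤D) ⟩
      D                    ∎)
    where
    open ≤-Reasoning
    alg : ∀ i → 3 + 2 * i ≡ suc (suc i + suc i)
    alg = solve-∀
    i<h : suc i ≤ h
    i<h = subst (i <_) (cong proj₁ eq) (∈-upTo⁻ i∈)

  prime∈roots : ∀ {D q} → Prime q → q ≤ D → q ∈ roots D
  prime∈roots {D} {q} pq q≤D with halve q
  ... | zero , lo , hi = contradiction (Chebyshev.prime⇒≥2 pq) (<⇒≱ (s≤s hi))
  ... | suc h , lo , hi with suc h + suc h ≟ q
  ...   | yes refl = [ (λ ()) , (λ 2≡q → here (sym 2≡q)) ]′ (prime⇒irreducible pq (divides (suc h) (alg (suc h))))
    where
    alg : ∀ h → h + h ≡ h * 2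
    alg = solve-∀
  ...   | no even≢ with halve (D ∸ 1)
  ...     | e , loe , hie = there (subst (_∈ map (λ i → 3 + 2 * i) (upTo e)) (sym q≡) (∈-map⁺ (λ i → 3 + 2 * i) (∈-upTo⁺ h<e)))
    where
    alg : ∀ h → suc (suc h + suc h) ≡ 3 + 2 * h
    alg = solve-∀
    q≡ : q ≡ 3 + 2 * h
    q≡ = trans (≤-antisym hi (≤∧≢⇒< lo even≢)) (alg h)
    h<e : h < e
    h<e = ≰⇒> λ e≤h → <-irrefl refl (begin-strict
      suc (suc (h + h))     ≡⟨ sym (cong suc (+-suc h h)) ⟩
      suc h + suc h         ≤⟨ s≤s⁻¹ (subst (_≤ D) (trans q≡ (sym (alg h))) q≤D ⟨≤⟩ ≤-reflexive (sym (m+[n∸m]≡n 1≤D))) ⟩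
      D ∸ 1                 ≤⟨ hie ⟩
      suc (e + e)           ≤⟨ s≤s (+-mono-≤ e≤h e≤h) ⟩
      suc (h + h)           <⟨ n<1+n _ ⟩
      suc (suc (h + h))     ∎)
      where
      open ≤-Reasoning
      infixl 5 _⟨≤⟩_
      _⟨≤⟩_ : ∀ {a b c} → a ≤ b → b ≤ c → a ≤ c
      _⟨≤⟩_ = ≤-trans
      1≤D : 1 ≤ D
      1≤D = ≤-trans (≤-trans (s≤s z≤n) (Chebyshev.prime⇒≥2 pq)) q≤D

  -- ∑ 1/(3 + 2i)² ≤ ∑ 1/(4(i + 1)(i + 2)) telescopes.
  odd-sum : ∀ m F I → (∀ i → i < I → 2 * ((3 + 2 * i) * (3 + 2 * i) * F i) ≤ 3 * m) →
            8 * (suc I * ∑< I F) ≤ 3 * m * I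
  odd-sum m F zero    bd = z≤n
  odd-sum m F (suc I) bd = *-cancelˡ-≤ (suc I) (begin
    suc I * (8 * (suc (suc I) * ∑< (suc I) F))
      ≡⟨ cong (λ s → suc I * (8 * (suc (suc I) * s))) (∑<-sucʳ I F) ⟩
    suc I * (8 * (suc (suc I) * (S + F I)))
      ≡⟨ alg₁ I S (F I) ⟩
    suc (suc I) * (8 * (suc I * S)) + 2 * (4 * (suc I * suc (suc I)) * F I)
      ≤⟨ +-mono-≤ (*-monoʳ-≤ (suc (suc I)) (odd-sum m F I (λ i i<I → bd i (m≤n⇒m≤1+n i<I))))
           (≤-trans (*-monoʳ-≤ 2 (*-monoˡ-≤ (F I) square≥)) (bd I ≤-refl)) ⟩
    suc (suc I) * (3 * m * I) + 3 * m
      ≡⟨ alg₂ I m ⟩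
    suc I * (3 * m * suc I) ∎)
    where
    open ≤-Reasoning
    S = ∑< I F
    alg₁ : ∀ I S f → suc I * (8 * (suc (suc I) * (S + f))) ≡ suc (suc I) * (8 * (suc I * S)) + 2 * (4 * (suc I * suc (suc I)) * f)
    alg₁ = solve-∀
    alg₂ : ∀ I m → suc (suc I) * (3 * m * I) + 3 * m ≡ suc I * (3 * m * suc I)
    alg₂ = solve-∀
    alg₃ : ∀ I → 4 * (suc I * suc (suc I)) + 1 ≡ (3 + 2 * I) * (3 + 2 * I)
    alg₃ = solve-∀
    square≥ : 4 * (suc I * suc (suc I)) ≤ (3 + 2 * I) * (3 + 2 * I)
    square≥ = ≤-trans (m≤m+n _ 1) (≤-reflexive (alg₃ I))

  -- The value d = 2 contributes at most 3m/8, and by `odd-sum` so do all odd d together.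
  roots-sum : ∀ D m F → (∀ d → d ∈ roots D → 2 * (d * d * F d) ≤ 3 * m) → 4 * ∑ (roots D) F ≤ 3 * m
  roots-sum D m F bd = *-cancelˡ-≤ 2 (begin
    2 * (4 * (F 2 + ∑ (map (λ i → 3 + 2 * i) (upTo I)) F))
      ≡⟨ cong (λ s → 2 * (4 * (F 2 + s))) (∑-map (λ i → 3 + 2 * i) (upTo I) F) ⟩
    2 * (4 * (F 2 + S))           ≡⟨ alg (F 2) S ⟩
    2 * (2 * 2 * F 2) + 8 * S     ≤⟨ +-mono-≤ (bd 2 (here refl)) odd ⟩
    3 * m + 3 * m                 ≡⟨ cong (3 * m +_) (sym (+-identityʳ (3 * m))) ⟩
    2 * (3 * m)                   ∎)
    where
    open ≤-Reasoning
    I = proj₁ (halve (D ∸ 1))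
    S = ∑< I (λ i → F (3 + 2 * i))
    alg : ∀ x S → 2 * (4 * (x + S)) ≡ 2 * (2 * 2 * x) + 8 * S
    alg = solve-∀
    alg₂ : ∀ I S → suc I * (8 * S) ≡ 8 * (suc I * S)
    alg₂ = solve-∀
    odd : 8 * S ≤ 3 * m
    odd = *-cancelˡ-≤ (suc I) (begin
      suc I * (8 * S)  ≡⟨ alg₂ I S ⟩
      8 * (suc I * S)  ≤⟨ odd-sum m (λ i → F (3 + 2 * i)) I
            (λ i i<I → bd (3 + 2 * i) (there (∈-map⁺ (λ i → 3 + 2 * i) (∈-upTo⁺ i<I)))) ⟩
      3 * m * I        ≤⟨ *-monoʳ-≤ (3 * m) (n≤1+n I) ⟩
      3 * m * suc I    ≡⟨ *-comm (3 * m) (suc I) ⟩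
      suc I * (3 * m)  ∎)

  -- Telescoping: 1/(D+1+i)² is at most 1/(D+i) - 1/(D+i+1), and these differences add up to
  -- J/(D(D+J)).
  large-sum : ∀ Y D J (e : ℕ → ℕ) → (∀ i → i < J → (suc D + i) * (suc D + i) * e i ≤ Y) →
              D * (D + J) * ∑< J e ≤ Y * J
  large-sum Y D zero    e bd = ≤-reflexive (trans (*-zeroʳ (D * (D + 0))) (sym (*-zeroʳ Y)))
  large-sum Y zero    (suc J) e bd = z≤n
  large-sum Y D@(suc _) (suc J) e bd = *-cancelˡ-≤ (D + J) (begin
    (D + J) * (D * (D + suc J) * ∑< (suc J) e)
      ≡⟨ cong (λ s → (D + J) * (D * (D + suc J) * s)) (∑<-sucʳ J e) ⟩
    (D + J) * (D * (D + suc J) * (S + e J))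
      ≡⟨ alg₁ D J S (e J) ⟩
    (suc D + J) * (D * (D + J) * S) + D * ((D + J) * (suc D + J) * e J)
      ≤⟨ +-mono-≤ (*-monoʳ-≤ (suc D + J) (large-sum Y D J e (λ i i<J → bd i (m≤n⇒m≤1+n i<J))))
           (*-monoʳ-≤ D (≤-trans (*-monoˡ-≤ (e J) (*-monoˡ-≤ (suc D + J) (n≤1+n (D + J)))) (bd J ≤-refl))) ⟩
    (suc D + J) * (Y * J) + D * Y
      ≡⟨ alg₂ D J Y ⟩
    (D + J) * (Y * suc J) ∎)
    where
    open ≤-Reasoning
    S = ∑< J e
    alg₁ : ∀ D J S f → (D + J) * (D * (D + suc J) * (S + f)) ≡ (suc D + J) * (D * (D + J) * S) + D * ((D + J) * (suc D + J) * f)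
    alg₁ = solve-∀
    alg₂ : ∀ D J Y → (suc D + J) * (Y * J) + D * Y ≡ (D + J) * (Y * suc J)
    alg₂ = solve-∀

  large-sum′ : ∀ Y D .{{_ : NonZero D}} J (e : ℕ → ℕ) → (∀ i → i < J → (suc D + i) * (suc D + i) * e i ≤ Y) →
               D * ∑< J e ≤ Y
  large-sum′ Y D J e bd = *-cancelʳ-≤ _ _ (D + J) {{>-nonZero (≤-trans (>-nonZero⁻¹ D) (m≤m+n D J))}} (begin
    D * ∑< J e * (D + J)    ≡⟨ alg D (∑< J e) (D + J) ⟩
    D * (D + J) * ∑< J e    ≤⟨ large-sum Y D J e bd ⟩
    Y * J                   ≤⟨ *-monoʳ-≤ Y (m≤n+m J D) ⟩
    Y * (D + J)             ∎)
    where
    open ≤-Reasoning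
    alg : ∀ a b c → a * b * c ≡ a * c * b
    alg = solve-∀

-- Solving congruences modulo p.

module ModularInverse (p : ℕ) (prime-p : Prime p) where

  open import Data.Nat
  open import Data.Nat.Properties
  open import Data.Nat.Tactic.RingSolver using (solve-∀)
  open Residues

  private instance
    p≢0 : NonZero p
    p≢0 = prime⇒nonZero prime-p

  -- sol c v is the solution u < p of c + v u ≡ 0 modulo p; junk (0) unless p ∤ v.
  sol : ℕ → ℕ → ℕ
  sol c v with coprime? v p
  ... | yes cop = proj₁ (solve-residue p cop c)
  ... | no  _   = 0

  sol<p : ∀ c v → sol c v < p
  sol<p c v with coprime? v p
  ... | yes cop = proj₁ (proj₂ (solve-residue p cop c))
  ... | no  _   = >-nonZero⁻¹ p

  sol-spec : ∀ c {v} → Coprime v p → p ∣ c + v * sol c v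
  sol-spec c {v} cop with coprime? v p
  ... | yes cop′ = proj₂ (proj₂ (solve-residue p cop′ c))
  ... | no  ¬cop = contradiction (λ {d} → cop {d}) ¬cop

  sol-mod : ∀ c {v} → Coprime v p → ∀ n → p ∣ c + v * n → n % p ≡ sol c v
  sol-mod c {v} cop n p∣ = residue-unique cop c (m%n<n n p) (sol<p c v)
    (∣-shift (v * (n / p)) (trans (cong (λ t → c + v * t) (m≡m%n+[m/n]*n n p)) (alg c v (n % p) (n / p) p)) p∣) (sol-spec c cop)
    where
    alg : ∀ c v r k q → c + v * (r + k * q) ≡ c + v * r + v * k * q
    alg = solve-∀

-- Prime factors above the square root.

module PrimeFactorsAboveRoot where

  open import Data.Nat
  open import Data.Nat.Properties
  open import Data.Nat.Tactic.RingSolver using (solve-∀)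
  open ℕΣ using (∑)
  open Chebyshev using (length-filter≡∑ι; coprime-∣-*)
  open PrimeDivisors using (coprime-distinct-primes)
  open Residues using (coprime-*)

  -- Four distinct primes above √p have a product above p².
  at-most-three : ∀ {p n} (ys : List ℕ) → Unique ys → (∀ y → y ∈ ys → Prime y × p < y * y) →
                  1 ≤ n → n < p * p → ∑ ys (λ y → ι (y ∣? n)) ≤ 3
  at-most-three {p} {n} ys uys big 1≤n n<pp =
    subst (_≤ 3) (length-filter≡∑ι (_∣? n) ys)
      (go (filter (_∣? n) ys) (Unique.filter⁺ (_∣? n) uys)
          (λ y y∈ → let y∈ys , y∣n = ∈-filter⁻ (_∣? n) {xs = ys} y∈ in big y y∈ys , y∣n))
    where
    go : ∀ zs → Unique zs → (∀ z → z ∈ zs → (Prime z × p < z * z) × z ∣ n) → length zs ≤ 3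
    go []              _ _ = z≤n
    go (_ ∷ [])        _ _ = s≤s z≤n
    go (_ ∷ _ ∷ [])    _ _ = s≤s (s≤s z≤n)
    go (_ ∷ _ ∷ _ ∷ []) _ _ = s≤s (s≤s (s≤s z≤n))
    go (a ∷ b ∷ c ∷ d ∷ zs) ((a≢b ∷ a≢c ∷ a≢d ∷ _) ∷ (b≢c ∷ b≢d ∷ _) ∷ (c≢d ∷ _) ∷ _) f
      with f a (here refl) | f b (there (here refl)) | f c (there (there (here refl))) | f d (there (there (there (here refl))))
    ... | (pa , a²) , a∣n | (pb , b²) , b∣n | (pc , c²) , c∣n | (pd , d²) , d∣n =
      contradiction (*-mono-< N<pp N<pp) (≤⇒≯ (begin
        p * p * (p * p)                              ≤⟨ *-mono-≤ (*-mono-≤ (<⇒≤ a²) (<⇒≤ b²)) (*-mono-≤ (<⇒≤ c²) (<⇒≤ d²)) ⟩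
        a * a * (b * b) * (c * c * (d * d))          ≡⟨ alg a b c d ⟩
        (a * b) * (c * d) * ((a * b) * (c * d))      ∎))
      where
      open ≤-Reasoning
      alg : ∀ a b c d → a * a * (b * b) * (c * c * (d * d)) ≡ (a * b) * (c * d) * ((a * b) * (c * d))
      alg = solve-∀
      ab⊥ : ∀ {e} → Prime e → a ≢ e → b ≢ e → Coprime (a * b) e
      ab⊥ pe a≢e b≢e = coprime-* (coprime-distinct-primes pa pe a≢e) (coprime-distinct-primes pb pe b≢e)
      N∣n : (a * b) * (c * d) ∣ n
      N∣n = coprime-∣-* (Coprime.sym (coprime-* (Coprime.sym (ab⊥ pc a≢c b≢c)) (Coprime.sym (ab⊥ pd a≢d b≢d))))
        (coprime-∣-* (coprime-distinct-primes pa pb a≢b) a∣n b∣n) (coprime-∣-* (coprime-distinct-primes pc pd c≢d) c∣n d∣n)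
      N<pp : (a * b) * (c * d) < p * p
      N<pp = ≤-<-trans (∣⇒≤ {{>-nonZero 1≤n}} N∣n) n<pp

-- Choosing y and z.

module Selection
  (p n D Z m x Y a b : ℕ) (prime-p : Prime p) (1≤a : 1 ℕ.≤ a) (1≤b : 1 ℕ.≤ b) (a+b≡p : a ℕ.+ b ≡ p)
  (2≤D : 2 ℕ.≤ D) (D<p : D ℕ.< p) (Z<x : Z ℕ.< x) (p<xx : p ℕ.< x ℕ.* x) (2Y<p : Y ℕ.+ Y ℕ.< p)
  (𝒴 : List ℕ) (𝒴-unique : Unique 𝒴) (𝒴-member : ∀ y → y ∈ 𝒴 → Prime y × x ℕ.< y × y ℕ.≤ Y) (x≤p : x ℕ.≤ p) where

  open import Data.Nat
  open import Data.Nat.Properties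
  open import Data.Nat.Tactic.RingSolver using (solve-∀)
  open ℕΣ
  open Residues
  open SmallSquares
  open ModularInverse p prime-p
  open PrimeFactorsAboveRoot
  open PrimeDivisors using (coprime-distinct-primes)

  Z<p : Z < p
  Z<p = <-≤-trans Z<x x≤p

  open SquareBlocks p n D Z m (roots D) prime-p D<p Z<p (roots-bounds 2≤D)

  private instance
    p≢0 : NonZero p
    p≢0 = prime⇒nonZero prime-p
    D≢0 : NonZero D
    D≢0 = >-nonZero (≤-trans (s≤s z≤n) 2≤D)

  -- The class to be represented is `a`, and `b` is its negative: y z u ≡ -b ≡ a modulo p.
  u : ℕ → ℕ → ℕ
  u y z = sol b (y * z)

  -- The residue -a/y, moved into the window [np, (n+1)p) for which `count-allBad` counts.
  r : ℕ → ℕ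
  r y = n * p + sol a y

  b<p : b < p
  b<p = subst (b <_) a+b≡p (m<n+m b 1≤a)

  p∤b : ¬ p ∣ b
  p∤b p∣b = <⇒≱ b<p (∣⇒≤ {{>-nonZero 1≤b}} p∣b)

  record SmallPrime (z : ℕ) : Set where
    constructor smallPrime
    field
      isPrime : Prime z
      D<z     : D < z
      z≤Z     : z ≤ Z

  module _ {y} (y∈ : y ∈ 𝒴) where

    prime-y : Prime y
    prime-y = proj₁ (𝒴-member y y∈)
    x<y : x < y
    x<y = proj₁ (proj₂ (𝒴-member y y∈))
    y≤Y : y ≤ Y
    y≤Y = proj₂ (proj₂ (𝒴-member y y∈))
    y<p : y < p
    y<p = ≤-<-trans y≤Y (≤-<-trans (m≤m+n Y Y) 2Y<p)
    instance
      y≢0 : NonZero y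
      y≢0 = prime⇒nonZero prime-y
    y⊥p : Coprime y p
    y⊥p = Coprime.sym (prime⇒coprime prime-p y<p)

  module _ {z} (sz : SmallPrime z) where

    open SmallPrime sz
    private instance
      z≢0 : NonZero z
      z≢0 = prime⇒nonZero isPrime

    z⊥p : Coprime z p
    z⊥p = Coprime.sym (prime⇒coprime prime-p (≤-<-trans z≤Z Z<p))

    yz⊥p : ∀ {y} → y ∈ 𝒴 → Coprime (y * z) p
    yz⊥p y∈ = coprime-* (y⊥p y∈) z⊥p

    u-spec : ∀ {y} → y ∈ 𝒴 → p ∣ b + y * z * u y z
    u-spec y∈ = sol-spec b (yz⊥p y∈)

    u>0 : ∀ {y} → y ∈ 𝒴 → 1 ≤ u y z
    u>0 {y} y∈ with u y z | u-spec y∈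
    ... | zero  | p∣ = contradiction (subst (p ∣_) (trans (cong (b +_) (*-zeroʳ (y * z))) (+-identityʳ b)) p∣) p∤b
    ... | suc _ | _  = s≤s z≤n

    -- Adding y z u ≡ -b and y r ≡ -a gives y (z u + r) ≡ -p ≡ 0, and y is invertible.
    p∣zu+r : ∀ {y} → y ∈ 𝒴 → p ∣ z * u y z + r y
    p∣zu+r {y} y∈ = coprime-divisor (Coprime.sym (y⊥p y∈))
      (∣m+n∣m⇒∣n (subst (p ∣_) eq (∣m∣n⇒∣m+n (∣m∣n⇒∣m+n (u-spec y∈) (sol-spec a (y⊥p y∈))) (n∣m*n (y * n)))) ∣-refl)
      where
      alg : ∀ a b y z u i N p → b + y * z * u + (a + y * i) + y * N * p ≡ (a + b) + y * (z * u + (N * p + i))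
      alg = solve-∀
      eq : b + y * z * u y z + (a + y * sol a y) + y * n * p ≡ p + y * (z * u y z + r y)
      eq = trans (alg a b y z (u y z) (sol a y) n p) (cong (_+ y * (z * u y z + r y)) a+b≡p)

    -- Let z u + r = q p and j = q - n - 1. Modulo d² z, `hit j` is r - q p = -z u, which d² z
    -- divides once d² ∣ u.
    event-occurs : ∀ {y d} → y ∈ 𝒴 → d ∈ roots D → d * d ∣ u y z → 1 ≤ Ev.E d z (r y)
    event-occurs {y} {d} y∈ d∈ dd∣u = begin
      1                                                       ≡⟨ sym
            (cong₂ _*_ (ι-yes (d * d ∣? hit j) dd∣hit) (ι-yes (z ∣? hit j) z∣hit)) ⟩
      ι (d * d ∣? hit j) * ι (z ∣? hit j)                      ≤⟨ ∑-∈ (upTo z)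
            (λ j → ι (d * d ∣? hit j) * ι (z ∣? hit j)) (∈-upTo⁺ j<z) ⟩
      Ev.E d z (r y)                                          ∎
      where
      open ≤-Reasoning
      hit = Ev.hit d z (r y)
      U = u y z
      q = quotient (p∣zu+r y∈)
      zu+r≡ : z * U + r y ≡ q * p
      zu+r≡ = m∣n⇒n≡quotient*m (p∣zu+r y∈)
      n<q : n < q
      n<q = *-cancelʳ-< p n q (begin-strict
        n * p           ≤⟨ m≤m+n (n * p) (sol a y) ⟩
        r y             <⟨ m<n+m (r y) (>-nonZero⁻¹ (z * U) {{m*n≢0 z U {{z≢0}} {{>-nonZero (u>0 y∈)}}}}) ⟩
        z * U + r y     ≡⟨ zu+r≡ ⟩
        q * p           ∎)
      q<z+suc[n] : q < z + suc n
      q<z+suc[n] = *-cancelʳ-< p q (z + suc n) (begin-strict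
        q * p                    ≡⟨ sym zu+r≡ ⟩
        z * U + (n * p + sol a y) <⟨ +-mono-≤-< (*-monoʳ-≤ z (<⇒≤ (sol<p b (y * z)))) (+-monoʳ-< (n * p) (sol<p a y)) ⟩
        z * p + (n * p + p)      ≡⟨ alg z n p ⟩
        (z + suc n) * p          ∎)
        where
        alg : ∀ z n p → z * p + (n * p + p) ≡ (z + suc n) * p
        alg = solve-∀
      -- The bounds n < q < z + n + 1 say exactly that this is an index in the sum defining `E`.
      j = q ∸ suc n
      suc[n]+j≡q : suc n + j ≡ q
      suc[n]+j≡q = m+[n∸m]≡n n<q
      j<z : j < z
      j<z = +-cancelˡ-< (suc n) j z (subst₂ _<_ (sym suc[n]+j≡q) (+-comm z (suc n)) q<z+suc[n])
      Q-1 = d * d * z ∸ 1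
      Q≡ : suc Q-1 ≡ d * d * z
      Q≡ = m+[n∸m]≡n {1} (>-nonZero⁻¹ (d * d * z) {{m*n≢0 (d * d) z {{m*n≢0 d d {{d≢0}} {{d≢0}}}}}})
        where
        d≢0 : NonZero d
        d≢0 = >-nonZero (≤-trans (s≤s z≤n) (proj₁ (roots-bounds 2≤D d d∈)))
      alg : ∀ r Q p n j → r + Q * p * suc n + Q * p * j ≡ r + Q * ((suc n + j) * p)
      alg = solve-∀
      alg₂ : ∀ r Q z u → r + Q * (z * u + r) ≡ suc Q * r + Q * (z * u)
      alg₂ = solve-∀
      hit≡ : hit j ≡ d * d * z * r y + Q-1 * (z * U)
      hit≡ = trans (alg (r y) Q-1 p n j) (trans (cong (λ t → r y + Q-1 * (t * p)) suc[n]+j≡q)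
        (trans (cong (λ t → r y + Q-1 * t) (sym zu+r≡)) (trans (alg₂ (r y) Q-1 z U) (cong (λ t → t * r y + Q-1 * (z * U)) Q≡))))
      dd∣hit : d * d ∣ hit j
      dd∣hit = subst (d * d ∣_) (sym hit≡) (∣m∣n⇒∣m+n (∣m⇒∣m*n (r y) (m∣m*n z)) (∣n⇒∣m*n Q-1 (∣n⇒∣m*n z dd∣u)))
      z∣hit : z ∣ hit j
      z∣hit = subst (z ∣_) (sym hit≡) (∣m∣n⇒∣m+n (∣m⇒∣m*n (r y) (n∣m*n (d * d))) (∣n⇒∣m*n Q-1 (m∣m*n U)))

    -- Exchanging the sums counts pairs of a number `N t` and a prime `y` of `𝒴` dividing it. It
    -- serves the large squares and also q = z.
    count-divisible : ∀ q .{{_ : NonZero q}} → Coprime p q → q * ∑ 𝒴 (λ y → ι (q ∣? u y z)) ≤ 3 * (Y + q)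
    count-divisible q p⊥q = begin
      q * ∑ 𝒴 (λ y → ι (q ∣? u y z))
        ≤⟨ *-monoʳ-≤ q (∑-mono 𝒴 (λ y y∈ → pointwise y y∈)) ⟩
      q * ∑ 𝒴 (λ y → ∑< Y (λ t → ι (q ∣? N t) * ι (y ∣? N t)))
        ≡⟨ cong (q *_) (∑-swap 𝒴 (upTo Y) _) ⟩
      q * ∑< Y (λ t → ∑ 𝒴 (λ y → ι (q ∣? N t) * ι (y ∣? N t)))
        ≤⟨ *-monoʳ-≤ q (∑-mono (upTo Y) (λ t t∈ → ≤-trans (≤-reflexive (∑-*ˡ 𝒴 (ι (q ∣? N t)) _))
             (*-monoʳ-≤ (ι (q ∣? N t)) (at-most-three 𝒴 𝒴-unique 𝒴-big (≤-trans c₀>0 (m≤m+n c₀ (p * t))) (N<pp (∈-upTo⁻ t∈)))))) ⟩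
      q * ∑< Y (λ t → ι (q ∣? N t) * 3)
        ≡⟨ cong (q *_) (∑-*ʳ (upTo Y) 3 _) ⟩
      q * (∑< Y (λ t → ι (q ∣? N t)) * 3)
        ≡⟨ alg q _ ⟩
      3 * (q * ∑< Y (λ t → ι (q ∣? N t)))
        ≤⟨ *-monoʳ-≤ 3 (proj₁ (count-residue q p⊥q c₀ Y)) ⟩
      3 * (Y + q) ∎
      where
      open ≤-Reasoning
      alg : ∀ q s → q * (s * 3) ≡ 3 * (q * s)
      alg = solve-∀
      -- The common class of all u y modulo p, namely -b/z.
      c₀ = sol b z
      c₀>0 : 1 ≤ c₀
      c₀>0 with c₀ | sol-spec b z⊥p
      ... | zero  | p∣ = contradiction (subst (p ∣_) (trans (cong (b +_) (*-zeroʳ z)) (+-identityʳ b)) p∣) p∤b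
      ... | suc _ | _  = s≤s z≤n
      N : ℕ → ℕ
      N t = c₀ + p * t
      𝒴-big : ∀ y → y ∈ 𝒴 → Prime y × p < y * y
      𝒴-big y y∈ = prime-y y∈ , <-trans p<xx (*-mono-< (x<y y∈) (x<y y∈))
      N<pp : ∀ {t} → t < Y → N t < p * p
      N<pp {t} t<Y = begin-strict
        c₀ + p * t    <⟨ +-monoˡ-< (p * t) (sol<p b z) ⟩
        p + p * t     ≡⟨ sym (*-suc p t) ⟩
        p * suc t     ≤⟨ *-monoʳ-≤ p (≤-trans t<Y (≤-trans (m≤m+n Y Y) (<⇒≤ 2Y<p))) ⟩
        p * p         ∎
      pointwise : ∀ y → y ∈ 𝒴 → ι (q ∣? u y z) ≤ ∑< Y (λ t → ι (q ∣? N t) * ι (y ∣? N t))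
      pointwise y y∈ = ι-elim (q ∣? u y z) (_≤ ∑< Y (λ t → ι (q ∣? N t) * ι (y ∣? N t))) (λ q∣u → begin
        1                              ≡⟨ sym (cong₂ _*_ (ι-yes (q ∣? N t) (subst (q ∣_) n′≡ (∣m⇒∣m*n y q∣u)))
              (ι-yes (y ∣? N t) (subst (y ∣_) n′≡ (n∣m*n (u y z))))) ⟩
        ι (q ∣? N t) * ι (y ∣? N t)    ≤⟨ ∑-∈ (upTo Y) (λ t → ι (q ∣? N t) * ι (y ∣? N t)) (∈-upTo⁺ t<Y) ⟩
        ∑< Y (λ t → ι (q ∣? N t) * ι (y ∣? N t)) ∎) (λ _ → z≤n)
        where
        n′ = u y z * y
        t = n′ / p
        alg′ : ∀ b y z u → b + y * z * u ≡ b + z * (u * y)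
        alg′ = solve-∀
        n′≡ : n′ ≡ N t
        n′≡ = trans (m≡m%n+[m/n]*n n′ p) (cong₂ _+_
              (sol-mod b z⊥p n′ (subst (p ∣_) (alg′ b y z (u y z)) (u-spec y∈))) (*-comm t p))
        t<Y : t < Y
        t<Y = m<n*o⇒m/o<n (begin-strict
          u y z * y     <⟨ *-monoˡ-< y {{y≢0 y∈}} (sol<p b (y * z)) ⟩
          p * y         ≤⟨ *-monoʳ-≤ p (y≤Y y∈) ⟩
          p * Y         ≡⟨ *-comm p Y ⟩
          Y * p         ∎)

    -- If u = w y, then w < x, because u < p < x² and y > x, and b + z w y² ≡ 0. For given w this
    -- fixes y up to sign, and the sign is settled by 0 < y₁ + y₂ ≤ 2Y < p.
    count-y∣u : ∑ 𝒴 (λ y → ι (y ∣? u y z)) ≤ x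
    count-y∣u = begin
      ∑ 𝒴 (λ y → ι (y ∣? u y z))
        ≤⟨ ∑-mono 𝒴 pointwise ⟩
      ∑ 𝒴 (λ y → ∑< x (λ w → ι (p ∣? (b + z * w * (y * y)))))
        ≡⟨ ∑-swap 𝒴 (upTo x) _ ⟩
      ∑< x (λ w → ∑ 𝒴 (λ y → ι (p ∣? (b + z * w * (y * y)))))
        ≤⟨ ∑-mono (upTo x) (λ w _ → ∑-ι-≤1 𝒴 (λ y → p ∣? (b + z * w * (y * y))) 𝒴-unique (λ y₁ y₂ → square-root-unique w)) ⟩
      ∑< x (λ _ → 1)
        ≡⟨ trans (∑<-const x 1) (*-identityʳ x) ⟩
      x ∎
      where
      open ≤-Reasoning
      square-root-unique : ∀ w {y₁ y₂} → y₁ ∈ 𝒴 → y₂ ∈ 𝒴 → p ∣ b + z * w * (y₁ * y₁) → p ∣ b + z * w * (y₂ * y₂) → y₁ ≡ y₂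
      square-root-unique w {y₁} {y₂} y₁∈ y₂∈ d₁ d₂ =
        [ (λ le → go le y₁∈ y₂∈ d₁ d₂) , (λ le → sym (go le y₂∈ y₁∈ d₂ d₁)) ]′ (≤-total y₁ y₂)
        where
        go : ∀ {y₁ y₂} → y₁ ≤ y₂ → y₁ ∈ 𝒴 → y₂ ∈ 𝒴 → p ∣ b + z * w * (y₁ * y₁) → p ∣ b + z * w * (y₂ * y₂) → y₁ ≡ y₂
        go {y₁} {y₂} le y₁∈ y₂∈ d₁ d₂ with y₂ ∸ y₁ in eq
        ... | zero  = ≤-antisym le (m∸n≡0⇒m≤n eq)
        ... | suc k = [ (λ p∣zw → contradiction (∣m+n∣m⇒∣n (subst (p ∣_) (+-comm b _) d₁) (∣m⇒∣m*n (y₁ * y₁) p∣zw)) p∤b)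
                      , (λ p∣ → [ (λ p∣k → contradiction (∣⇒≤ p∣k) (<⇒≱ (≤-<-trans (subst (_≤ y₂) eq (m∸n≤m y₂ y₁)) (y<p y₂∈))))
                                , (λ p∣s → contradiction (∣⇒≤ {{>-nonZero
                                      (≤-trans (>-nonZero⁻¹ y₁ {{y≢0 y₁∈}}) (m≤m+n y₁ y₂))}} p∣s) (<⇒≱ (≤-<-trans (+-mono-≤ (y≤Y y₁∈) (y≤Y y₂∈)) 2Y<p))) ]′
                                (euclidsLemma (suc k) (y₁ + y₂) prime-p p∣)) ]′
                      (euclidsLemma (z * w) (suc k * (y₁ + y₂)) prime-p p∣diff)
          where
          y₂≡ : y₂ ≡ suc k + y₁
          y₂≡ = trans (sym (m∸n+n≡m le)) (cong (_+ y₁) eq)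
          alg : ∀ b c k y → b + c * ((k + y) * (k + y)) ≡ b + c * (y * y) + c * (k * (y + (k + y)))
          alg = solve-∀
          p∣diff : p ∣ z * w * (suc k * (y₁ + y₂))
          p∣diff = ∣m+n∣m⇒∣n (subst (p ∣_) (trans (cong (λ t → b + z * w * (t * t)) y₂≡)
            (trans (alg b (z * w) (suc k) y₁) (cong (λ t → b + z * w * (y₁ * y₁) + z * w * (suc k * (y₁ + t))) (sym y₂≡)))) d₂) d₁
      pointwise : ∀ y → y ∈ 𝒴 → ι (y ∣? u y z) ≤ ∑< x (λ w → ι (p ∣? (b + z * w * (y * y))))
      pointwise y y∈ = ι-elim (y ∣? u y z) (_≤ ∑< x (λ w → ι (p ∣? (b + z * w * (y * y))))) (λ y∣u →
        let w = quotient y∣u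
            u≡ = m∣n⇒n≡quotient*m y∣u
            p∣ = subst (p ∣_) (trans (cong (λ t → b + y * z * t) u≡) (alg b y z w)) (u-spec y∈)
        in begin
        1                                       ≡⟨ sym (ι-yes (p ∣? (b + z * w * (y * y))) p∣) ⟩
        ι (p ∣? (b + z * w * (y * y)))          ≤⟨ ∑-∈ (upTo x) (λ w → ι (p ∣? (b + z * w * (y * y)))) (∈-upTo⁺ (w<x w u≡)) ⟩
        ∑< x (λ w → ι (p ∣? (b + z * w * (y * y)))) ∎) (λ _ → z≤n)
        where
        alg : ∀ b y z w → b + y * z * (w * y) ≡ b + z * w * (y * y)
        alg = solve-∀
        w<x : ∀ w → u y z ≡ w * y → w < x
        w<x w u≡ = ≰⇒> λ x≤w → <⇒≱ (<-trans (sol<p b (y * z)) p<xx)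
          (≤-trans (*-mono-≤ x≤w (<⇒≤ (x<y y∈))) (≤-reflexive (sym u≡)))

  -- A d above `D` with d² ∣ u has d < x, as 0 < u < p < x². So d = `suc D + i` with i < J covers
  -- all large d.
  J : ℕ
  J = x ∸ suc D

  -- All obstructions to u y z being squarefree: `S` collects those controlled by the variances, `T`
  -- the large squares together with z ∣ u and y ∣ u.
  S T : ℕ → ℕ → ℕ
  S y z = ∑ (roots D) (λ d → ι (d * d ∣? u y z))
  T y z = ∑< J (λ i → ι ((suc D + i) * (suc D + i) ∣? u y z)) + ι (z ∣? u y z) + ι (y ∣? u y z)

  -- Takes off the constant 3 that every modulus can contribute, so that what is left decays like
  -- 3Y/q and can be summed over q = d².
  excess : ∀ q c → q * c ≤ 3 * (Y + q) → q * (c ∸ 3) ≤ 3 * Y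
  excess q c le = begin
    q * (c ∸ 3)              ≡⟨ *-distribˡ-∸ q c 3 ⟩
    q * c ∸ q * 3            ≤⟨ ∸-monoˡ-≤ (q * 3) le ⟩
    3 * (Y + q) ∸ q * 3      ≡⟨ cong (_∸ q * 3) (alg Y q) ⟩
    3 * Y + q * 3 ∸ q * 3    ≡⟨ m+n∸n≡m (3 * Y) (q * 3) ⟩
    3 * Y                    ∎
    where
    open ≤-Reasoning
    alg : ∀ Y q → 3 * (Y + q) ≡ 3 * Y + q * 3
    alg = solve-∀

  c≤[c∸3]+3 : ∀ c → c ≤ (c ∸ 3) + 3
  c≤[c∸3]+3 c = ≤-trans (m≤n+m∸n c 3) (≤-reflexive (+-comm 3 (c ∸ 3)))

  -- The large d give at most 3Y/D by `large-sum′`, plus 3 for each of `J` ≤ x moduli. The condition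
  -- z ∣ u gives at most 3Y/D + 3, because z > D, and y ∣ u at most x.
  tail-bound : ∀ {z} → SmallPrime z → D * ∑ 𝒴 (λ y → T y z) ≤ D * (4 * x + 3) + 6 * Y
  tail-bound {z} sz = begin
    D * ∑ 𝒴 (λ y → T y z)
      ≡⟨ cong (D *_) (trans (∑-+ 𝒴 _ _) (cong (_+ C) (trans (∑-+ 𝒴 _ _) (cong (_+ B) (∑-swap 𝒴 (upTo J) _))))) ⟩
    D * (∑< J c + B + C)
      ≤⟨ *-monoʳ-≤ D (+-mono-≤ (+-mono-≤ (≤-trans (∑-mono (upTo J) (λ i _ → c≤[c∸3]+3 (c i)))
            (≤-reflexive (trans (∑-+ (upTo J) _ _) (cong (∑< J e +_) (∑<-const J 3))))) (c≤[c∸3]+3 B)) (count-y∣u sz)) ⟩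
    D * (∑< J e + J * 3 + (B ∸ 3 + 3) + x)
      ≡⟨ alg D (∑< J e) J (B ∸ 3) x ⟩
    D * ∑< J e + D * (B ∸ 3) + D * (3 * J + 3 + x)
      ≤⟨ +-mono-≤ (+-mono-≤ (large-sum′ (3 * Y) D J e
            (λ i i<J → excess ((suc D + i) * (suc D + i)) (c i) (count-divisible sz ((suc D + i) * (suc D + i)) (dd⊥p i i<J))))
                            (≤-trans (*-monoˡ-≤ (B ∸ 3) (<⇒≤ D<z)) (excess z B (count-divisible sz z (Coprime.sym (z⊥p sz))))))
                  (*-monoʳ-≤ D (+-monoˡ-≤ x (+-monoˡ-≤ 3 (*-monoʳ-≤ 3 (m∸n≤m x (suc D)))))) ⟩
    3 * Y + 3 * Y + D * (3 * x + 3 + x)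
      ≡⟨ alg₂ Y D x ⟩
    D * (4 * x + 3) + 6 * Y ∎
    where
    open ≤-Reasoning
    open SmallPrime sz
    instance
      z≢0 : NonZero z
      z≢0 = prime⇒nonZero isPrime
    c e : ℕ → ℕ
    c i = ∑ 𝒴 (λ y → ι ((suc D + i) * (suc D + i) ∣? u y z))
    e i = c i ∸ 3
    B = ∑ 𝒴 (λ y → ι (z ∣? u y z))
    C = ∑ 𝒴 (λ y → ι (y ∣? u y z))
    dd⊥p : ∀ i → i < J → Coprime p ((suc D + i) * (suc D + i))
    dd⊥p i i<J = Coprime.sym (coprime-* d⊥p d⊥p)
      where
      d<p : suc D + i < p
      d<p = <-≤-trans (subst (suc D + i <_) (m+[n∸m]≡n {suc D} {x}
            (<⇒≤ (m∸n≢0⇒n<m {x} {suc D} (>⇒≢ (≤-<-trans z≤n i<J))))) (+-monoʳ-< (suc D) i<J)) x≤p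
      d⊥p : Coprime (suc D + i) p
      d⊥p = Coprime.sym (prime⇒coprime prime-p d<p)
    alg : ∀ D s J B x → D * (s + J * 3 + (B + 3) + x) ≡ D * s + D * B + D * (3 * J + 3 + x)
    alg = solve-∀
    alg₂ : ∀ Y D x → 3 * Y + 3 * Y + D * (3 * x + 3 + x) ≡ D * (4 * x + 3) + 6 * Y
    alg₂ = solve-∀

  module _ (bls : List (List ℕ)) (Bs : All PrimeBlock bls) where

    zs : List ℕ
    zs = concat bls

    small-prime : ∀ {z bl} → z ∈ bl → PrimeBlock bl → SmallPrime z
    small-prime {z} z∈ B = let pz , D<z , _ , z≤Z = PrimeBlock.member B z z∈ in smallPrime pz D<z z≤Z

    zs-small : ∀ {z} → z ∈ zs → SmallPrime z
    zs-small z∈ = let bl , z∈bl , bl∈ = ∈-concat⁻′ bls z∈ in small-prime z∈bl (All.lookup Bs bl∈)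

    ∑-concat-≥ : ∀ {bl} (bls : List (List ℕ)) → bl ∈ bls → ∀ f → ∑ bl f ≤ ∑ (concat bls) f
    ∑-concat-≥ (bl ∷ bls) (here refl) f = ≤-trans (m≤m+n _ _) (≤-reflexive (sym (∑-++ bl (concat bls) f)))
    ∑-concat-≥ (bl ∷ bls) (there bl∈) f = ≤-trans (∑-concat-≥ bls bl∈ f)
          (≤-trans (m≤n+m _ _) (≤-reflexive (sym (∑-++ bl (concat bls) f))))

    length-zs : ∀ {bls} → All PrimeBlock bls → length (concat bls) ≡ length bls * m
    length-zs []                 = refl
    length-zs {bl ∷ bls} (B ∷ Bs) = trans (length-++ bl) (cong₂ _+_ (PrimeBlock.size≡m B) (length-zs Bs))

    module _ (none : ∀ y z → y ∈ 𝒴 → z ∈ zs → 1 ≤ S y z + T y z) where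

      -- By `roots-sum` the small squares account for at most 3m/4 in a block that is not bad, while
      -- `none` demands an obstruction for each of its m primes. The missing quarter falls on `T`.
      good-block : ∀ {y bl} → y ∈ 𝒴 → bl ∈ bls → ¬ Bad (r y) bl → m ≤ 4 * ∑ zs (T y)
      good-block {y} {bl} y∈ bl∈ ok = begin
        m                      ≤⟨ m≤4t ⟩
        4 * ∑ bl (T y)         ≤⟨ *-monoʳ-≤ 4 (∑-concat-≥ bls bl∈ (T y)) ⟩
        4 * ∑ zs (T y)         ∎
        where
        open ≤-Reasoning
        B = All.lookup Bs bl∈
        s = ∑ bl (S y)
        t = ∑ bl (T y)
        m≤s+t : m ≤ s + t
        m≤s+t = begin
          m                              ≡⟨ sym (trans (∑-const bl 1) (trans (*-identityʳ _) (PrimeBlock.size≡m B))) ⟩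
          ∑ bl (λ _ → 1)                 ≤⟨ ∑-mono bl (λ z z∈ → none y z y∈ (∈-concat⁺′ z∈ bl∈)) ⟩
          ∑ bl (λ z → S y z + T y z)     ≡⟨ ∑-+ bl (S y) (T y) ⟩
          s + t                          ∎
        s≤F : s ≤ ∑ (roots D) (λ d → F d bl (r y))
        s≤F = begin
          ∑ bl (S y)   ≡⟨ ∑-swap bl (roots D) _ ⟩
          ∑ (roots D) (λ d → ∑ bl (λ z → ι (d * d ∣? u y z)))
            ≤⟨ ∑-mono (roots D) (λ d d∈ → ∑-mono bl (λ z z∈ → ι-elim (d * d ∣? u y z) (_≤ Ev.E d z (r y))
                  (event-occurs (small-prime z∈ B) y∈ d∈) (λ _ → z≤n))) ⟩
          ∑ (roots D) (λ d → F d bl (r y)) ∎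
        4s≤3m : 4 * s ≤ 3 * m
        4s≤3m = ≤-trans (*-monoʳ-≤ 4 s≤F) (roots-sum D m (λ d → F d bl (r y)) (λ d d∈ → ≮⇒≥ (λ bad → ok (lose d∈ bad))))
        m≤4t : m ≤ 4 * t
        m≤4t = +-cancelˡ-≤ (3 * m) m (4 * t) (begin
          3 * m + m          ≡⟨ +-comm (3 * m) m ⟩
          4 * m              ≤⟨ *-monoʳ-≤ 4 m≤s+t ⟩
          4 * (s + t)        ≡⟨ *-distribˡ-+ 4 s t ⟩
          4 * s + 4 * t      ≤⟨ +-monoˡ-≤ (4 * t) 4s≤3m ⟩
          3 * m + 4 * t      ∎)

      each-y : ∀ y → y ∈ 𝒴 → m ≤ m * allBad (r y) bls + 4 * ∑ zs (T y)
      each-y y y∈ = ι-elim (all? (bad? (r y)) bls) (λ i → m ≤ m * i + 4 * ∑ zs (T y))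
        (λ _ → ≤-trans (≤-reflexive (sym (*-identityʳ m))) (m≤m+n (m * 1) _))
        (λ ¬all → let bl , bl∈ , ok = find (¬All⇒Any¬ (bad? (r y)) bls ¬all) in
          ≤-trans (good-block y∈ bl∈ ok) (m≤n+m _ (m * 0)))

      -- Distinct y below p have distinct residues -a/y, so the bad y are at most as many as the bad
      -- residues.
      bad-y : ∑ 𝒴 (λ y → allBad (r y) bls) ≤ ∑< p (λ i → allBad (n * p + i) bls)
      bad-y = begin
        ∑ 𝒴 (λ y → A (sol a y))
          ≤⟨ ∑-mono 𝒴 (λ y y∈ → single y) ⟩
        ∑ 𝒴 (λ y → ∑< p (λ i → ι (i ≟ sol a y) * A i))
          ≡⟨ ∑-swap 𝒴 (upTo p) _ ⟩
        ∑< p (λ i → ∑ 𝒴 (λ y → ι (i ≟ sol a y) * A i))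
          ≤⟨ ∑-mono (upTo p) (λ i _ → ≤-trans (≤-reflexive (∑-*ʳ 𝒴 (A i) _))
               (≤-trans (*-monoˡ-≤ (A i) (∑-ι-≤1 𝒴 (λ y → i ≟ sol a y) 𝒴-unique
                     (λ y₁ y₂ y₁∈ y₂∈ e₁ e₂ → injective y₁∈ y₂∈ (trans (sym e₁) e₂))))
                        (≤-reflexive (*-identityˡ (A i))))) ⟩
        ∑< p A ∎
        where
        open ≤-Reasoning
        A : ℕ → ℕ
        A i = allBad (n * p + i) bls
        single : ∀ y → A (sol a y) ≤ ∑< p (λ i → ι (i ≟ sol a y) * A i)
        single y = begin
          A (sol a y)                                    ≡⟨ sym (*-identityˡ _) ⟩
          1 * A (sol a y)                                ≡⟨ cong (_* A (sol a y)) (sym (ι-yes (sol a y ≟ sol a y) refl)) ⟩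
          ι (sol a y ≟ sol a y) * A (sol a y)            ≤⟨ ∑-∈ (upTo p) (λ i → ι (i ≟ sol a y) * A i) (∈-upTo⁺ (sol<p a y)) ⟩
          ∑< p (λ i → ι (i ≟ sol a y) * A i)             ∎
        i⊥p : ∀ {y} → y ∈ 𝒴 → Coprime (sol a y) p
        i⊥p {y} y∈ with sol a y in eq
        ... | zero  = contradiction (subst (p ∣_)
              (trans (cong (a +_) (trans (cong (y *_) eq) (*-zeroʳ y))) (+-identityʳ a)) (sol-spec a (y⊥p y∈)))
                        (λ p∣a → <⇒≱ (subst (a <_) a+b≡p (m<m+n a 1≤b)) (∣⇒≤ {{>-nonZero 1≤a}} p∣a))
        ... | suc i = Coprime.sym (prime⇒coprime prime-p (subst (_< p) eq (sol<p a y)))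
        injective : ∀ {y₁ y₂} → y₁ ∈ 𝒴 → y₂ ∈ 𝒴 → sol a y₁ ≡ sol a y₂ → y₁ ≡ y₂
        injective {y₁} {y₂} y₁∈ y₂∈ eq = residue-unique (i⊥p y₂∈) a (y<p y₁∈) (y<p y₂∈)
          (subst (λ t → p ∣ a + t) (trans (cong (y₁ *_) eq) (*-comm y₁ _)) (sol-spec a (y⊥p y₁∈)))
          (subst (λ t → p ∣ a + t) (*-comm y₂ _) (sol-spec a (y⊥p y₂∈)))

      -- Summing `each-y` over `𝒴`: every y either is counted among the bad residues or consumes m/4
      -- of the total of `T`, which `tail-bound` limits for each z.
      count-contradiction : D * (m * length 𝒴) ≤
        D * (m * ∑< p (λ i → allBad (n * p + i) bls)) + 4 * (length bls * m * (D * (4 * x + 3) + 6 * Y))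
      count-contradiction = begin
        D * (m * length 𝒴)
          ≡⟨ cong (D *_) (trans (*-comm m _) (sym (∑-const 𝒴 m))) ⟩
        D * ∑ 𝒴 (λ _ → m)
          ≤⟨ *-monoʳ-≤ D (∑-mono 𝒴 each-y) ⟩
        D * ∑ 𝒴 (λ y → m * allBad (r y) bls + 4 * ∑ zs (T y))
          ≡⟨ cong (D *_) (trans (∑-+ 𝒴 _ _) (cong₂ _+_ (∑-*ˡ 𝒴 m _) (trans (∑-*ˡ 𝒴 4 _) (cong (4 *_) (∑-swap 𝒴 zs T))))) ⟩
        D * (m * ∑ 𝒴 (λ y → allBad (r y) bls) + 4 * ∑ zs (λ z → ∑ 𝒴 (λ y → T y z)))
          ≡⟨ alg D _ _ ⟩
        D * (m * ∑ 𝒴 (λ y → allBad (r y) bls)) + 4 * (D * ∑ zs (λ z → ∑ 𝒴 (λ y → T y z)))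
          ≤⟨ +-mono-≤ (*-monoʳ-≤ D (*-monoʳ-≤ m bad-y)) (*-monoʳ-≤ 4 tails) ⟩
        D * (m * ∑< p (λ i → allBad (n * p + i) bls)) + 4 * (length bls * m * (D * (4 * x + 3) + 6 * Y)) ∎
        where
        open ≤-Reasoning
        alg : ∀ D a b → D * (a + 4 * b) ≡ D * a + 4 * (D * b)
        alg = solve-∀
        tails : D * ∑ zs (λ z → ∑ 𝒴 (λ y → T y z)) ≤ length bls * m * (D * (4 * x + 3) + 6 * Y)
        tails = begin
          D * ∑ zs (λ z → ∑ 𝒴 (λ y → T y z))       ≡⟨ sym (∑-*ˡ zs D _) ⟩
          ∑ zs (λ z → D * ∑ 𝒴 (λ y → T y z))       ≤⟨ ∑-const-≤ zs _ (λ z z∈ → tail-bound (zs-small z∈)) ⟩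
          length zs * (D * (4 * x + 3) + 6 * Y)     ≡⟨ cong (_* (D * (4 * x + 3) + 6 * Y)) (length-zs Bs) ⟩
          length bls * m * (D * (4 * x + 3) + 6 * Y) ∎

    find-pair : D * (m * ∑< p (λ i → allBad (n * p + i) bls)) + 4 *
          (length bls * m * (D * (4 * x + 3) + 6 * Y)) < D * (m * length 𝒴) →
                ∃[ y ] ∃[ z ] y ∈ 𝒴 × z ∈ zs × S y z + T y z ≡ 0
    find-pair big = [ (λ found → found) , (λ none → contradiction (count-contradiction none) (<⇒≱ big)) ]′
      (zero-or-positive 𝒴 zs (λ y z → S y z + T y z))

    module _ {y z} (y∈ : y ∈ 𝒴) (z∈ : z ∈ zs) (ST≡0 : S y z + T y z ≡ 0) where

      private
        sz = zs-small z∈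
        open SmallPrime sz
        U = u y z
        instance
          z≢0 : NonZero z
          z≢0 = prime⇒nonZero isPrime
          U≢0 : NonZero U
          U≢0 = >-nonZero (u>0 sz y∈)

      T₁ : ℕ
      T₁ = ∑< J (λ i → ι ((suc D + i) * (suc D + i) ∣? U))

      S≡0 : S y z ≡ 0
      S≡0 = m+n≡0⇒m≡0 (S y z) ST≡0

      T≡0 : T y z ≡ 0
      T≡0 = m+n≡0⇒n≡0 (S y z) ST≡0

      ι≡0⇒¬ : ∀ {P : Set} (d : Dec P) → ι d ≤ 0 → ¬ P
      ι≡0⇒¬ d le pf = contradiction (subst (_≤ 0) (ι-yes d pf) le) (λ ())

      no-square : ∀ q → Prime q → ¬ q * q ∣ U
      no-square q pq with q ≤? D
      ... | yes q≤D = ι≡0⇒¬ (q * q ∣? U) (subst (ι (q * q ∣? U) ≤_) S≡0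
            (∑-∈ (roots D) (λ d → ι (d * d ∣? U)) (prime∈roots pq q≤D)))
      ... | no  q≰D = λ qq∣U → ι≡0⇒¬ ((suc D + i) * (suc D + i) ∣? U)
        (≤-trans (∑-∈ (upTo J) (λ i → ι ((suc D + i) * (suc D + i) ∣? U)) (∈-upTo⁺ (i<J qq∣U)))
          (≤-trans (≤-trans (m≤m+n T₁ (ι (z ∣? U))) (m≤m+n (T₁ + ι (z ∣? U)) (ι (y ∣? U)))) (≤-reflexive T≡0)))
        (subst (λ t → t * t ∣ U) (sym eq) qq∣U)
        where
        i = q ∸ suc D
        eq : suc D + i ≡ q
        eq = m+[n∸m]≡n (≰⇒> q≰D)
        i<J : q * q ∣ U → i < J
        i<J qq∣U = ∸-monoˡ-< {q} {suc D} {x} (≰⇒>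
              (λ x≤q → <⇒≱ (<-trans (sol<p b (y * z)) p<xx) (≤-trans (*-mono-≤ x≤q x≤q) (∣⇒≤ qq∣U)))) (≰⇒> q≰D)

      z∤u : ¬ z ∣ U
      z∤u = ι≡0⇒¬ (z ∣? U) (≤-trans (≤-trans (m≤n+m (ι (z ∣? U)) T₁) (m≤m+n (T₁ + ι (z ∣? U)) (ι (y ∣? U)))) (≤-reflexive T≡0))

      y∤u : ¬ y ∣ U
      y∤u = ι≡0⇒¬ (y ∣? U) (≤-trans (m≤n+m (ι (y ∣? U)) (T₁ + ι (z ∣? U))) (≤-reflexive T≡0))

      y≢z : y ≢ z
      y≢z y≡z = <⇒≢ (≤-<-trans z≤Z (<-trans Z<x (x<y y∈))) (sym y≡z)

      private
        py = prime-y y∈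
        prime-∣-prime : ∀ {q v} → Prime q → Prime v → q ∣ v → q ≡ v
        prime-∣-prime pq pv q∣v with prime⇒irreducible pv q∣v
        ... | inj₁ refl = contradiction pq ¬prime[1]
        ... | inj₂ eq   = eq

      N : ℕ
      N = U * (y * z)

      -- A prime q other than y and z has q² prime to y z, so q² would divide u. For q = y,
      -- cancelling one factor leaves y ∣ u z; for q = z it leaves z ∣ u y.
      squarefree : SquareFree N
      squarefree q pq q²∣N with q ≟ y | q ≟ z
      ... | yes refl | _ = [ y∤u , (λ q∣z → y≢z (prime-∣-prime pq isPrime q∣z)) ]′ (euclidsLemma U z pq
              (*-cancelʳ-∣ y {{prime⇒nonZero pq}} (subst₂ _∣_ (cong (y *_) (*-identityʳ y)) (alg U y z) q²∣N)))
        where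
        alg : ∀ U y z → U * (y * z) ≡ U * z * y
        alg = solve-∀
      ... | no _ | yes refl = [ z∤u , (λ q∣y → y≢z (sym (prime-∣-prime pq py q∣y))) ]′ (euclidsLemma U y pq
              (*-cancelʳ-∣ z {{prime⇒nonZero pq}} (subst₂ _∣_ (cong (z *_) (*-identityʳ z)) (sym (*-assoc U y z)) q²∣N)))
      ... | no q≢y | no q≢z = no-square q pq (coprime-divisor qq⊥yz
            (subst₂ _∣_ (cong (q *_) (*-identityʳ q)) (*-comm U (y * z)) q²∣N))
        where
        q⊥yz : Coprime q (y * z)
        q⊥yz = Coprime.sym (coprime-* (coprime-distinct-primes py pq (q≢y ∘ sym))
              (coprime-distinct-primes isPrime pq (q≢z ∘ sym)))
        qq⊥yz : Coprime (q * q) (y * z)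
        qq⊥yz = coprime-* q⊥yz q⊥yz

      smooth : Smooth p N
      smooth q pq q∣N = [ (λ q∣U → ≤-trans (∣⇒≤ q∣U) (<⇒≤ (sol<p b (y * z))))
                        , (λ q∣yz → [ (λ q∣y → ≤-trans (∣⇒≤ {{y≢0 y∈}} q∣y) (<⇒≤ (y<p y∈)))
                                    , (λ q∣z → ≤-trans (∣⇒≤ q∣z) (≤-trans z≤Z (<⇒≤ Z<p))) ]′ (euclidsLemma y z pq q∣yz)) ]′
                        (euclidsLemma U (y * z) pq q∣N)

      N>0 : 0 < N
      N>0 = >-nonZero⁻¹ N {{m*n≢0 U (y * z) {{U≢0}} {{m*n≢0 y z {{y≢0 y∈}}}}}}

      N≤ : N ≤ p * (Y * Z)
      N≤ = *-mono-≤ (<⇒≤ (sol<p b (y * z))) (*-mono-≤ (y≤Y y∈) z≤Z)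

      p∣b+N : p ∣ b + N
      p∣b+N = subst (λ t → p ∣ b + t) (*-comm (y * z) U) (u-spec sz y∈)

    representative : D * (m * ∑< p (λ i → allBad (n * p + i) bls)) + 4 *
          (length bls * m * (D * (4 * x + 3) + 6 * Y)) < D * (m * length 𝒴) →
                     ∃[ N ] 0 < N × N ≤ p * (Y * Z) × Smooth p N × SquareFree N × p ∣ b + N
    representative big = let y , z , y∈ , z∈ , eq = find-pair big in
      N y∈ z∈ eq , N>0 y∈ z∈ eq , N≤ y∈ z∈ eq , smooth y∈ z∈ eq , squarefree y∈ z∈ eq , p∣b+N y∈ z∈ eq

-- Choice of the parameters.

module Parameters where

  open import Data.Nat
  open import Data.Nat.Properties
  open import Data.Nat.Tactic.RingSolver using (solve-∀)
  open ℕΣ using (∑<)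
  open Chebyshev

  integer-root : ∀ N .{{_ : NonZero N}} p → 1 ≤ p → ∃[ t ] t ^ N ≤ p × p < suc t ^ N
  integer-root N (suc zero)    _ = 1 , ≤-reflexive (^-zeroˡ N) , ^-monoʳ-< 2 ≤-refl {0} {N} (>-nonZero⁻¹ N)
  integer-root N (suc (suc p)) _ with integer-root N (suc p) (s≤s z≤n)
  ... | t , lo , hi with suc t ^ N ≤? suc (suc p)
  ...   | yes le = suc t , le , ≤-<-trans hi (^-monoˡ-< N ≤-refl)
  ...   | no  gt = t , m≤n⇒m≤1+n lo , ≰⇒> gt

  *-^ : ∀ a b k → (a * b) ^ k ≡ a ^ k * b ^ k
  *-^ a b zero    = refl
  *-^ a b (suc k) = trans (cong (a * b *_) (*-^ a b k)) (alg a b (a ^ k) (b ^ k))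
    where
    alg : ∀ a b x y → a * b * (x * y) ≡ a * x * (b * y)
    alg = solve-∀

  length-roots : ∀ D → 2 ≤ D → length (SmallSquares.roots D) ≤ D
  length-roots D 2≤D with halve (D ∸ 1)
  ... | h , lo , _ = begin
    suc (length (map (λ i → 3 + 2 * i) (upTo h)))  ≡⟨ cong suc (trans (length-map _ (upTo h)) (length-upTo h)) ⟩
    suc h                                          ≤⟨ s≤s (≤-trans (m≤m+n h h) lo) ⟩
    suc (D ∸ 1)                                    ≡⟨ m+[n∸m]≡n (≤-trans (s≤s z≤n) 2≤D) ⟩
    D                                              ∎
    where open ≤-Reasoning

  module _ (k : ℕ) where

    -- Everything is a power of t ≈ p^(1/2ν): z ≈ t^(k+6), and y ≈ t^suc j
    -- lies above √p since k² + j = 2ν is less than 2 (suc j).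
    ν j n C₀ C : ℕ
    ν = (k + 7) * k + 1
    j = ν + (7 * k + 1)
    n = (3 * k + 20) * k + 1
    C₀ = 4 ^ k * 2 ^ k * (2 * suc n) * 2 ^ (ν + ν)
    C = suc (C₀ + 4 * (k * (4 * 2 ^ ν + 9))) + suc (2 ^ ν)

    module _ (t : ℕ) (3≤t : 3 ≤ t) (2^ν≤t : 2 ^ ν ≤ t) (2≤k : 2 ≤ k)
             (z-many : (k + 2) * t ^ (k + 5) ≤ length (primesUpTo (t ^ suc (k + 5))))
             (y-many : C * t ^ j ≤ length (primesUpTo (t ^ suc j)))
             (p : ℕ) (prime-p : Prime p) (t^≤p : t ^ (ν + ν) ≤ p) (p<[t+1]^ : p < suc t ^ (ν + ν)) where

      private instance
        t≢0 : NonZero t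
        t≢0 = >-nonZero (≤-trans (s≤s z≤n) 3≤t)
        p≢0 : NonZero p
        p≢0 = prime⇒nonZero prime-p

      -- Five factors t in `m` pay for D⁴ and the at most `D` values of d, so each block gains t^k
      -- and all of them t^(k²). `Z` has one more factor t, to leave room for `k * m` primes above
      -- `m`. The base t + 1 in `x` ensures x² > p. `Y` is `t * W`, where `W` is, up to constants,
      -- the number of bad residues as well as `Y / D`.
      D m Z Y x W : ℕ
      D = t
      m = t ^ (k + 5)
      Z = t ^ suc (k + 5)
      Y = t ^ suc j
      x = suc t ^ ν
      W = t ^ j

      2≤t : 2 ≤ t
      2≤t = ≤-trans (n≤1+n 2) 3≤t

      t^-mono : ∀ {a b} → a ≤ b → t ^ a ≤ t ^ b
      t^-mono = ^-monoʳ-≤ t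

      1≤t^ : ∀ a → 1 ≤ t ^ a
      1≤t^ a = m^n>0 t a

      merge : ∀ a b → t ^ a * t ^ b ≡ t ^ (a + b)
      merge a b = sym (^-distribˡ-+-* t a b)

      [t+1]^≤ : ∀ a → suc t ^ a ≤ 2 ^ a * t ^ a
      [t+1]^≤ a = ≤-trans (^-monoˡ-≤ a (≤-trans (+-monoˡ-≤ t (≤-trans (s≤s z≤n) 3≤t))
            (≤-reflexive (cong (t +_) (sym (+-identityʳ t)))))) (≤-reflexive (*-^ 2 t a))

      ν≤j : ν ≤ j
      ν≤j = m≤m+n ν _

      x≤2^νW : x ≤ 2 ^ ν * W
      x≤2^νW = ≤-trans ([t+1]^≤ ν) (*-monoʳ-≤ (2 ^ ν) (t^-mono ν≤j))

      x≤Y : x ≤ Y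
      x≤Y = ≤-trans x≤2^νW (*-monoˡ-≤ W 2^ν≤t)

      -- Since 2ν = k² + j, this amounts to k² ≥ 2.
      suc[j]<ν+ν : suc (suc j) ≤ ν + ν
      suc[j]<ν+ν = begin
        suc (suc j)                ≡⟨ alg₁ k ν ⟩
        ν + (7 * k + 1 * 1 + 2)    ≤⟨ +-monoʳ-≤ ν (+-monoʳ-≤ (7 * k + 1 * 1) 2≤k) ⟩
        ν + (7 * k + 1 * 1 + k)    ≤⟨ +-monoʳ-≤ ν
              (≤-trans (+-monoʳ-≤ (7 * k + 1 * 1) (m≤m*n k k {{>-nonZero (≤-trans (s≤s z≤n) 2≤k)}})) (≤-reflexive (alg₂ k))) ⟩
        ν + ν                      ∎
        where
        open ≤-Reasoning
        alg₁ : ∀ k ν → suc (suc (ν + (7 * k + 1))) ≡ ν + (7 * k + 1 * 1 + 2)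
        alg₁ = solve-∀
        alg₂ : ∀ k → 7 * k + 1 * 1 + k * k ≡ (k + 7) * k + 1
        alg₂ = solve-∀

      2Y<p : Y + Y < p
      2Y<p = begin-strict
        Y + Y                ≡⟨ cong (Y +_) (sym (+-identityʳ Y)) ⟩
        2 * Y                <⟨ *-monoˡ-< Y {{m^n≢0 t (suc j)}} 3≤t ⟩
        t ^ suc (suc j)      ≤⟨ t^-mono suc[j]<ν+ν ⟩
        t ^ (ν + ν)          ≤⟨ t^≤p ⟩
        p                    ∎
        where open ≤-Reasoning

      Y≤p : Y ≤ p
      Y≤p = ≤-trans (m≤m+n Y Y) (<⇒≤ 2Y<p)

      D<p : D < p
      D<p = begin-strict
        t          <⟨ m<m+n t (≤-trans (s≤s z≤n) 3≤t) ⟩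
        t + t      ≤⟨ +-mono-≤ t≤Y t≤Y ⟩
        Y + Y      <⟨ 2Y<p ⟩
        p          ∎
        where
        open ≤-Reasoning
        t≤Y : t ≤ Y
        t≤Y = m≤m*n t (t ^ j) {{m^n≢0 t j}}

      Z<x : Z < x
      Z<x = begin-strict
        t ^ suc (k + 5)   ≤⟨ t^-mono exponent ⟩
        t ^ ν             <⟨ ^-monoˡ-< ν {{>-nonZero ν>0}} ≤-refl ⟩
        suc t ^ ν         ∎
        where
        open ≤-Reasoning
        ν>0 : 1 ≤ ν
        ν>0 = m≤n+m 1 ((k + 7) * k)
        exponent : suc (k + 5) ≤ ν
        exponent = begin
          suc (k + 5)       ≤⟨ m≤n+m (suc (k + 5)) 1 ⟩
          suc (suc (k + 5)) ≡⟨ alg k ⟩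
          (k + 7) * 1       ≤⟨ *-monoʳ-≤ (k + 7) (≤-trans (s≤s z≤n) 2≤k) ⟩
          (k + 7) * k       ≤⟨ m≤m+n _ 1 ⟩
          ν                 ∎
          where
          alg : ∀ k → suc (suc (k + 5)) ≡ (k + 7) * 1
          alg = solve-∀

      p<xx : p < x * x
      p<xx = subst (p <_) (^-distribˡ-+-* (suc t) ν ν) p<[t+1]^

      m≤Z : m ≤ Z
      m≤Z = t^-mono (n≤1+n (k + 5))

      𝒵 𝒴 : List ℕ
      𝒵 = primesBetween m Z
      𝒴 = primesBetween x Y

      -- Of the `(k + 2) * m` primes at most `suc m` ≤ 2m are lost by requiring z > m.
      length-𝒵 : k * m ≤ length 𝒵
      length-𝒵 = +-cancelˡ-≤ (suc m) (k * m) (length 𝒵) (begin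
        suc m + k * m                ≤⟨ +-monoˡ-≤ (k * m) (+-monoˡ-≤ m (1≤t^ (k + 5))) ⟩
        m + m + k * m                ≡⟨ alg k m ⟩
        (k + 2) * m                  ≤⟨ z-many ⟩
        length (primesUpTo Z)        ≤⟨ length-primesBetween m≤Z ⟩
        suc m + length 𝒵             ∎)
        where
        open ≤-Reasoning
        alg : ∀ k m → m + m + k * m ≡ (k + 2) * m
        alg = solve-∀

      -- The summand `suc (2 ^ ν)` of `C` pays for the primes up to `x`.
      length-𝒴 : suc (C₀ + 4 * (k * (4 * 2 ^ ν + 9))) * W ≤ length 𝒴
      length-𝒴 = +-cancelˡ-≤ (suc x) _ (length 𝒴) (begin
        suc x + c * W                          ≤⟨ +-monoˡ-≤ (c * W) (+-mono-≤ (1≤t^ j) x≤2^νW) ⟩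
        W + 2 ^ ν * W + c * W                  ≡⟨ alg W (2 ^ ν) c ⟩
        C * W                                  ≤⟨ y-many ⟩
        length (primesUpTo Y)                  ≤⟨ length-primesBetween x≤Y ⟩
        suc x + length 𝒴                       ∎)
        where
        open ≤-Reasoning
        c = suc (C₀ + 4 * (k * (4 * 2 ^ ν + 9)))
        alg : ∀ W a c → W + a * W + c * W ≡ (c + suc a) * W
        alg = solve-∀

      module _ (a b : ℕ) (1≤a : 1 ≤ a) (1≤b : 1 ≤ b) (a+b≡p : a + b ≡ p) where

        private module Sel = Selection p n D Z m x Y a b prime-p 1≤a 1≤b a+b≡p 2≤t D<p Z<x p<xx 2Y<p
                               𝒴 (primesBetween-unique x Y) (λ y → ∈-primesBetween⁻ x≤Y) (≤-trans x≤Y Y≤p)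
        private module SB = SquareBlocks p n D Z m (SmallSquares.roots D) prime-p D<p Sel.Z<p (SmallSquares.roots-bounds 2≤t)
        open Blocks p n D Z m using (Err)

        private
          chunked = Chunks.chunks k m 𝒵 (primesBetween-unique m Z) length-𝒵
          bls = proj₁ chunked
          length-bls = proj₁ (proj₂ chunked)

        Bs : All SB.PrimeBlock bls
        Bs = All.map prime-block (proj₁ (proj₂ (proj₂ chunked)))
          where
          t≤m : t ≤ m
          t≤m = subst (_≤ m) (^-identityʳ t) (t^-mono (≤-trans (s≤s z≤n) (m≤n+m 5 k)))
          prime-block : ∀ {bl} → Chunks.Chunk m 𝒵 bl → SB.PrimeBlock bl
          prime-block (Chunks.chunk u s sub) = record
            { unique = u ; size≡m = s
            ; member = λ z z∈ → let pz , m<z , z≤Z = ∈-primesBetween⁻ m≤Z (sub z∈) in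
                pz , ≤-<-trans t≤m m<z , <⇒≤ m<z , z≤Z }

        Bad : ℕ
        Bad = ∑< p (λ i → SB.allBad (n * p + i) bls)

        -- One `βW` is at most 2 t^5 m², a power of t with exponent 2k + 15.
        E₂ : ℕ
        E₂ = (2 * k + 15) * k

        -- Apart from the n-th power of the period bound t^eM, the error is 2 t^((3k+20)k), at most
        -- t^n by the choice of `n`. As eM + 2 = 2ν, the period times t is at most p, so each of the
        -- n averages gains the factor t that is needed.
        TW≤ : SB.TW ^ k * Err k ≤ p ^ n
        TW≤ = begin
          SB.TW ^ k * Err k
            ≤⟨ *-monoˡ-≤ (Err k) (^-monoˡ-≤ k (*-monoˡ-≤ (m * m) (length-roots D 2≤t))) ⟩
          (t * (m * m)) ^ k * (m ^ k * (((Z * Z) ^ k * (t * t) ^ k) ^ n * (2 * (t * t * (t * t)) ^ k)))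
            ≡⟨ cong₂ (λ u v → u ^ k * (m ^ k * (v ^ n * (2 * (t * t * (t * t)) ^ k)))) tmm≡ M≡ ⟩
          (t ^ e₁) ^ k * (m ^ k * ((t ^ eM) ^ n * (2 * (t * t * (t * t)) ^ k)))
            ≡⟨ cong₂ (λ u v → u * (v * ((t ^ eM) ^ n * (2 * (t * t * (t * t)) ^ k)))) (^-*-assoc t e₁ k) (^-*-assoc t (k + 5) k) ⟩
          t ^ (e₁ * k) * (t ^ ((k + 5) * k) * ((t ^ eM) ^ n * (2 * (t * t * (t * t)) ^ k)))
            ≡⟨ cong (λ u → t ^ (e₁ * k) * (t ^ ((k + 5) * k) * ((t ^ eM) ^ n * (2 * u))))
                  (trans (cong (_^ k) t⁴≡) (^-*-assoc t 4 k)) ⟩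
          t ^ (e₁ * k) * (t ^ ((k + 5) * k) * ((t ^ eM) ^ n * (2 * t ^ (4 * k))))
            ≡⟨ alg (t ^ (e₁ * k)) (t ^ ((k + 5) * k)) ((t ^ eM) ^ n) (t ^ (4 * k)) ⟩
          2 * (t ^ (e₁ * k) * t ^ ((k + 5) * k) * t ^ (4 * k)) * (t ^ eM) ^ n
            ≡⟨ cong (λ u → 2 * u * (t ^ eM) ^ n) (trans (cong (_* t ^ (4 * k)) (merge (e₁ * k) ((k + 5) * k)))
                  (trans (merge (e₁ * k + (k + 5) * k) (4 * k)) (cong (t ^_) (alg₂ k)))) ⟩
          2 * t ^ ((3 * k + 20) * k) * (t ^ eM) ^ n
            ≤⟨ *-monoˡ-≤ ((t ^ eM) ^ n) (*-monoˡ-≤ (t ^ ((3 * k + 20) * k)) 2≤t) ⟩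
          t ^ suc ((3 * k + 20) * k) * (t ^ eM) ^ n
            ≡⟨ cong (λ u → t ^ u * (t ^ eM) ^ n) (+-comm 1 ((3 * k + 20) * k)) ⟩
          t ^ n * (t ^ eM) ^ n
            ≡⟨ sym (*-^ t (t ^ eM) n) ⟩
          (t ^ suc eM) ^ n
            ≤⟨ ^-monoˡ-≤ n (≤-trans (t^-mono (≤-trans (m≤m+n (suc eM) 1) (≤-reflexive (alg₃ k)))) t^≤p) ⟩
          p ^ n ∎
          where
          open ≤-Reasoning
          e₁ = suc ((k + 5) + (k + 5))
          eM = (suc (k + 5) + suc (k + 5)) * k + 2 * k
          tmm≡ : t * (m * m) ≡ t ^ e₁
          tmm≡ = cong (t *_) (merge (k + 5) (k + 5))
          t⁴≡ : t * t * (t * t) ≡ t ^ 4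
          t⁴≡ = alg₄ t
            where
            alg₄ : ∀ t → t * t * (t * t) ≡ t * (t * (t * (t * 1)))
            alg₄ = solve-∀
          M≡ : (Z * Z) ^ k * (t * t) ^ k ≡ t ^ eM
          M≡ = trans (cong₂ (λ u v → u ^ k * v ^ k) (merge (suc (k + 5)) (suc (k + 5))) (cong (t *_) (sym (*-identityʳ t))))
               (trans (cong₂ _*_ (^-*-assoc t (suc (k + 5) + suc (k + 5)) k) (^-*-assoc t 2 k))
                     (merge ((suc (k + 5) + suc (k + 5)) * k) (2 * k)))
          alg : ∀ a b c d → a * (b * (c * (2 * d))) ≡ 2 * (a * b * d) * c
          alg = solve-∀
          alg₂ : ∀ k → suc ((k + 5) + (k + 5)) * k + (k + 5) * k + 4 * k ≡ (3 * k + 20) * k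
          alg₂ = solve-∀
          alg₃ : ∀ k → suc ((suc (k + 5) + suc (k + 5)) * k + 2 * k) + 1 ≡ (k + 7) * k + 1 + ((k + 7) * k + 1)
          alg₃ = solve-∀

        βW≤ : SB.βW ^ k ≤ 2 ^ k * t ^ E₂
        βW≤ = begin
          SB.βW ^ k                          ≤⟨ ^-monoˡ-≤ k (*-monoˡ-≤ _ (length-roots D 2≤t)) ⟩
          (t * (m * (t * t * (t * t) * m + m * (t * t * (t * t))))) ^ k   ≡⟨ cong (_^ k) (alg t m) ⟩
          (2 * (t ^ 5 * (m * m))) ^ k        ≡⟨ cong (λ u → (2 * u) ^ k)
                (trans (cong (t ^ 5 *_) (merge (k + 5) (k + 5))) (merge 5 (k + 5 + (k + 5)))) ⟩
          (2 * t ^ (5 + (k + 5 + (k + 5)))) ^ k  ≡⟨ *-^ 2 (t ^ (5 + (k + 5 + (k + 5)))) k ⟩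
          2 ^ k * (t ^ (5 + (k + 5 + (k + 5)))) ^ k  ≡⟨ cong (2 ^ k *_)
                (trans (^-*-assoc t (5 + (k + 5 + (k + 5))) k) (cong (t ^_) (alg₂ k))) ⟩
          2 ^ k * t ^ E₂                     ∎
          where
          open ≤-Reasoning
          alg : ∀ t m → t * (m * (t * t * (t * t) * m + m * (t * t * (t * t)))) ≡ 2 * (t * (t * (t * (t * (t * 1)))) * (m * m))
          alg = solve-∀
          alg₂ : ∀ k → (5 + (k + 5 + (k + 5))) * k ≡ (2 * k + 15) * k
          alg₂ = solve-∀

        -- The factor m^(3k) on the left of `count-allBad` is t^(E₂ + k²). Main term and error are
        -- both at most p^n 2^k t^E₂, which explains the 2 in `2 * suc n`.
        t^k²Bad≤ : t ^ (k * k) * Bad ≤ 4 ^ k * 2 ^ k * (2 * suc n) * p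
        t^k²Bad≤ = *-cancelˡ-≤ (p ^ n * t ^ E₂) {{m*n≢0 (p ^ n) (t ^ E₂) {{m^n≢0 p n}} {{m^n≢0 t E₂}}}} (begin
          p ^ n * t ^ E₂ * (t ^ (k * k) * Bad)
            ≡⟨ alg₁ (p ^ n) (t ^ E₂) (t ^ (k * k)) Bad ⟩
          t ^ E₂ * t ^ (k * k) * (p ^ n * Bad)
            ≡⟨ cong (_* (p ^ n * Bad)) (trans (merge E₂ (k * k))
                  (trans (cong (t ^_) (alg₂ k)) (sym (merge ((k + 5) * k) ((k + 5 + (k + 5)) * k))))) ⟩
          t ^ ((k + 5) * k) * t ^ ((k + 5 + (k + 5)) * k) * (p ^ n * Bad)
            ≡⟨ cong₂ (λ u v → u * v * (p ^ n * Bad)) (sym (^-*-assoc t (k + 5) k))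
                  (trans (sym (^-*-assoc t (k + 5 + (k + 5)) k)) (cong (_^ k) (sym (merge (k + 5) (k + 5))))) ⟩
          m ^ k * (m * m) ^ k * (p ^ n * Bad)
            ≡⟨ alg₃ (m ^ k) ((m * m) ^ k) (p ^ n) Bad ⟩
          m ^ k * (p ^ n * ((m * m) ^ k * Bad))
            ≤⟨ subst (λ l → m ^ l * (p ^ n * ((m * m) ^ l * Bad)) ≤ 4 ^ l *
                  ((n * p + p) * (p ^ n * SB.βW ^ l + SB.TW ^ l * Err l)))
                 length-bls (SB.count-allBad Bs (proj₂ (proj₂ (proj₂ chunked)))) ⟩
          4 ^ k * ((n * p + p) * (p ^ n * SB.βW ^ k + SB.TW ^ k * Err k))
            ≤⟨ *-monoʳ-≤ (4 ^ k) (*-monoʳ-≤ (n * p + p) (+-mono-≤ (*-monoʳ-≤ (p ^ n) βW≤)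
                 (≤-trans TW≤ (≤-trans (≤-reflexive (sym (*-identityʳ (p ^ n))))
                       (*-monoʳ-≤ (p ^ n) (*-mono-≤ (m^n>0 2 k) (1≤t^ E₂))))))) ⟩
          4 ^ k * ((n * p + p) * (p ^ n * (2 ^ k * t ^ E₂) + p ^ n * (2 ^ k * t ^ E₂)))
            ≡⟨ alg₄ (4 ^ k) (2 ^ k) n p (p ^ n) (t ^ E₂) ⟩
          p ^ n * t ^ E₂ * (4 ^ k * 2 ^ k * (2 * suc n) * p) ∎)
          where
          open ≤-Reasoning
          alg₁ : ∀ a b c d → a * b * (c * d) ≡ b * c * (a * d)
          alg₁ = solve-∀
          alg₂ : ∀ k → (2 * k + 15) * k + k * k ≡ (k + 5) * k + (k + 5 + (k + 5)) * k
          alg₂ = solve-∀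
          alg₃ : ∀ a b c d → a * b * (c * d) ≡ a * (c * (b * d))
          alg₃ = solve-∀
          alg₄ : ∀ a b n p q s → a * ((n * p + p) * (q * (b * s) + q * (b * s))) ≡ q * s * (a * b * (2 * suc n) * p)
          alg₄ = solve-∀

        -- p is below 2^(2ν) t^(2ν), and 2ν = k² + j, so division by t^(k²) leaves a constant times
        -- t^j.
        Bad≤ : Bad ≤ C₀ * W
        Bad≤ = *-cancelˡ-≤ (t ^ (k * k)) {{m^n≢0 t (k * k)}} (begin
          t ^ (k * k) * Bad
            ≤⟨ t^k²Bad≤ ⟩
          c * p
            ≤⟨ *-monoʳ-≤ c (≤-trans (<⇒≤ p<[t+1]^) ([t+1]^≤ (ν + ν))) ⟩
          c * (2 ^ (ν + ν) * t ^ (ν + ν))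
            ≡⟨ cong (λ u → c * (2 ^ (ν + ν) * u)) (trans (cong (t ^_) (alg k)) (sym (merge (k * k) j))) ⟩
          c * (2 ^ (ν + ν) * (t ^ (k * k) * W))
            ≡⟨ alg₂ c (2 ^ (ν + ν)) (t ^ (k * k)) W ⟩
          t ^ (k * k) * (C₀ * W) ∎)
          where
          open ≤-Reasoning
          c = 4 ^ k * 2 ^ k * (2 * suc n)
          alg : ∀ k → (k + 7) * k + 1 + ((k + 7) * k + 1) ≡ k * k + ((k + 7) * k + 1 + (7 * k + 1))
          alg = solve-∀
          alg₂ : ∀ c a b w → c * (a * (b * w)) ≡ b * (c * a * w)
          alg₂ = solve-∀

        -- Both sides are multiples of t m W. The 9 is 3 + 6, from 3 ≤ 3W and 6Y = 6tW; the `suc` in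
        -- the bound of `length-𝒴` makes the inequality strict.
        enough-y : D * (m * Bad) + 4 * (length bls * m * (D * (4 * x + 3) + 6 * Y)) < D * (m * length 𝒴)
        enough-y = begin-strict
          t * (m * Bad) + 4 * (length bls * m * (t * (4 * x + 3) + 6 * Y))
            ≤⟨ +-mono-≤ (*-monoʳ-≤ t (*-monoʳ-≤ m Bad≤))
                 (*-monoʳ-≤ 4 (*-mono-≤ (≤-reflexive (cong (_* m) length-bls))
                   (+-monoˡ-≤ (6 * Y) (*-monoʳ-≤ t (+-mono-≤ (*-monoʳ-≤ 4 x≤2^νW)
                         (≤-trans (≤-reflexive (sym (*-identityʳ 3))) (*-monoʳ-≤ 3 (1≤t^ j)))))))) ⟩
          t * (m * (C₀ * W)) + 4 * (k * m * (t * (4 * (2 ^ ν * W) + 3 * W) + 6 * (t * W)))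
            ≡⟨ alg t m C₀ W k (2 ^ ν) ⟩
          t * (m * ((C₀ + 4 * (k * (4 * 2 ^ ν + 9))) * W))
            <⟨ *-monoʳ-< t (*-monoʳ-< m {{m^n≢0 t (k + 5)}}
                  (*-monoˡ-< W {{m^n≢0 t j}} (n<1+n (C₀ + 4 * (k * (4 * 2 ^ ν + 9)))))) ⟩
          t * (m * (suc (C₀ + 4 * (k * (4 * 2 ^ ν + 9))) * W))
            ≤⟨ *-monoʳ-≤ t (*-monoʳ-≤ m length-𝒴) ⟩
          t * (m * length 𝒴) ∎
          where
          open ≤-Reasoning
          alg : ∀ t m C W k a → t * (m * (C * W)) + 4 * (k * m * (t * (4 * (a * W) + 3 * W) + 6 * (t * W))) ≡ t *
                (m * ((C + 4 * (k * (4 * a + 9))) * W))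
          alg = solve-∀

        representative : ∃[ N ] 0 < N × N ≤ p * (Y * Z) × Smooth p N × SquareFree N × p ∣ b + N
        representative = Sel.representative bls Bs enough-y

  -- p Y Z ≤ p^(3/2 + 1/K), with the roots cleared.
  power-bound : ∀ K p t → let k = 4 * K in t ^ (ν k + ν k) ≤ p → 1 ≤ t →
                (p * (t ^ suc (j k) * t ^ suc (k + 5))) ^ (2 * K) ≤ p ^ (3 * K + 2)
  power-bound K p t t^≤p 1≤t = begin
    (p * (t ^ suc (j k) * t ^ suc (k + 5))) ^ (2 * K)
      ≡⟨ *-^ p (t ^ suc (j k) * t ^ suc (k + 5)) (2 * K) ⟩
    p ^ (2 * K) * (t ^ suc (j k) * t ^ suc (k + 5)) ^ (2 * K)
      ≡⟨ cong (λ u → p ^ (2 * K) * u) (trans (cong (_^ (2 * K)) (sym (^-distribˡ-+-* t (suc (j k)) (suc (k + 5)))))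
            (^-*-assoc t (suc (j k) + suc (k + 5)) (2 * K))) ⟩
    p ^ (2 * K) * t ^ ((suc (j k) + suc (k + 5)) * (2 * K))
      ≤⟨ *-monoʳ-≤ (p ^ (2 * K)) (^-monoʳ-≤ t {{>-nonZero 1≤t}}
            (≤-trans (m≤m+n ((suc (j k) + suc (k + 5)) * (2 * K)) (96 * K + 4)) (≤-reflexive (alg K)))) ⟩
    p ^ (2 * K) * t ^ ((ν k + ν k) * (K + 2))
      ≡⟨ cong (p ^ (2 * K) *_) (sym (^-*-assoc t (ν k + ν k) (K + 2))) ⟩
    p ^ (2 * K) * (t ^ (ν k + ν k)) ^ (K + 2)
      ≤⟨ *-monoʳ-≤ (p ^ (2 * K)) (^-monoˡ-≤ (K + 2) t^≤p) ⟩
    p ^ (2 * K) * p ^ (K + 2)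
      ≡⟨ sym (^-distribˡ-+-* p (2 * K) (K + 2)) ⟩
    p ^ (2 * K + (K + 2))
      ≡⟨ cong (p ^_) (alg₂ K) ⟩
    p ^ (3 * K + 2) ∎
    where
    open ≤-Reasoning
    k = 4 * K
    alg : ∀ K → (suc ((4 * K + 7) * (4 * K) + 1 + (7 * (4 * K) + 1)) + suc (4 * K + 5)) * (2 * K) + (96 * K + 4)
              ≡ ((4 * K + 7) * (4 * K) + 1 + ((4 * K + 7) * (4 * K) + 1)) * (K + 2)
    alg = solve-∀
    alg₂ : ∀ K → 2 * K + (K + 2) ≡ 3 * K + 2
    alg₂ = solve-∀

  Representable : ℕ → ℕ → Set
  Representable p B = ∀ a b → 1 ≤ a → 1 ≤ b → a + b ≡ p → ∃[ N ] 0 < N × N ≤ B × Smooth p N × SquareFree N × p ∣ b + N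

  eventually-representable : ∀ K → 1 ≤ K → ∃[ N₀ ] ∀ p → Prime p → N₀ ≤ p →
    ∃[ B ] B ^ (2 * K) ≤ p ^ (3 * K + 2) × p ≤ B × Representable p B
  eventually-representable K 1≤K = t₁ ^ (ν k + ν k) , main
    where
    -- Y Z exceeds t^ν by the factor t^(8k+8), while p^(1/K) is at least t^(2ν/K) = t^(8ν/k), and
    -- 8ν/k is more than 8k + 8.
    k = 4 * K
    Az = suc (k + 5) * (k + 2)
    Ay = suc (j k) * C k
    tz = log-threshold Az
    ty = log-threshold Ay
    t₁ = 3 + 2 ^ ν k + proj₁ tz + proj₁ ty
    main : ∀ p → Prime p → t₁ ^ (ν k + ν k) ≤ p → ∃[ B ] B ^ (2 * K) ≤ p ^ (3 * K + 2) × p ≤ B × Representable p B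
    main p prime-p N₀≤p =
      p * (t ^ suc (j k) * t ^ suc (k + 5)) , power-bound K p t lo 1≤t
        , m≤m*n p _ {{m*n≢0 (t ^ suc (j k)) _ {{m^n≢0 t (suc (j k))}} {{m^n≢0 t (suc (k + 5))}}}}
        , representative k t 3≤t 2^ν≤t 2≤k
            (π-lower {b = bz} (k + 5) (k + 2) t<2^bz (subst (λ s → 2 + s < t) (sym (*-assoc bz (suc (k + 5)) (k + 2))) bz-small))
            (π-lower {b = by} (j k) (C k) t<2^by (subst (λ s → 2 + s < t) (sym (*-assoc by (suc (j k)) (C k))) by-small))
            p prime-p lo hi
      where
      instance
        2ν≢0 : NonZero (ν k + ν k)
        2ν≢0 = >-nonZero (≤-trans (m≤n+m 1 ((k + 7) * k)) (m≤m+n (ν k) (ν k)))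
      root = integer-root (ν k + ν k) p (>-nonZero⁻¹ p {{prime⇒nonZero prime-p}})
      t = proj₁ root
      lo = proj₁ (proj₂ root)
      hi = proj₂ (proj₂ root)
      t₁≤t : t₁ ≤ t
      t₁≤t = s≤s⁻¹ (≰⇒> λ t<t₁ → <⇒≱ hi (≤-trans (^-monoˡ-≤ (ν k + ν k) t<t₁) N₀≤p))
      3≤t : 3 ≤ t
      3≤t = ≤-trans (≤-trans (m≤m+n 3 (2 ^ ν k)) (≤-trans (m≤m+n _ (proj₁ tz)) (m≤m+n _ (proj₁ ty)))) t₁≤t
      1≤t : 1 ≤ t
      1≤t = ≤-trans (s≤s z≤n) 3≤t
      instance
        t≢0 : NonZero t
        t≢0 = >-nonZero 1≤t
      2^ν≤t : 2 ^ ν k ≤ t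
      2^ν≤t = ≤-trans (≤-trans (m≤n+m (2 ^ ν k) 3) (≤-trans (m≤m+n _ (proj₁ tz)) (m≤m+n _ (proj₁ ty)))) t₁≤t
      2≤k : 2 ≤ k
      2≤k = ≤-trans (s≤s (s≤s z≤n)) (*-monoʳ-≤ 4 1≤K)
      bz-spec = proj₂ tz t (≤-trans (≤-trans (m≤n+m (proj₁ tz) (3 + 2 ^ ν k)) (m≤m+n _ (proj₁ ty))) t₁≤t)
      by-spec = proj₂ ty t (≤-trans (m≤n+m (proj₁ ty) (3 + 2 ^ ν k + proj₁ tz)) t₁≤t)
      bz = proj₁ bz-spec
      by = proj₁ by-spec
      t<2^bz = proj₁ (proj₂ bz-spec)
      bz-small = proj₂ (proj₂ bz-spec)
      t<2^by = proj₁ (proj₂ by-spec)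
      by-small = proj₂ (proj₂ by-spec)

-- From congruences to the minimum M(p).

module Covering where

  open import Data.Integer.DivMod using (a≡a%ℕn+[a/ℕn]*n; n%ℕd<d; _%ℕ_; _/ℕ_)
  import Data.Integer.Divisibility as ℤ
  import Data.Integer.Divisibility.Signed as Signed
  import Data.Integer.Properties as ℤ
  import Data.Integer.Tactic.RingSolver as ℤ-Solver
  open import Data.Integer as ℤ using (ℤ; +_; -[1+_])
  open import Data.Nat hiding (_/_)
  open import Data.Nat.Properties
  open Parameters using (Representable)
  open import Algebra.Properties.Group (AbelianGroup.group ℤ.+-0-abelianGroup) using (∙-cancelˡ)

  Represents : ℕ → ℕ → ℤ → ℕ → Set
  Represents p m a n = 0 < n × n ≤ m × Smooth p n × SquareFree n × (+ p) ℤ.∣ ((+ n) ℤ.- a)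

  squareFree-prime : ∀ {p} → Prime p → SquareFree p
  squareFree-prime {p} pp q pq q²∣p with prime⇒irreducible pp (∣-trans (m∣m*n {q} (q * 1)) q²∣p)
  ... | inj₁ refl = contradiction pq ¬prime[1]
  ... | inj₂ refl = <⇒≱ (m<m*n p p (Chebyshev.prime⇒≥2 pp)) (subst (_≤ p) (cong (p *_) (*-identityʳ p)) (∣⇒≤ q²∣p))
    where instance _ = prime⇒nonZero pp

  ∣-difference : ∀ {p} (a : ℤ) (k : ℤ) n → + n ≡ a ℤ.+ k ℤ.* + p → (+ p) ℤ.∣ ((+ n) ℤ.- a)
  ∣-difference {p} a k n eq = Signed.∣⇒∣ᵤ (Signed.divides k (trans (cong (ℤ._- a) eq) (alg a (k ℤ.* + p))))
    where
    alg : ∀ a x → a ℤ.+ x ℤ.- a ≡ x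
    alg = ℤ-Solver.solve-∀

  covers : ∀ {p B} → Prime p → p ≤ B → Representable p B → CoversResidues p B
  covers {p} {B} pp p≤B rep a with a %ℕ p | a≡a%ℕn+[a/ℕn]*n a p | n%ℕd<d a p
    where instance _ = prime⇒nonZero pp
  -- The class of 0 is represented by p itself, which is p-smooth and squarefree; `Representable`
  -- speaks of the other classes only.
  ... | zero | a≡ | _ = p , >-nonZero⁻¹ p , p≤B , (λ q _ q∣p → ∣⇒≤ q∣p) , squareFree-prime pp
      , ∣-difference a (ℤ.1ℤ ℤ.- κ) p (sym (trans (cong (ℤ._+ (ℤ.1ℤ ℤ.- κ) ℤ.* + p) a≡) (alg κ (+ p))))
    where
    instance p≢0 = prime⇒nonZero pp
    κ = a /ℕ p
    alg : ∀ κ p → + 0 ℤ.+ κ ℤ.* p ℤ.+ (ℤ.1ℤ ℤ.- κ) ℤ.* p ≡ p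
    alg = ℤ-Solver.solve-∀
  ... | suc r | a≡ | r<p with rep (suc r) (p ∸ suc r) (s≤s z≤n) (m<n⇒0<n∸m r<p) (m+[n∸m]≡n (<⇒≤ r<p))
  ...   | N , N>0 , N≤ , smooth , sqf , divides k eq = N , N>0 , N≤ , smooth , sqf
      , ∣-difference a (+ k ℤ.- κ ℤ.- ℤ.1ℤ) N (∙-cancelˡ (+ (p ∸ suc r)) (+ N) _ (begin
        + (p ∸ suc r) ℤ.+ + N            ≡⟨ cong +_ eq ⟩
        + (k * p)                        ≡⟨ ℤ.pos-* k p ⟩
        + k ℤ.* + p                      ≡⟨ alg (+ k) κ (+ p) ⟩
        + p ℤ.+ (κ ℤ.* + p ℤ.+ (+ k ℤ.- κ ℤ.- ℤ.1ℤ) ℤ.* + p)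
          ≡⟨ cong (ℤ._+ (κ ℤ.* + p ℤ.+ (+ k ℤ.- κ ℤ.- ℤ.1ℤ) ℤ.* + p)) (cong +_ (sym (m∸n+n≡m (<⇒≤ r<p)))) ⟩
        + (p ∸ suc r) ℤ.+ + suc r ℤ.+ (κ ℤ.* + p ℤ.+ (+ k ℤ.- κ ℤ.- ℤ.1ℤ) ℤ.* + p)
          ≡⟨ alg₂ (+ (p ∸ suc r)) (+ suc r) (κ ℤ.* + p) _ ⟩
        + (p ∸ suc r) ℤ.+ (+ suc r ℤ.+ κ ℤ.* + p ℤ.+ (+ k ℤ.- κ ℤ.- ℤ.1ℤ) ℤ.* + p)
          ≡⟨ cong (λ t → + (p ∸ suc r) ℤ.+ (t ℤ.+ (+ k ℤ.- κ ℤ.- ℤ.1ℤ) ℤ.* + p)) (sym a≡) ⟩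
        + (p ∸ suc r) ℤ.+ (a ℤ.+ (+ k ℤ.- κ ℤ.- ℤ.1ℤ) ℤ.* + p) ∎))
    where
    open ≡-Reasoning
    instance p≢0 = prime⇒nonZero pp
    κ = a /ℕ p
    alg : ∀ k κ p → k ℤ.* p ≡ p ℤ.+ (κ ℤ.* p ℤ.+ (k ℤ.- κ ℤ.- ℤ.1ℤ) ℤ.* p)
    alg = ℤ-Solver.solve-∀
    alg₂ : ∀ a b c d → a ℤ.+ b ℤ.+ (c ℤ.+ d) ≡ a ℤ.+ (b ℤ.+ c ℤ.+ d)
    alg₂ = ℤ-Solver.solve-∀

  smooth? : ∀ y n .{{_ : NonZero n}} → Dec (Smooth y n)
  smooth? y n = map′ (λ all q pq q∣n → all (s≤s (∣⇒≤ q∣n)) pq q∣n) (λ sm {q} _ → sm q)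
    (allUpTo? (λ q → prime? q →-dec (q ∣? n →-dec q ≤? y)) (suc n))

  squareFree? : ∀ n .{{_ : NonZero n}} → Dec (SquareFree n)
  squareFree? n = map′ (λ all q pq q²∣n → all (s≤s (∣⇒≤ (∣-trans (m∣m*n {q} (q * 1)) q²∣n))) pq q²∣n) (λ sf {q} _ → sf q)
    (allUpTo? (λ q → prime? q →-dec ¬? (q ^ 2 ∣? n)) (suc n))

  represents? : ∀ p m a n → Dec (Represents p m a n)
  represents? p m a zero    = no λ { (() , _) }
  represents? p m a (suc n) =
    (0 <? suc n) ×-dec (suc n ≤? m) ×-dec smooth? p (suc n) ×-dec squareFree? (suc n) ×-dec (p ∣? ℤ.∣ (+ suc n) ℤ.- a ∣)

  -- The value M(p) has to be exhibited, so its minimality needs a decidable search. It is finite: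
  -- the classes are those of i < p, and representatives are at most m.
  coversResidues? : ∀ {p} → Prime p → ∀ m → Dec (CoversResidues p m)
  coversResidues? {p} pp m = map′ to from
    (allUpTo? (λ i → anyUpTo? (represents? p m (+ i)) (suc m)) p)
    where
    instance p≢0 = prime⇒nonZero pp
    from : CoversResidues p m → ∀ {i} → i < p → ∃[ n ] n < suc m × Represents p m (+ i) n
    from cov {i} _ with cov (+ i)
    ... | n , rep@(_ , n≤m , _) = n , s≤s n≤m , rep
    to : (∀ {i} → i < p → ∃[ n ] n < suc m × Represents p m (+ i) n) → CoversResidues p m
    to all a with all (n%ℕd<d a p)
    ... | n , _ , n>0 , n≤m , sm , sf , p∣ with Signed.∣ᵤ⇒∣ {+ p} {+ n ℤ.- + (a %ℕ p)} p∣
    ...   | Signed.divides k eq = n , n>0 , n≤m , sm , sf , ∣-difference a (k ℤ.- a /ℕ p) n (begin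
        + n                                             ≡⟨ alg (+ n) (+ (a %ℕ p)) ⟩
        + (a %ℕ p) ℤ.+ (+ n ℤ.- + (a %ℕ p))             ≡⟨ cong (λ t → + (a %ℕ p) ℤ.+ t) eq ⟩
        + (a %ℕ p) ℤ.+ k ℤ.* + p                        ≡⟨ alg₂ (+ (a %ℕ p)) k (a /ℕ p) (+ p) ⟩
        + (a %ℕ p) ℤ.+ a /ℕ p ℤ.* + p ℤ.+ (k ℤ.- a /ℕ p) ℤ.* + p
                                                        ≡⟨ cong (ℤ._+ (k ℤ.- a /ℕ p) ℤ.* + p) (sym (a≡a%ℕn+[a/ℕn]*n a p)) ⟩
        a ℤ.+ (k ℤ.- a /ℕ p) ℤ.* + p                    ∎)
      where
      open ≡-Reasoning
      alg : ∀ n r → n ≡ r ℤ.+ (n ℤ.- r)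
      alg = ℤ-Solver.solve-∀
      alg₂ : ∀ r k q p → r ℤ.+ k ℤ.* p ≡ r ℤ.+ q ℤ.* p ℤ.+ (k ℤ.- q) ℤ.* p
      alg₂ = ℤ-Solver.solve-∀

  least : ∀ {P : ℕ → Set} → (∀ m → Dec (P m)) → ∀ B → P B → ∃[ m ] m ≤ B × P m × (∀ m′ → P m′ → m ≤ m′)
  least {P} P? = <-rec _ step
    where
    step : ∀ B → (∀ {m} → m < B → P m → ∃[ m′ ] m′ ≤ m × P m′ × (∀ m″ → P m″ → m′ ≤ m″)) →
           P B → ∃[ m ] m ≤ B × P m × (∀ m′ → P m′ → m ≤ m′)
    step B rec PB with anyUpTo? P? B
    ... | no none = B , ≤-refl , PB , λ m′ Pm′ → ≮⇒≥ λ m′<B → none (m′ , m′<B , Pm′)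
    ... | yes (m , m<B , Pm) with rec m<B Pm
    ...   | m′ , m′≤m , Pm′ , min = m′ , ≤-trans m′≤m (<⇒≤ m<B) , Pm′ , min

-- One function o(1) from the bounds for all K.

module Exponent where

  open import Data.Integer as ℤ using (ℤ; +_; -[1+_])
  open import Data.Nat hiding (_/_)
  open import Data.Nat.Properties
  import Data.Integer.Properties as ℤ
  open import Data.Rational as ℚ using (ℚ; mkℚ; ↥_; ↧ₙ_; _/_) renaming (_+_ to _+ℚ_)
  import Data.Rational.Properties as ℚ
  open import Data.Rational.Unnormalised as ℚᵘ using (mkℚᵘ; *≡*)
  open Parameters
  open Covering

  ^-cancelˡ-≤ : ∀ e .{{_ : NonZero e}} {m n} → m ^ e ≤ n ^ e → m ≤ n
  ^-cancelˡ-≤ e le = ≮⇒≥ λ n<m → <⇒≱ (^-monoˡ-< e n<m) le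

  1/suc : ℕ → ℚ
  1/suc κ = mkℚ (+ 1) κ (1-coprimeTo (suc κ))

  -- Addition in ℚ cancels common factors, so the numerator and denominator of 3/2 + 1/K are not
  -- given by a formula. Comparison with the unnormalised fraction (3K+2)/(2K) still gives their
  -- ratio.
  cross-multiply : ∀ r {n d} → ℚ.toℚᵘ r ℚᵘ.≃ mkℚᵘ n d → ↥ r ℤ.* + suc d ≡ n ℤ.* + (↧ₙ r)
  cross-multiply (mkℚ _ _ _) (*≡* eq) = eq

  3/2+1/K : ∀ κ → let r = (+ 3) / 2 +ℚ 1/suc κ in
            ↥ r ℤ.* + (2 * suc κ) ≡ + (3 * suc κ + 2) ℤ.* + (↧ₙ r)
  3/2+1/K κ = cross-multiply ((+ 3) / 2 +ℚ 1/suc κ) {+ (3 * suc κ + 2)} (ℚ.toℚᵘ-homo-+ ((+ 3) / 2) (1/suc κ))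

  -- Only the ratio of numerator and denominator of `r` is known. So both sides are raised to the
  -- power 2K, where the hypothesis on `M` applies, and the root is taken at the end.
  powerBound : ∀ {M p} r κ → ↥ r ℤ.* + (2 * suc κ) ≡ + (3 * suc κ + 2) ℤ.* + (↧ₙ r) →
               M ^ (2 * suc κ) ≤ p ^ (3 * suc κ + 2) → [ M ] ≤ p ^ℚ r
  powerBound {M} {p} r κ eq le = go (↥ r) (↧ₙ r) eq
    where
    K = suc κ
    go : ∀ n d → n ℤ.* + (2 * K) ≡ + (3 * K + 2) ℤ.* + d → PowerBound M p n d
    go -[1+ n ] d eq = contradiction (trans eq (sym (ℤ.pos-* (3 * K + 2) d))) λ ()
    go (+ n)    d eq = ^-cancelˡ-≤ (2 * K) (begin
      (M ^ d) ^ (2 * K)        ≡⟨ trans (^-*-assoc M d (2 * K))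
            (trans (cong (M ^_) (*-comm d (2 * K))) (sym (^-*-assoc M (2 * K) d))) ⟩
      (M ^ (2 * K)) ^ d        ≤⟨ ^-monoˡ-≤ d le ⟩
      (p ^ (3 * K + 2)) ^ d    ≡⟨ ^-*-assoc p (3 * K + 2) d ⟩
      p ^ ((3 * K + 2) * d)    ≡⟨ cong (p ^_) (sym
            (ℤ.+-injective (trans (ℤ.pos-* n (2 * K)) (trans eq (sym (ℤ.pos-* (3 * K + 2) d)))))) ⟩
      p ^ (n * (2 * K))        ≡⟨ sym (^-*-assoc p n (2 * K)) ⟩
      (p ^ n) ^ (2 * K)        ∎)
      where open ≤-Reasoning

  module _ (threshold : ℕ → ℕ)
           (representable : ∀ κ p → Prime p → threshold κ ≤ p →
              ∃[ B ] B ^ (2 * suc κ) ≤ p ^ (3 * suc κ + 2) × p ≤ B × Representable p B) where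

    -- 0 if no κ ≤ i has threshold κ ≤ p.
    search : ℕ → ℕ → ℕ
    search p zero    = zero
    search p (suc i) with threshold (suc i) ≤? p
    ... | yes _ = suc i
    ... | no  _ = search p i

    -- The default 0 is legitimate by the assumption `threshold 0 ≤ p`; this is why `p₀` in the
    -- final statement is `threshold 0`.
    search-valid : ∀ p i → threshold 0 ≤ p → threshold (search p i) ≤ p
    search-valid p zero    le = le
    search-valid p (suc i) le with threshold (suc i) ≤? p
    ... | yes le′ = le′
    ... | no  _   = search-valid p i le

    search-largest : ∀ p i κ → κ ≤ i → threshold κ ≤ p → κ ≤ search p i
    search-largest p zero    κ κ≤i le = κ≤i
    search-largest p (suc i) κ κ≤i le with threshold (suc i) ≤? p
    ... | yes _  = κ≤i
    ... | no  gt = search-largest p i κ (s≤s⁻¹ (≤∧≢⇒< κ≤i λ { refl → gt le })) le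

    -- Each exponent 3/2 + 1/K is admissible from a threshold of its own; for every p the best K
    -- found so far is taken.
    o : ℕ → ℚ
    o p = 1/suc (search p p)

    o→0 : TendsToZeroAlongPrimes o
    o→0 (mkℚ (+ zero) d _)   (ℚ.*<* (ℤ.+<+ ()))
    o→0 (mkℚ -[1+ n ] d _)   (ℚ.*<* ())
    -- The summand `suc d` makes the search, which stops at p, reach κ = d + 1. Then o p ≤ 1/(d+2) <
    -- 1/(d+1) ≤ ε.
    o→0 (mkℚ (+ suc n) d _)  _ = threshold (suc d) + suc d , λ p _ N≤p → ℚ.*<* (small p
      (search-largest p p (suc d) (≤-trans (m≤n+m (suc d) (threshold (suc d))) N≤p)
            (≤-trans (m≤m+n (threshold (suc d)) (suc d)) N≤p)))
      where
      small : ∀ p → suc d ≤ search p p → + 1 ℤ.* + suc d ℤ.< + suc n ℤ.* + suc (search p p)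
      small p le = subst₂ ℤ._<_ (ℤ.pos-* 1 (suc d)) (ℤ.pos-* (suc n) (suc (search p p))) (ℤ.+<+ (begin-strict
        1 * suc d                       ≡⟨ *-identityˡ (suc d) ⟩
        suc d                           <⟨ s≤s le ⟩
        suc (search p p)                ≤⟨ m≤n*m (suc (search p p)) (suc n) ⟩
        suc n * suc (search p p)        ∎))
        where open ≤-Reasoning

    M-bound : ∀ p → Prime p → threshold 0 ≤ p → ∃[ M ] IsM p M × (M ≤ p ^ℚ ((+ 3) / 2 +ℚ o p))
    M-bound p pp p₀≤p =
      let κ = search p p
          B , B^≤ , p≤B , rep = representable κ p pp (search-valid p p p₀≤p)
          M , M≤B , cov , min = least (coversResidues? pp) B (covers pp p≤B rep)
      in [ M ] , (cov , min) , powerBound ((+ 3) / 2 +ℚ o p) κ (3/2+1/K κ) (≤-trans (^-monoˡ-≤ (2 * suc κ) M≤B) B^≤)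

  bound : ∃[ o ] TendsToZeroAlongPrimes o × (∃[ p₀ ] (∀ p → Prime p → p₀ ≤ p → ∃[ M ] IsM p M × (M ≤ p ^ℚ ((+ 3) / 2 +ℚ o p))))
  bound = o T R , o→0 T R , T 0 , M-bound T R
    where
    T = λ κ → proj₁ (eventually-representable (suc κ) (s≤s z≤n))
    R = λ κ → proj₂ (eventually-representable (suc κ) (s≤s z≤n))

open import Data.Nat using (ℕ; _≤_)
open import Data.Nat.Primality using (Prime)
open import Data.Integer using (+_)
open import Data.Rational using (ℚ; _+_; _/_)
open import Data.Product using (_×_; ∃-syntax)

theorem1p4 : ∃[ o ] TendsToZeroAlongPrimes o × (∃[ p₀ ] (∀ p → Prime p → p₀ ≤ p → ∃[ M ] IsM p M × (M ≤ p ^ℚ ((+ 3) / 2 + o p))))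
theorem1p4 = Exponent.bound
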